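{- For every finite simple graph $G$ the following are equivalent. (1) $G$ is line $[B,-]$-perfect. (2) None of the following is an edge-induced subgraph of $G$: $P_5\cup P_2$, $C_4\cup P_2$, $P_6$, $C_5$, the bull, the diamond, or the 3-caterpillar $F_1$. (3) Either every component of $G$ is a double star, a vase of flowers, or an isolated vertex; or $G$ has at most one nontrivial component (component containing an edge) and this component is a double star, a vase of flowers, a candy, a shooting star, a double vase, or an amaryllis.
   Context: All graphs are finite and simple; two edges are adjacent if they share an endpoint. For $X\in\{A,B\}$, $Y\in\{A,B,-\}$ and $k\in\mathbb N$, the $[X,Y]$-edge colouring game with $k$ colours on a graph $G$ is played by Alice (A) and Bob (B), who alternately colour a previously uncoloured edge with one of the $k$ colours so that adjacent edges always get distinct colours; player $X$ moves first; if $Y\in\{A,B\}$, only player $Y$ may skip any of his/her moves, and if $Y=-$ no player may skip. The game ends when no move is possible; Alice wins iff all edges are coloured. $\chi'_{[X,Y]}(G)$ is the least $k\ge0$ for which Alice has a winning strategy. $\omega(L(G))$ is the maximum number of pairwise adjacent edges of $G$. An edge-induced subgraph of $G$ is a subgraph formed by a subset of the edges together with their endpoints; "$H$ is an edge-induced subgraph of $G$" means $G$ has one isomorphic to $H$. $G$ is line $[X,Y]$-perfect if $\chi'_{[X,Y]}(H)=\omega(L(H))$ for every edge-induced subgraph $H$ of $G$. $P_n$, $C_n$ are the path and cycle on $n$ vertices, $\cup$ is disjoint union. The bull is a triangle with pendant edges at two distinct vertices; the diamond is $K_4$ minus an edge. The 3-caterpillar $F_1$ is the tree with vertices $v,u,w_1,w_2,a_1,a_2,b_1,b_2$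 and edges $vu,vw_1,vw_2,w_1a_1,w_1a_2,w_2b_1,w_2b_2$. Permitted types (parameters in $\mathbb N$): a vase of $n$ flowers is a triangle $w_1w_2w_3$ plus $n$ leaves attached to $w_1$. An $(m,n)$-double star is an edge $w_1w_2$ plus $m$ leaves attached to $w_1$ and $n$ leaves attached to $w_2$. For $m\ge1$, an $(m,n_1,n_2)$-candy is $K_{2,m}$ with parts $\{v_1,v_2\}$, $\{w_1,\dots,w_m\}$ plus $n_1$ leaves attached to $v_1$ and $n_2$ leaves attached to $v_2$. An $(m,n)$-shooting star has vertices $v,w,a,b,x_1,\dots,x_m,y_1,\dots,y_n$ and edges $wv,va,ab,wx_i,vy_j$. A double vase of $n$ flowers is two triangles $vx_1x_2$ and $vy_1y_2$ sharing only $v$, plus $n$ leaves attached to $v$. An $(m,n)$-amaryllis has vertices $v,w,c_1,c_2,x_1,\dots,x_m,y_1,\dots,y_n$ and edges $wv,vc_1,c_1c_2,c_2v,wx_i,vy_j$. -}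

module Defs where

open import Data.Nat using (ℕ; zero; suc; _+_; _<_; _≤_)
open import Data.Fin using (Fin; toℕ)
open import Data.Bool using (Bool; true; false; _∧_; _∨_; not; if_then_else_)
open import Data.Bool.Properties using (∨-comm)
open import Data.List using (List; []; _∷_; _++_; map; upTo)
open import Data.Maybe using (Maybe; just; nothing)
open import Data.Product using (Σ; ∃; ∃-syntax; _×_; _,_; proj₁; proj₂)
open import Data.Sum using (_⊎_)
open import Relation.Nullary using (¬_)
open import Relation.Binary.PropositionalEquality using (_≡_; _≢_; refl; cong; cong₂)
open import Function.Definitions using (Injective)

record Graph : Set where
  field
    n   : ℕ
    adj : Fin n → Fin n → Bool
    sym : ∀ u v → adj u v ≡ adj v u
    irr : ∀ u → adj u u ≡ false
open Graph public

eqℕ : ℕ → ℕ → Bool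
eqℕ zero    zero    = true
eqℕ zero    (suc _) = false
eqℕ (suc _) zero    = false
eqℕ (suc m) (suc k) = eqℕ m k

eqℕ-sym : ∀ m k → eqℕ m k ≡ eqℕ k m
eqℕ-sym zero    zero    = refl
eqℕ-sym zero    (suc _) = refl
eqℕ-sym (suc _) zero    = refl
eqℕ-sym (suc m) (suc k) = eqℕ-sym m k

eqℕ-refl : ∀ m → eqℕ m m ≡ true
eqℕ-refl zero    = refl
eqℕ-refl (suc m) = eqℕ-refl m

matchᵇ : ℕ → ℕ → ℕ → ℕ → Bool
matchᵇ a b u v = (eqℕ a u ∧ eqℕ b v) ∨ (eqℕ a v ∧ eqℕ b u)

hasEdge : List (ℕ × ℕ) → ℕ → ℕ → Bool
hasEdge []             u v = false
hasEdge ((a , b) ∷ es) u v = matchᵇ a b u v ∨ hasEdge es u v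

hasEdge-sym : ∀ es u v → hasEdge es u v ≡ hasEdge es v u
hasEdge-sym []             u v = refl
hasEdge-sym ((a , b) ∷ es) u v =
  cong₂ _∨_ (∨-comm (eqℕ a u ∧ eqℕ b v) (eqℕ a v ∧ eqℕ b u)) (hasEdge-sym es u v)

fromEdges : ℕ → List (ℕ × ℕ) → Graph
fromEdges k es = record
  { n   = k
  ; adj = λ u v → not (eqℕ (toℕ u) (toℕ v)) ∧ hasEdge es (toℕ u) (toℕ v)
  ; sym = λ u v → cong₂ (λ x y → not x ∧ y) (eqℕ-sym (toℕ u) (toℕ v)) (hasEdge-sym es (toℕ u) (toℕ v))
  ; irr = λ u → cong (λ x → not x ∧ hasEdge es (toℕ u) (toℕ u)) (eqℕ-refl (toℕ u))
  }

-- H is (isomorphic to) an edge-induced subgraph of G: H has no isolated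
-- vertices (it consists of a set of edges with their endpoints) and there is
-- an injective vertex map sending edges of H to edges of G.
EdgeSub : Graph → Graph → Set
EdgeSub H G =
  Σ (Fin (n H) → Fin (n G)) λ φ →
    Injective _≡_ _≡_ φ
    × (∀ x y → adj H x y ≡ true → adj G (φ x) (φ y) ≡ true)
    × (∀ x → ∃[ y ] adj H x y ≡ true)

IsEdge : (G : Graph) → Fin (n G) × Fin (n G) → Set
IsEdge G (u , v) = (toℕ u < toℕ v) × adj G u v ≡ true

ShareEnd : ∀ {m} → Fin m × Fin m → Fin m × Fin m → Set
ShareEnd (a , b) (c , d) = (a ≡ c) ⊎ (a ≡ d) ⊎ (b ≡ c) ⊎ (b ≡ d)

EdgeClique : Graph → ℕ → Set
EdgeClique G j =
  Σ (Fin j → Fin (n G) × Fin (n G)) λ f →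
    (∀ i → IsEdge G (f i))
    × Injective _≡_ _≡_ f
    × (∀ i i' → i ≢ i' → ShareEnd (f i) (f i'))

OmegaL : Graph → ℕ → Set
OmegaL G w = EdgeClique G w × (∀ j → EdgeClique G j → j ≤ w)

data Player : Set where
  alice bob : Player

-- partial colouring: colour (or nothing) of the edge uv, stored symmetrically
Colouring : Graph → ℕ → Set
Colouring G k = Fin (n G) → Fin (n G) → Maybe (Fin k)

emptyCol : ∀ {G k} → Colouring G k
emptyCol _ _ = nothing

eqF : ∀ {m} → Fin m → Fin m → Bool
eqF x y = eqℕ (toℕ x) (toℕ y)

setCol : ∀ {G k} → Colouring G k → Fin (n G) → Fin (n G) → Fin k → Colouring G k
setCol c u v col x y =
  if (eqF x u ∧ eqF y v) ∨ (eqF x v ∧ eqF y u) then just col else c x y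

Legal : ∀ {G k} → Colouring G k → Fin (n G) → Fin (n G) → Fin k → Set
Legal {G} c u v col =
  adj G u v ≡ true × c u v ≡ nothing
  × (∀ w → c u w ≢ just col) × (∀ w → c v w ≢ just col)

AllColoured : ∀ {G k} → Colouring G k → Set
AllColoured {G} c = ∀ u v → adj G u v ≡ true → ∃[ col ] c u v ≡ just col

-- Alice has a winning strategy from position c with player p to move,
-- when no player may skip.  The game is finite, so an inductive
-- definition is appropriate.
data AliceWins (G : Graph) (k : ℕ) : Colouring G k → Player → Set where
  finished : ∀ {c p} → AllColoured {G} c → AliceWins G k c p
  aliceMoves : ∀ {c} u v col → Legal {G} c u v col →
               AliceWins G k (setCol {G} c u v col) bob → AliceWins G k c alice
  bobMoves : ∀ {c} →
             (∃[ u ] ∃[ v ] ∃[ col ] Legal {G} c u v col) →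
             (∀ u v col → Legal {G} c u v col →
                AliceWins G k (setCol {G} c u v col) alice) →
             AliceWins G k c bob

AliceWinsBminus : Graph → ℕ → Set
AliceWinsBminus G k = AliceWins G k (emptyCol {G} {k}) bob

ChiBminus : Graph → ℕ → Set
ChiBminus G k = AliceWinsBminus G k × (∀ j → j < k → ¬ AliceWinsBminus G j)

LineBminusPerfect : Graph → Set
LineBminusPerfect G = ∀ H → EdgeSub H G → ∀ w → OmegaL H w → ChiBminus H w

P5∪P2 : Graph
P5∪P2 = fromEdges 7 ((0 , 1) ∷ (1 , 2) ∷ (2 , 3) ∷ (3 , 4) ∷ (5 , 6) ∷ [])

C4∪P2 : Graph
C4∪P2 = fromEdges 6 ((0 , 1) ∷ (1 , 2) ∷ (2 , 3) ∷ (3 , 0) ∷ (4 , 5) ∷ [])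

P6 : Graph
P6 = fromEdges 6 ((0 , 1) ∷ (1 , 2) ∷ (2 , 3) ∷ (3 , 4) ∷ (4 , 5) ∷ [])

C5 : Graph
C5 = fromEdges 5 ((0 , 1) ∷ (1 , 2) ∷ (2 , 3) ∷ (3 , 4) ∷ (4 , 0) ∷ [])

bull : Graph
bull = fromEdges 5 ((0 , 1) ∷ (1 , 2) ∷ (2 , 0) ∷ (0 , 3) ∷ (1 , 4) ∷ [])

diamond : Graph
diamond = fromEdges 4 ((0 , 1) ∷ (0 , 2) ∷ (0 , 3) ∷ (1 , 2) ∷ (1 , 3) ∷ [])

-- v=0, u=1, w1=2, w2=3, a1=4, a2=5, b1=6, b2=7
F₁ : Graph
F₁ = fromEdges 8 ((0 , 1) ∷ (0 , 2) ∷ (0 , 3) ∷ (2 , 4) ∷ (2 , 5) ∷ (3 , 6) ∷ (3 , 7) ∷ [])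

NoForbidden : Graph → Set
NoForbidden G =
  ¬ EdgeSub P5∪P2 G × ¬ EdgeSub C4∪P2 G × ¬ EdgeSub P6 G × ¬ EdgeSub C5 G
  × ¬ EdgeSub bull G × ¬ EdgeSub diamond G × ¬ EdgeSub F₁ G

leaves : ℕ → ℕ → ℕ → List (ℕ × ℕ)
leaves c s t = map (λ i → (c , s + i)) (upTo t)

K₁ : Graph
K₁ = fromEdges 1 []

-- vase of p flowers: triangle w1=0,w2=1,w3=2, leaves 3.. at w1
vase : ℕ → Graph
vase p = fromEdges (3 + p) ((0 , 1) ∷ (1 , 2) ∷ (2 , 0) ∷ leaves 0 3 p)

-- (m,p)-double star: w1=0, w2=1
doubleStar : ℕ → ℕ → Graph
doubleStar m p = fromEdges (2 + m + p) ((0 , 1) ∷ leaves 0 2 m ++ leaves 1 (2 + m) p)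

-- (m,n1,n2)-candy (used with m ≥ 1): v1=0, v2=1, w_i = 2+i,
-- leaves of v1 from 2+m, leaves of v2 from 2+m+n1
candy : ℕ → ℕ → ℕ → Graph
candy m n₁ n₂ = fromEdges (2 + m + n₁ + n₂)
  (leaves 0 2 m ++ leaves 1 2 m ++ leaves 0 (2 + m) n₁ ++ leaves 1 (2 + m + n₁) n₂)

-- (m,p)-shooting star: v=0, w=1, a=2, b=3, x_i = 4+i, y_j = 4+m+j
shootingStar : ℕ → ℕ → Graph
shootingStar m p = fromEdges (4 + m + p)
  ((1 , 0) ∷ (0 , 2) ∷ (2 , 3) ∷ leaves 1 4 m ++ leaves 0 (4 + m) p)

-- double vase of p flowers: v=0, x1=1, x2=2, y1=3, y2=4, leaves from 5
doubleVase : ℕ → Graph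
doubleVase p = fromEdges (5 + p)
  ((0 , 1) ∷ (1 , 2) ∷ (2 , 0) ∷ (0 , 3) ∷ (3 , 4) ∷ (4 , 0) ∷ leaves 0 5 p)

-- (m,p)-amaryllis: v=0, w=1, c1=2, c2=3, x_i = 4+i, y_j = 4+m+j
amaryllis : ℕ → ℕ → Graph
amaryllis m p = fromEdges (4 + m + p)
  ((1 , 0) ∷ (0 , 2) ∷ (2 , 3) ∷ (3 , 0) ∷ leaves 1 4 m ++ leaves 0 (4 + m) p)

data Reach (G : Graph) : Fin (n G) → Fin (n G) → Set where
  here : ∀ {u} → Reach G u u
  step : ∀ {u v w} → adj G u v ≡ true → Reach G v w → Reach G u w

CompIso : (G : Graph) → Fin (n G) → Graph → Set
CompIso G u T =
  Σ (Fin (n T) → Fin (n G)) λ φ →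
    Injective _≡_ _≡_ φ
    × (∀ x y → adj T x y ≡ adj G (φ x) (φ y))
    × (∀ x → Reach G u (φ x))
    × (∀ v → Reach G u v → ∃[ x ] φ x ≡ v)

Nontrivial : (G : Graph) → Fin (n G) → Set
Nontrivial G u = ∃[ x ] ∃[ y ] (Reach G u x × adj G x y ≡ true)

IsDoubleStarComp IsVaseComp IsIsolatedComp : (G : Graph) → Fin (n G) → Set
IsDoubleStarComp G u = ∃[ m ] ∃[ p ] CompIso G u (doubleStar m p)
IsVaseComp G u = ∃[ p ] CompIso G u (vase p)
IsIsolatedComp G u = CompIso G u K₁

IsPermittedComp : (G : Graph) → Fin (n G) → Set
IsPermittedComp G u =
  IsDoubleStarComp G u
  ⊎ IsVaseComp G u
  ⊎ (∃[ m ] ∃[ n₁ ] ∃[ n₂ ] (1 ≤ m × CompIso G u (candy m n₁ n₂)))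
  ⊎ (∃[ m ] ∃[ p ] CompIso G u (shootingStar m p))
  ⊎ (∃[ p ] CompIso G u (doubleVase p))
  ⊎ (∃[ m ] ∃[ p ] CompIso G u (amaryllis m p))

Structure : Graph → Set
Structure G =
  (∀ u → IsDoubleStarComp G u ⊎ IsVaseComp G u ⊎ IsIsolatedComp G u)
  ⊎ ((∀ u v → Nontrivial G u → Nontrivial G v → Reach G u v)
     × (∀ u → Nontrivial G u → IsPermittedComp G u))

{-# OPTIONS --safe #-}

-- For an uncoloured edge xy consider the number of uncoloured edges at x and y against
-- the number of colours still free for xy.  This balance never gets worse, and it gets
-- strictly better when a colour already seen at one end is repeated at the other.  Edges
-- whose balance is good (all leaf edges, and more generally edges with small degree sum)
-- can be coloured whatever happens, so Alice only has to look after the few remaining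
-- ones: the centre of a double star, the edges at a hub of a triangle, or the edges v₁w,
-- v₂w of a candy, for which she keeps the colour sets at v₁ and v₂ equal or takes care
-- that the last open edge at v₁ is not killed.
--
-- A graph without the seven forbidden subgraphs either contains a C₄ (then it is a candy),
-- or no C₄ but a P₅ (then all edges meet the P₅, and chords and leaves leave only the
-- other permitted types), or neither (then each component is a double star, a vase or a
-- vertex).  Conversely, a forbidden subgraph inside a permitted graph would give a map to
-- a finite pattern of vertex classes; that none exists is a finite search, as is Bob's
-- win on each of the seven graphs.

module Submission where

open import Defs
open import Data.Bool using (Bool; true; false; _∧_; _∨_; not; if_then_else_)
import Data.Bool
import Data.Bool.Properties as Bool
open import Data.Empty using (⊥; ⊥-elim)
open import Data.Fin as Fin using (Fin; toℕ; zero; suc)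
open import Data.Fin.Patterns using (0F; 1F; 2F; 3F; 4F; 5F; 6F; 7F)
import Data.Fin.Properties as Fin
open import Data.List using (List; []; _∷_; _++_; length)
open import Data.List.Membership.Propositional using (_∈_; _∉_; find; lose)
open import Data.List.Membership.Propositional.Properties using (∈-++⁺ʳ; ∈-upTo⁺; ∈-upTo⁻)
open import Data.List.Relation.Unary.All as All using (All; []; _∷_)
open import Data.List.Relation.Unary.AllPairs using (AllPairs; []; _∷_)
open import Data.List.Relation.Unary.Any as Any using (Any; here; there)
import Data.List.Relation.Unary.Any.Properties as Any
open import Data.Maybe using (Maybe; just; nothing)
import Data.Maybe
import Data.Maybe.Properties as Maybe
open import Data.Nat using (ℕ; zero; suc; _+_; _<_; _≤_; z≤n; s≤s; _∸_)
import Data.Nat as ℕ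
import Data.Nat.Properties as ℕ
open import Data.Product using (∃; ∃-syntax; _×_; _,_; proj₁; proj₂)
import Data.Product.Properties as Product
open import Data.Sum using (_⊎_; inj₁; inj₂; [_,_]′)
import Data.Sum as Sum
open import Data.Unit using (⊤; tt)
open import Data.Vec as Vec using (Vec; []; _∷_; lookup)
import Data.Vec.Properties as Vec
open import Function.Base using (_∘_; id; case_of_)
open import Function.Bundles using (_⇔_; mk⇔)
open import Function.Definitions using (Injective)
open import Relation.Binary.Definitions using (tri<; tri≈; tri>)
open import Relation.Binary.PropositionalEquality
  using (_≡_; _≢_; refl; cong; cong₂; subst; trans) renaming (sym to ≡-sym)
open import Relation.Nullary using (¬_; Dec; yes; no; does)
open import Relation.Nullary.Decidable using (True; toWitness; _×-dec_; _⊎-dec_; _→-dec_; ¬?)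

-- The obstacle is that Alice may not skip: after a harmless move of Bob she still has to find a
-- move that spoils nothing. Positions are therefore kept together with a list of threats, the edges
-- that may lack slack. A single threat is harmless as long as two colours are free for it, because
-- Bob's move takes away at most one of them. Perfection speaks of all edge-induced subgraphs, but
-- the absence of the seven graphs is inherited by them, so it suffices that Alice wins on each such
-- graph with ω colours. Of ω only two facts enter: it bounds every degree, and it is at least 3 if
-- there is a triangle. Fewer colours cannot do, since a finished game is a proper edge colouring.
-- Leaves at the same vertex are interchangeable, and so are the middle vertices of a candy. Hence
-- each permitted family consists of the blow-ups of one fixed pattern graph, with one label per
-- class. The pattern serves Alice's strategies, the isomorphisms with the templates, and the search
-- that excludes the forbidden graphs.

-- Booleans, counting and enumeration in finite sets

true≢false : ∀ {b} → b ≡ true → b ≡ false → ⊥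
true≢false refl ()

∧-true : ∀ {a b} → a ∧ b ≡ true → a ≡ true × b ≡ true
∧-true {true} {true} refl = refl , refl

∧-intro : ∀ {a b} → a ≡ true → b ≡ true → a ∧ b ≡ true
∧-intro refl refl = refl

∨-true : ∀ {a b} → a ∨ b ≡ true → a ≡ true ⊎ b ≡ true
∨-true {true}  _ = inj₁ refl
∨-true {false} p = inj₂ p

∨-introʳ : ∀ a {b} → b ≡ true → a ∨ b ≡ true
∨-introʳ true  _ = refl
∨-introʳ false p = p

∨-introˡ : ∀ {a} b → a ≡ true → a ∨ b ≡ true
∨-introˡ _ refl = refl

not-true : ∀ {a} → not a ≡ true → a ≡ false
not-true {false} _ = refl

bool-ext : ∀ {a b} → (a ≡ true → b ≡ true) → (b ≡ true → a ≡ true) → a ≡ b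
bool-ext {true}  {b}     f g = ≡-sym (f refl)
bool-ext {false} {true}  f g = g refl
bool-ext {false} {false} f g = refl

≢true : ∀ {a} → (a ≡ true → ⊥) → a ≡ false
≢true {true}  f = ⊥-elim (f refl)
≢true {false} f = refl

bool? : ∀ b → b ≡ true ⊎ b ≡ false
bool? true  = inj₁ refl
bool? false = inj₂ refl

eqℕ⇒≡ : ∀ {a b} → eqℕ a b ≡ true → a ≡ b
eqℕ⇒≡ {zero}  {zero}  _ = refl
eqℕ⇒≡ {suc a} {suc b} p = cong suc (eqℕ⇒≡ p)

≡⇒eqℕ : ∀ {a b} → a ≡ b → eqℕ a b ≡ true
≡⇒eqℕ {a} refl = eqℕ-refl a

eqF⇒≡ : ∀ {m} {x y : Fin m} → eqF x y ≡ true → x ≡ y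
eqF⇒≡ p = Fin.toℕ-injective (eqℕ⇒≡ p)

≡⇒eqF : ∀ {m} {x y : Fin m} → x ≡ y → eqF x y ≡ true
≡⇒eqF p = ≡⇒eqℕ (cong toℕ p)

bit : Bool → ℕ
bit true  = 1
bit false = 0

count : ∀ {m} → (Fin m → Bool) → ℕ
count {zero}  P = 0
count {suc m} P = bit (P zero) + count (P ∘ suc)

bit-mono : ∀ {a b} → (a ≡ true → b ≡ true) → bit a ≤ bit b
bit-mono {false}        f = z≤n
bit-mono {true} {true}  f = s≤s z≤n
bit-mono {true} {false} f with () ← f refl

count-mono : ∀ {m} {P Q : Fin m → Bool} →
             (∀ x → P x ≡ true → Q x ≡ true) → count P ≤ count Q
count-mono {zero}  f = z≤n
count-mono {suc m} f = ℕ.+-mono-≤ (bit-mono (f zero)) (count-mono (f ∘ suc))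

count-cong : ∀ {m} {P Q : Fin m → Bool} → (∀ x → P x ≡ Q x) → count P ≡ count Q
count-cong {zero}  f = refl
count-cong {suc m} f = cong₂ _+_ (cong bit (f zero)) (count-cong (f ∘ suc))

count-drop : ∀ {m} {P Q : Fin m → Bool} a → (∀ x → x ≢ a → P x ≡ Q x) →
             P a ≡ true → Q a ≡ false → count P ≡ suc (count Q)
count-drop {suc m} zero f p q rewrite p | q =
  cong suc (count-cong (λ x → f (suc x) λ ()))
count-drop {suc m} {P} {Q} (suc a) f p q
  rewrite f zero (λ ())
        | count-drop {P = P ∘ suc} {Q ∘ suc} a
            (λ x x≢a → f (suc x) (x≢a ∘ Fin.suc-injective)) p q
  = ℕ.+-suc (bit (Q zero)) _

count-≤suc : ∀ {m} {P Q : Fin m → Bool} a →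
             (∀ x → x ≢ a → P x ≡ true → Q x ≡ true) → count P ≤ suc (count Q)
count-≤suc {suc m} {P} {Q} zero f with P zero
... | true  = s≤s (ℕ.≤-trans (count-mono (λ x → f (suc x) λ ())) (ℕ.m≤n+m _ (bit (Q zero))))
... | false = ℕ.m≤n⇒m≤1+n
                (ℕ.≤-trans (count-mono (λ x → f (suc x) λ ())) (ℕ.m≤n+m _ (bit (Q zero))))
count-≤suc {suc m} {P} {Q} (suc a) f =
  ℕ.≤-trans (ℕ.+-mono-≤ (bit-mono (f zero λ ()))
               (count-≤suc a (λ x x≢a → f (suc x) (x≢a ∘ Fin.suc-injective))))
            (ℕ.≤-reflexive (ℕ.+-suc (bit (Q zero)) _))

count-true : ∀ {m} {P : Fin m → Bool} → (∀ x → P x ≡ true) → count P ≡ m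
count-true {zero}  f = refl
count-true {suc m} f rewrite f zero = cong suc (count-true (f ∘ suc))

count-false : ∀ {m} {P : Fin m → Bool} → (∀ x → P x ≡ false) → count P ≡ 0
count-false {zero}  f = refl
count-false {suc m} f rewrite f zero = count-false (f ∘ suc)

count-pos : ∀ {m} {P : Fin m → Bool} → 1 ≤ count P → ∃[ x ] P x ≡ true
count-pos {suc m} {P} p with P zero in eq
... | true  = zero , eq
... | false = let x , q = count-pos p in suc x , q

count-pos⁺ : ∀ {m} {P : Fin m → Bool} {x} → P x ≡ true → 1 ≤ count P
count-pos⁺ {suc m} {P} {zero}  p rewrite p = s≤s z≤n
count-pos⁺ {suc m} {P} {suc x} p =
  ℕ.≤-trans (count-pos⁺ {P = P ∘ suc} p) (ℕ.m≤n+m _ (bit (P zero)))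

count-<⇒∃ : ∀ {m} {P Q : Fin m → Bool} → count P < count Q →
            ∃[ x ] (Q x ≡ true × P x ≡ false)
count-<⇒∃ {m} {P} {Q} P<Q = case Fin.any? dec of λ where
    (yes r) → r
    (no ¬r) → ⊥-elim (ℕ.<⇒≱ P<Q (count-mono λ x q → case bool? (P x) of λ where
        (inj₁ p) → p
        (inj₂ p) → ⊥-elim (¬r (x , q , p))))
  where
    dec : ∀ x → Dec (Q x ≡ true × P x ≡ false)
    dec x with Q x | P x
    ... | true  | false = yes (refl , refl)
    ... | true  | true  = no λ ()
    ... | false | _     = no λ ()

remove : ∀ {m} → (Fin m → Bool) → Fin m → Fin m → Bool
remove P a x = P x ∧ not (eqF x a)

remove-self : ∀ {m} (P : Fin m → Bool) a → remove P a a ≡ false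
remove-self P a rewrite ≡⇒eqF {x = a} refl = Bool.∧-zeroʳ (P a)

remove-other : ∀ {m} (P : Fin m → Bool) {a x} → x ≢ a → remove P a x ≡ P x
remove-other P {a} {x} x≢a rewrite ≢true (x≢a ∘ eqF⇒≡ {x = x} {a}) = Bool.∧-identityʳ (P x)

count-remove : ∀ {m} {P : Fin m → Bool} {a} → P a ≡ true → count P ≡ suc (count (remove P a))
count-remove {P = P} {a} p =
  count-drop a (λ x x≢a → ≡-sym (remove-other P x≢a)) p (remove-self P a)

count-≥2 : ∀ {m} {P : Fin m → Bool} a → 2 ≤ count P → ∃[ x ] (x ≢ a × P x ≡ true)
count-≥2 {P = P} a 2≤ = go (bool? (P a))
  where
    found : 1 ≤ count (remove P a) → ∃[ x ] (x ≢ a × P x ≡ true)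
    found q = let x , r = count-pos q
                  Px , x≠a = ∧-true {P x} r
              in x , (λ x≡a → true≢false (≡⇒eqF x≡a) (not-true x≠a)) , Px
    go : P a ≡ true ⊎ P a ≡ false → ∃[ x ] (x ≢ a × P x ≡ true)
    go (inj₁ p) = found (ℕ.≤-pred (subst (2 ≤_) (count-remove {P = P} p) 2≤))
    go (inj₂ p) = let x , q = count-pos {P = P} (ℕ.<⇒≤ 2≤)
                  in x , (λ where refl → true≢false q p) , q

count-≤length : ∀ {m} {P : Fin m → Bool} (xs : List (Fin m)) →
                (∀ x → P x ≡ true → x ∈ xs) → count P ≤ length xs
count-≤length {P = P} [] f with count P in eq
... | zero  = z≤n
... | suc _ with () ← f _ (proj₂ (count-pos {P = P} (ℕ.≤-trans (s≤s z≤n) (ℕ.≤-reflexive (≡-sym eq)))))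
count-≤length {P = P} (a ∷ xs) f =
  ℕ.≤-trans (count-≤suc a λ x x≢a p → trans (remove-other P x≢a) p)
            (s≤s (count-≤length {P = remove P a} xs λ x r → case f x (proj₁ (∧-true {P x} r)) of λ where
              (here refl) → ⊥-elim (true≢false r (remove-self P a))
              (there x∈)  → x∈))

-- The converse of counting: `Fin (count P)` indexes the elements of P. It lists the edges at a
-- vertex as a clique, and the members of a leaf class in the order of a template.
enum : ∀ {m} (P : Fin m → Bool) → Fin (count P) → Fin m
enum {suc m} P i with P zero
enum {suc m} P zero    | true  = zero
enum {suc m} P (suc i) | true  = suc (enum (P ∘ suc) i)
enum {suc m} P i       | false = suc (enum (P ∘ suc) i)

enum-sound : ∀ {m} (P : Fin m → Bool) i → P (enum P i) ≡ true
enum-sound {suc m} P i with P zero in eq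
enum-sound {suc m} P zero    | true  = eq
enum-sound {suc m} P (suc i) | true  = enum-sound (P ∘ suc) i
enum-sound {suc m} P i       | false = enum-sound (P ∘ suc) i

enum-injective : ∀ {m} (P : Fin m → Bool) {i j} → enum P i ≡ enum P j → i ≡ j
enum-injective {suc m} P {i} {j} e with P zero
enum-injective {suc m} P {zero}  {zero}  e | true  = refl
enum-injective {suc m} P {suc i} {suc j} e | true  =
  cong suc (enum-injective (P ∘ suc) (Fin.suc-injective e))
enum-injective {suc m} P {i}     {j}     e | false = enum-injective (P ∘ suc) (Fin.suc-injective e)

enum-complete : ∀ {m} (P : Fin m → Bool) x → P x ≡ true → ∃[ i ] enum P i ≡ x
enum-complete {suc m} P x p with P zero in eq
enum-complete {suc m} P zero    p | true  = zero , refl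
enum-complete {suc m} P (suc x) p | true  =
  let i , e = enum-complete (P ∘ suc) x p in suc i , cong suc e
enum-complete {suc m} P zero    p | false = ⊥-elim (true≢false p eq)
enum-complete {suc m} P (suc x) p | false =
  let i , e = enum-complete (P ∘ suc) x p in i , cong suc e

sumF : ∀ {m} → (Fin m → ℕ) → ℕ
sumF {zero}  f = 0
sumF {suc m} f = f zero + sumF (f ∘ suc)

sumF-mono : ∀ {m} {f g : Fin m → ℕ} → (∀ x → f x ≤ g x) → sumF f ≤ sumF g
sumF-mono {zero}  h = z≤n
sumF-mono {suc m} h = ℕ.+-mono-≤ (h zero) (sumF-mono (h ∘ suc))

sumF-mono-< : ∀ {m} {f g : Fin m → ℕ} a → (∀ x → f x ≤ g x) → f a < g a → sumF f < sumF g
sumF-mono-< zero    h p = ℕ.+-mono-<-≤ p (sumF-mono (h ∘ suc))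
sumF-mono-< (suc a) h p = ℕ.+-mono-≤-< (h zero) (sumF-mono-< a (h ∘ suc) p)

-- The game, slack, and positions with few threats

module Game (G : Graph) (k : ℕ) where

  V : Set
  V = Fin (n G)

  Col : Set
  Col = Colouring G k

  Adj : V → V → Set
  Adj x y = adj G x y ≡ true

  Wins : Col → Player → Set
  Wins = AliceWins G k

  adj-sym : ∀ {x y} → Adj x y → Adj y x
  adj-sym {x} {y} p = trans (sym G y x) p

  adj⇒≢ : ∀ {x y} → Adj x y → x ≢ y
  adj⇒≢ {x} p refl = true≢false p (irr G x)

  abstract
    -- Opaque, so that a position remains a visible stack of moves instead of unfolding into nested
    -- conditionals; `upd-def` leads back to `setCol`.
    upd : Col → V → V → Fin k → Col
    upd = setCol {G}

    upd-def : ∀ c u v j → upd c u v j ≡ setCol {G} c u v j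
    upd-def c u v j = refl

    upd-hit : ∀ {c u v j x y} → (x ≡ u × y ≡ v) ⊎ (x ≡ v × y ≡ u) → upd c u v j x y ≡ just j
    upd-hit {u = u} {v} (inj₁ (refl , refl)) rewrite ≡⇒eqF {x = u} refl | ≡⇒eqF {x = v} refl = refl
    upd-hit {u = u} {v} (inj₂ (refl , refl)) rewrite ≡⇒eqF {x = u} refl | ≡⇒eqF {x = v} refl
      | Bool.∨-zeroʳ (eqF v u ∧ eqF u v) = refl

    upd-miss : ∀ {c u v j x y} → ¬ (x ≡ u × y ≡ v) → ¬ (x ≡ v × y ≡ u) → upd c u v j x y ≡ c x y
    upd-miss {u = u} {v} {x = x} {y} ¬1 ¬2
      rewrite ≢true {eqF x u ∧ eqF y v} (λ p → let a , b = ∧-true p in ¬1 (eqF⇒≡ a , eqF⇒≡ b))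
            | ≢true {eqF x v ∧ eqF y u} (λ p → let a , b = ∧-true p in ¬2 (eqF⇒≡ a , eqF⇒≡ b)) = refl

  same? : ∀ (u v x y : V) → ((x ≡ u × y ≡ v) ⊎ (x ≡ v × y ≡ u)) ⊎ (¬ (x ≡ u × y ≡ v) × ¬ (x ≡ v × y ≡ u))
  same? u v x y with x Fin.≟ u | y Fin.≟ v | x Fin.≟ v | y Fin.≟ u
  ... | yes p | yes q | _     | _     = inj₁ (inj₁ (p , q))
  ... | _     | _     | yes p | yes q = inj₁ (inj₂ (p , q))
  ... | no p  | _     | no q  | _     = inj₂ (p ∘ proj₁ , q ∘ proj₁)
  ... | no p  | _     | _     | no q  = inj₂ (p ∘ proj₁ , q ∘ proj₂)
  ... | _     | no p  | no q  | _     = inj₂ (p ∘ proj₂ , q ∘ proj₁)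
  ... | _     | no p  | _     | no q  = inj₂ (p ∘ proj₂ , q ∘ proj₂)

  upd-cases : ∀ {c u v j i} x y → upd c u v j x y ≡ just i →
              (((x ≡ u × y ≡ v) ⊎ (x ≡ v × y ≡ u)) × i ≡ j) ⊎ c x y ≡ just i
  upd-cases {c} {u} {v} {j} x y e with same? u v x y
  ... | inj₁ h = inj₁ (h , ≡-sym (Maybe.just-injective (trans (≡-sym (upd-hit {c} h)) e)))
  ... | inj₂ (a , b) = inj₂ (trans (≡-sym (upd-miss {c} a b)) e)

  upd-none : ∀ {c u v j x y} → upd c u v j x y ≡ nothing → c x y ≡ nothing
  upd-none {c} {u} {v} {j} {x} {y} e with same? u v x y
  ... | inj₁ h with () ← trans (≡-sym e) (upd-hit {c} h)
  ... | inj₂ (a , b) = trans (≡-sym (upd-miss {c} a b)) e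

  upd-none-≢ : ∀ {c u v j x y} → upd c u v j x y ≡ nothing → ¬ ((x ≡ u × y ≡ v) ⊎ (x ≡ v × y ≡ u))
  upd-none-≢ {c} e h with () ← trans (≡-sym e) (upd-hit {c} h)

  isNone : ∀ {A : Set} → Maybe A → Bool
  isNone nothing  = true
  isNone (just _) = false

  isNone⁻ : ∀ {A : Set} {m : Maybe A} → isNone m ≡ true → m ≡ nothing
  isNone⁻ {m = nothing} _ = refl

  none? : (m : Maybe (Fin k)) → m ≡ nothing ⊎ ∃[ j ] m ≡ just j
  none? nothing  = inj₁ refl
  none? (just j) = inj₂ (j , refl)

  seen? : (c : Col) (x : V) (j : Fin k) → Dec (∃[ w ] c x w ≡ just j)
  seen? c x j = Fin.any? λ w → Maybe.≡-dec Fin._≟_ (c x w) (just j)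

  abstract
    seen : Col → V → Fin k → Bool
    seen c x j = does (seen? c x j)

    seen⁺ : ∀ {c x w j} → c x w ≡ just j → seen c x j ≡ true
    seen⁺ {c} {x} {w} {j} e with seen? c x j
    ... | yes _ = refl
    ... | no ¬p = ⊥-elim (¬p (w , e))

    seen⁻ : ∀ {c x j} → seen c x j ≡ true → ∃[ w ] c x w ≡ just j
    seen⁻ {c} {x} {j} e with seen? c x j
    ... | yes p = p
    ... | no _ with () ← e

  unseen⁻ : ∀ {c x j} → seen c x j ≡ false → ∀ w → c x w ≢ just j
  unseen⁻ e w p = true≢false (seen⁺ p) e

  unseen⁺ : ∀ {c x j} → (∀ w → c x w ≢ just j) → seen c x j ≡ false
  unseen⁺ f = ≢true λ p → let w , e = seen⁻ p in f w e

  deg : V → ℕ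
  deg x = count (adj G x)

  uncolouredAt : Col → V → V → Bool
  uncolouredAt c x y = adj G x y ∧ isNone (c x y)

  unc : Col → V → ℕ
  unc c x = count (uncolouredAt c x)

  fre : Col → V → ℕ
  fre c x = count (λ j → not (seen c x j))

  free : Col → V → V → ℕ
  free c x y = count (λ j → not (seen c x j) ∧ not (seen c y j))

  uncolouredAt⁺ : ∀ {c x y} → Adj x y → c x y ≡ nothing → uncolouredAt c x y ≡ true
  uncolouredAt⁺ a e rewrite a | e = refl

  uncolouredAt⁻ : ∀ {c x y} → uncolouredAt c x y ≡ true → Adj x y × c x y ≡ nothing
  uncolouredAt⁻ {c} {x} {y} p = let a , b = ∧-true {adj G x y} p in a , isNone⁻ b

  free-sym : ∀ c x y → free c x y ≡ free c y x
  free-sym c x y = count-cong λ j → Bool.∧-comm (not (seen c x j)) (not (seen c y j))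

  -- The slack condition is preserved by every move: colouring an edge next to
  -- xy removes one uncoloured edge and at most one free colour.  For B = 0 it
  -- implies that xy can still be coloured.
  Slack : ℕ → Col → V → V → Set
  Slack B c x y = unc c x + unc c y ≤ free c x y + suc B

  slack-sym : ∀ {B c x y} → Slack B c x y → Slack B c y x
  slack-sym {B} {c} {x} {y} p rewrite ℕ.+-comm (unc c y) (unc c x) | free-sym c y x = p

  -- The invariants of reachable positions. `bal` says, without subtraction, that x sees exactly as
  -- many colours as it has coloured edges, which is properness at x.
  record Valid (c : Col) : Set where
    field
      csym   : ∀ x y → c x y ≡ c y x
      onEdge : ∀ {x y j} → c x y ≡ just j → Adj x y
      bal    : ∀ x → fre c x + deg x ≡ k + unc c x

  Leg : Col → V → V → Fin k → Set
  Leg = Legal {G}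

  module Move {c : Col} {u v : V} {j : Fin k} (valid : Valid c) (legal : Leg c u v j) where
    open Valid valid

    c′ : Col
    c′ = upd c u v j

    uv-adj : Adj u v
    uv-adj = proj₁ legal

    u≢v : u ≢ v
    u≢v = adj⇒≢ uv-adj

    uv-none : c u v ≡ nothing
    uv-none = proj₁ (proj₂ legal)

    vu-none : c v u ≡ nothing
    vu-none = trans (csym v u) uv-none

    Touched : V → Set
    Touched x = x ≡ u ⊎ x ≡ v

    touched? : ∀ x → Touched x ⊎ (x ≢ u × x ≢ v)
    touched? x with x Fin.≟ u | x Fin.≟ v
    ... | yes p | _     = inj₁ (inj₁ p)
    ... | no _  | yes p = inj₁ (inj₂ p)
    ... | no p  | no q  = inj₂ (p , q)

    upd-off : ∀ {x y} → x ≢ u → x ≢ v → c′ x y ≡ c x y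
    upd-off {x} {y} p q = upd-miss {c} {u} {v} {j} {x} {y} (p ∘ proj₁) (q ∘ proj₁)

    seen-mono : ∀ {x i} → seen c x i ≡ true → seen c′ x i ≡ true
    seen-mono {x} {i} p with seen⁻ p
    ... | w , e with same? u v x w
    ...   | inj₁ (inj₁ (refl , refl)) with () ← trans (≡-sym uv-none) e
    ...   | inj₁ (inj₂ (refl , refl)) with () ← trans (≡-sym vu-none) e
    ...   | inj₂ (a , b) = seen⁺ {w = w} (trans (upd-miss {c} a b) e)

    seen-new : ∀ {x i} → seen c′ x i ≡ true → seen c x i ≡ true ⊎ (i ≡ j × Touched x)
    seen-new {x} p with seen⁻ p
    ... | w , e with upd-cases {c} x w e
    ...   | inj₂ q                    = inj₁ (seen⁺ q)
    ...   | inj₁ (inj₁ (q , _) , r) = inj₂ (r , inj₁ q)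
    ...   | inj₁ (inj₂ (q , _) , r) = inj₂ (r , inj₂ q)

    seen-hit : ∀ {x} → Touched x → seen c′ x j ≡ true
    seen-hit (inj₁ refl) = seen⁺ {w = v} (upd-hit {c} (inj₁ (refl , refl)))
    seen-hit (inj₂ refl) = seen⁺ {w = u} (upd-hit {c} (inj₂ (refl , refl)))

    seen-same : ∀ {x i} → i ≢ j → seen c x i ≡ seen c′ x i
    seen-same i≢j = bool-ext seen-mono λ p → case seen-new p of λ where
      (inj₁ q)       → q
      (inj₂ (q , _)) → ⊥-elim (i≢j q)

    seen-off : ∀ {x i} → x ≢ u → x ≢ v → seen c′ x i ≡ seen c x i
    seen-off x≢u x≢v = bool-ext (λ p → case seen-new p of λ where
      (inj₁ q)            → q
      (inj₂ (_ , inj₁ q)) → ⊥-elim (x≢u q)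
      (inj₂ (_ , inj₂ q)) → ⊥-elim (x≢v q)) seen-mono

    unseen-before : ∀ {x} → Touched x → seen c x j ≡ false
    unseen-before (inj₁ refl) = unseen⁺ (proj₁ (proj₂ (proj₂ legal)))
    unseen-before (inj₂ refl) = unseen⁺ (proj₂ (proj₂ (proj₂ legal)))

    unc-hit : ∀ {x} → Touched x → unc c x ≡ suc (unc c′ x)
    unc-hit (inj₁ refl) = count-drop v
      (λ y y≢v → cong (λ m → adj G u y ∧ isNone m) (≡-sym (upd-miss {c} (y≢v ∘ proj₂) (u≢v ∘ proj₁))))
      (uncolouredAt⁺ {c} uv-adj uv-none)
      (≢true λ p → case trans (≡-sym (proj₂ (uncolouredAt⁻ {c′} {u} {v} p))) (upd-hit {c} (inj₁ (refl , refl))) of λ ())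
    unc-hit (inj₂ refl) = count-drop u
      (λ y y≢u → cong (λ m → adj G v y ∧ isNone m) (≡-sym (upd-miss {c} (u≢v ∘ ≡-sym ∘ proj₁) (y≢u ∘ proj₂))))
      (uncolouredAt⁺ {c} (adj-sym uv-adj) vu-none)
      (≢true λ p → case trans (≡-sym (proj₂ (uncolouredAt⁻ {c′} {v} {u} p))) (upd-hit {c} (inj₂ (refl , refl))) of λ ())

    unc-off : ∀ {x} → x ≢ u → x ≢ v → unc c′ x ≡ unc c x
    unc-off {x} p q = count-cong λ y → cong (λ m → adj G x y ∧ isNone m) (upd-off p q)

    unc-≤ : ∀ x → unc c′ x ≤ unc c x
    unc-≤ x with touched? x
    ... | inj₁ t       = ℕ.<⇒≤ (ℕ.≤-reflexive (≡-sym (unc-hit t)))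
    ... | inj₂ (p , q) = ℕ.≤-reflexive (unc-off p q)

    fre-hit : ∀ {x} → Touched x → fre c x ≡ suc (fre c′ x)
    fre-hit t = count-drop j (λ i i≢j → cong not (seen-same i≢j))
      (cong not (unseen-before t)) (cong not (seen-hit t))

    fre-off : ∀ {x} → x ≢ u → x ≢ v → fre c′ x ≡ fre c x
    fre-off {x} p q = count-cong λ i → cong not (seen-off {x} {i} p q)

    free-≤ : ∀ x y → free c x y ≤ suc (free c′ x y)
    free-≤ x y = count-≤suc j λ i i≢j p →
      trans (cong₂ (λ a b → not a ∧ not b) (≡-sym (seen-same {x} i≢j)) (≡-sym (seen-same {y} i≢j))) p

    free-gain : ∀ x {y} → seen c y j ≡ true → free c x y ≤ free c′ x y
    free-gain x {y} s = count-mono λ i p → case i Fin.≟ j of λ where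
      (no i≢j) → trans (cong₂ (λ a b → not a ∧ not b) (≡-sym (seen-same {x} i≢j)) (≡-sym (seen-same {y} i≢j))) p
      (yes refl) → ⊥-elim (true≢false s (not-true (proj₂ (∧-true {not (seen c x i)} p))))

    free-off : ∀ {x y} → x ≢ u → x ≢ v → y ≢ u → y ≢ v → free c′ x y ≡ free c x y
    free-off {x} {y} p q r s =
      count-cong λ i → cong₂ (λ a b → not a ∧ not b) (seen-off {x} {i} p q) (seen-off {y} {i} r s)

    slack-stepˡ : ∀ {B x y} → Touched x → y ≢ u → y ≢ v → Slack B c x y → Slack B c′ x y
    slack-stepˡ {B} {x} {y} t p q s rewrite unc-hit t | unc-off p q =
      ℕ.≤-pred (ℕ.≤-trans s (ℕ.+-monoˡ-≤ (suc B) (free-≤ x y)))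

    -- A move cannot touch both x and y, since it would then colour xy, which is still open
    -- afterwards. So at most one of the two counts of uncoloured edges changes.
    slack-step : ∀ {B x y} → Adj x y → c′ x y ≡ nothing → Slack B c x y → Slack B c′ x y
    slack-step {B} {x} {y} a e s with touched? x | touched? y
    ... | inj₁ t | inj₂ (p , q) = slack-stepˡ t p q s
    ... | inj₂ (p , q) | inj₁ t = slack-sym {B} {c′} {y} (slack-stepˡ t p q (slack-sym {B} {c} {x} s))
    ... | inj₂ (p , q) | inj₂ (p′ , q′)
          rewrite unc-off p q | unc-off p′ q′ | free-off p q p′ q′ = s
    ... | inj₁ (inj₁ refl) | inj₁ (inj₁ refl) = ⊥-elim (adj⇒≢ a refl)
    ... | inj₁ (inj₂ refl) | inj₁ (inj₂ refl) = ⊥-elim (adj⇒≢ a refl)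
    ... | inj₁ (inj₁ refl) | inj₁ (inj₂ refl) = ⊥-elim (upd-none-≢ {c} e (inj₁ (refl , refl)))
    ... | inj₁ (inj₂ refl) | inj₁ (inj₁ refl) = ⊥-elim (upd-none-≢ {c} e (inj₂ (refl , refl)))

    -- A colour played at x that y already sees costs the edge xy no free colour.
    slack-gain : ∀ {B x y} → Touched x → y ≢ u → y ≢ v → seen c y j ≡ true →
                 Slack (suc B) c x y → Slack B c′ x y
    slack-gain {B} {x} {y} t p q sy s rewrite unc-hit t | unc-off p q =
      ℕ.≤-pred (ℕ.≤-trans s (ℕ.≤-trans (ℕ.+-monoˡ-≤ (suc (suc B)) (free-gain x sy))
        (ℕ.≤-reflexive (ℕ.+-suc (free c′ x y) (suc B)))))

    valid′ : Valid c′
    valid′ = record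
      { csym = λ x y → case same? u v x y of λ where
          (inj₁ (inj₁ h)) → trans (upd-hit {c} (inj₁ h)) (≡-sym (upd-hit {c} (inj₂ (proj₂ h , proj₁ h))))
          (inj₁ (inj₂ h)) → trans (upd-hit {c} (inj₂ h)) (≡-sym (upd-hit {c} (inj₁ (proj₂ h , proj₁ h))))
          (inj₂ (a , b))  → trans (upd-miss {c} a b) (trans (csym x y)
            (≡-sym (upd-miss {c} (λ h → b (proj₂ h , proj₁ h)) (λ h → a (proj₂ h , proj₁ h)))))
      ; onEdge = λ {x} {y} e → case upd-cases {c} x y e of λ where
          (inj₁ (inj₁ (refl , refl) , _)) → uv-adj
          (inj₁ (inj₂ (refl , refl) , _)) → adj-sym uv-adj
          (inj₂ q) → onEdge q
      ; bal = λ x → case touched? x of λ where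
          (inj₁ t) → ℕ.suc-injective (trans (cong (_+ deg x) (≡-sym (fre-hit t)))
                       (trans (bal x) (trans (cong (k +_) (unc-hit t)) (ℕ.+-suc k _))))
          (inj₂ (p , q)) → trans (cong (_+ deg x) (fre-off p q)) (trans (bal x) (cong (k +_) (≡-sym (unc-off p q))))
      }

  -- In a valid position this is twice the number of open edges. It falls with every move and serves
  -- as fuel for strategies whose recursion is not structural.
  tot : Col → ℕ
  tot c = sumF (unc c)

  tot-< : ∀ {c u v j} → Valid c → Leg c u v j → tot (upd c u v j) < tot c
  tot-< {u = u} val leg = sumF-mono-< u unc-≤ (ℕ.≤-reflexive (≡-sym (unc-hit (inj₁ refl))))
    where open Move val leg

  abstract
    -- Colourings are functions, and colouring uv or vu yields positions that agree only pointwise;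
    -- this transports a win between them.
    wins-ext : ∀ {c c′ p} → (∀ x y → c x y ≡ c′ x y) → Wins c p → Wins c′ p
    upd-ext : ∀ {c c′} u v j → (∀ x y → c x y ≡ c′ x y) → ∀ x y → upd c u v j x y ≡ upd c′ u v j x y
    upd-ext u v j h x y rewrite h x y = refl
    legal-ext : ∀ {c c′ u v j} → (∀ x y → c x y ≡ c′ x y) → Leg c u v j → Leg c′ u v j
    legal-ext h (a , b , f , g) =
      a , trans (≡-sym (h _ _)) b , (λ w e → f w (trans (h _ _) e)) , (λ w e → g w (trans (h _ _) e))
    wins-ext h (finished f) = finished λ u v a → let j , e = f u v a in j , trans (≡-sym (h u v)) e
    wins-ext h (aliceMoves u v j l w) =
      aliceMoves u v j (legal-ext h l) (wins-ext (upd-ext u v j h) w)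
    wins-ext h (bobMoves (u , v , j , l) f) =
      bobMoves (u , v , j , legal-ext h l) λ u v j l →
        wins-ext (upd-ext u v j h) (f u v j (legal-ext (λ x y → ≡-sym (h x y)) l))

    upd-swap : ∀ {c} u v j x y → upd c u v j x y ≡ upd c v u j x y
    upd-swap {c} u v j x y rewrite Bool.∨-comm (eqF x u ∧ eqF y v) (eqF x v ∧ eqF y u) = refl

    aliceTurn : ∀ {c u v j} → Leg c u v j → Wins (upd c u v j) bob → Wins c alice
    aliceTurn leg w = aliceMoves _ _ _ leg w

    bobMove : ∀ {c} → (∃[ u ] ∃[ v ] ∃[ j ] Leg c u v j) →
              (∀ u v j → Leg c u v j → Wins (upd c u v j) alice) → Wins c bob
    bobMove = bobMoves

  legal-swap : ∀ {c u v j} → Valid c → Leg c u v j → Leg c v u j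
  legal-swap {c} {u} {v} val (a , b , f , g) = adj-sym a , trans (Valid.csym val v u) b , g , f

  open-or-done : ∀ c → AllColoured {G} c ⊎ ∃[ x ] ∃[ y ] (Adj x y × c x y ≡ nothing)
  open-or-done c with Fin.any? (λ x → Fin.any? λ y → uncolouredAt c x y Bool.≟ true)
  ... | yes (x , y , p) = inj₂ (x , y , uncolouredAt⁻ {c} p)
  ... | no ¬p = inj₁ λ x y a → case none? (c x y) of λ where
          (inj₁ e) → ⊥-elim (¬p (x , y , uncolouredAt⁺ {c} a e))
          (inj₂ r) → r

  free-move : ∀ {c x y} → Adj x y → c x y ≡ nothing → 1 ≤ free c x y → ∃[ j ] Leg c x y j
  free-move {c} {x} a e f =
    let j , p = count-pos f ; s , t = ∧-true {not (seen c x _)} p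
    in j , a , e , unseen⁻ (not-true s) , unseen⁻ (not-true t)

  Live : Col → Set
  Live c = ∀ x y → Adj x y → c x y ≡ nothing → 1 ≤ free c x y

  -- `bobMoves` asks for a legal move, as a stuck position is no win for Alice. In a live position
  -- such a move exists unless all edges are coloured.
  bobTurn : ∀ {c} → Live c → (∀ u v j → Leg c u v j → Wins (upd c u v j) alice) → Wins c bob
  bobTurn {c} live f with open-or-done c
  ... | inj₁ done = finished done
  ... | inj₂ (x , y , a , e) = bobMove (x , y , free-move a e (live x y a e)) f

  -- The open edge xy is itself counted at x and at y, so the left-hand side of `Slack` is at least
  -- 2.
  slack⇒live : ∀ {c x y} → Valid c → Adj x y → c x y ≡ nothing → Slack 0 c x y → 1 ≤ free c x y
  slack⇒live {c} {x} {y} val a e s = ℕ.+-cancelʳ-≤ 1 1 (free c x y) (ℕ.≤-trans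
    (ℕ.+-mono-≤ (count-pos⁺ {x = y} (uncolouredAt⁺ {c} a e))
                (count-pos⁺ {x = x} (uncolouredAt⁺ {c} (adj-sym a) (trans (Valid.csym val y x) e)))) s)

  SameEdge : V → V → V × V → Set
  SameEdge x y (a , b) = (x ≡ a × y ≡ b) ⊎ (x ≡ b × y ≡ a)

  -- L lists the threats: the only edges that may still be spoilt. Alice's strategies consist in
  -- shortening L to the empty list.
  BadOnly : List (V × V) → Col → Set
  BadOnly L c = ∀ x y → Adj x y → c x y ≡ nothing → Slack 0 c x y ⊎ Any (SameEdge x y) L

  AllSafe : Col → Set
  AllSafe = BadOnly []

  -- The fates of a former threat: it is coloured, it has become safe, or it is carried over to the
  -- new list L.
  data Status (L : List (V × V)) (c : Col) : V × V → Set where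
    coloured : ∀ {a b j} → c a b ≡ just j → Status L c (a , b)
    slack    : ∀ {a b} → Slack 0 c a b → Status L c (a , b)
    keep     : ∀ {e} → e ∈ L → Status L c e

  resolve : ∀ {L L′ c x y} → Valid c → c x y ≡ nothing → Any (SameEdge x y) L → All (Status L′ c) L →
            Slack 0 c x y ⊎ Any (SameEdge x y) L′
  resolve val e (there m) (_ ∷ st) = resolve val e m st
  resolve val e (here (inj₁ (refl , refl))) (coloured q ∷ _) = case trans (≡-sym e) q of λ ()
  resolve {x = x} {y} val e (here (inj₂ (refl , refl))) (coloured q ∷ _) =
    case trans (≡-sym e) (trans (Valid.csym val x y) q) of λ ()
  resolve val e (here (inj₁ (refl , refl))) (slack s ∷ _) = inj₁ s
  resolve {c = c} {y = y} val e (here (inj₂ (refl , refl))) (slack s ∷ _) = inj₁ (slack-sym {0} {c} {y} s)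
  resolve val e (here m) (keep i ∷ _) = inj₂ (Any.map (λ where refl → m) i)

  restrict : ∀ {L L′ c} → Valid c → BadOnly L c → All (Status L′ c) L → BadOnly L′ c
  restrict val bad st x y a e with bad x y a e
  ... | inj₁ s = inj₁ s
  ... | inj₂ m = resolve val e m st

  bad-step : ∀ {L c u v j} → Valid c → Leg c u v j → BadOnly L c → BadOnly L (upd c u v j)
  bad-step {c = c} val leg bad x y a e with bad x y a (upd-none {c} e)
  ... | inj₁ s = inj₁ (Move.slack-step val leg a e s)
  ... | inj₂ m = inj₂ m

  safe-live : ∀ {c} → Valid c → AllSafe c → Live c
  safe-live val safe x y a e with safe x y a e
  ... | inj₁ s = slack⇒live val a e s

  -- No move of either player can destroy slack, so Alice may colour any open edge with any legal
  -- colour.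
  safe-wins : ∀ {c} → Valid c → AllSafe c → ∀ p → Wins c p
  safe-wins {c} val safe p = go (tot c) ℕ.≤-refl val safe p
    where
      go : ∀ {c} m → tot c ≤ m → Valid c → AllSafe c → ∀ p → Wins c p
      next : ∀ {c u v j} m → tot c ≤ m → Valid c → AllSafe c → Leg c u v j → ∀ p → Wins (upd c u v j) p
      next zero    t val safe leg p with () ← ℕ.≤-trans (tot-< val leg) t
      next (suc m) t val safe leg p =
        go m (ℕ.≤-pred (ℕ.≤-trans (tot-< val leg) t)) (Move.valid′ val leg) (bad-step val leg safe) p
      go m t val safe bob = bobTurn (safe-live val safe) λ u v j leg → next m t val safe leg alice
      go {c} m t val safe alice with open-or-done c
      ... | inj₁ done = finished done
      ... | inj₂ (x , y , a , e) =
        let j , leg = free-move a e (safe-live val safe x y a e)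
        in aliceTurn leg (next m t val safe leg bob)

  one-threatᴬ : ∀ {c a b} → Valid c → BadOnly ((a , b) ∷ []) c → Adj a b → 1 ≤ free c a b → Wins c alice
  one-threatᴬ {c} {a} {b} val bad ab f with none? (c a b)
  ... | inj₂ (_ , q) = safe-wins val (restrict val bad (coloured q ∷ [])) alice
  ... | inj₁ e =
    let j , leg = free-move ab e f in
    aliceTurn leg (safe-wins (Move.valid′ val leg)
      (restrict (Move.valid′ val leg) (bad-step val leg bad) (coloured (upd-hit {c} (inj₁ (refl , refl))) ∷ [])) bob)

  bad-live : ∀ {L c} → Valid c → BadOnly L c → All (λ (a , b) → 1 ≤ free c a b) L → Live c
  bad-live {c = c} val bad f x y a e with bad x y a e
  ... | inj₁ s = slack⇒live val a e s
  ... | inj₂ m = go m f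
    where
      go : ∀ {L} → Any (SameEdge x y) L → All (λ (a , b) → 1 ≤ free c a b) L → 1 ≤ free c x y
      go (here (inj₁ (refl , refl))) (p ∷ _) = p
      go (here (inj₂ (refl , refl))) (p ∷ _) = subst (1 ≤_) (free-sym c y x) p
      go (there m) (_ ∷ f) = go m f

  -- Bob's move takes at most one of the two free colours, and Alice then colours ab at once.
  one-threatᴮ : ∀ {c a b} → Valid c → BadOnly ((a , b) ∷ []) c → Adj a b → 2 ≤ free c a b → Wins c bob
  one-threatᴮ {c} {a} {b} val bad ab f = bobTurn (bad-live val bad (ℕ.<⇒≤ f ∷ [])) λ u v j leg →
    one-threatᴬ (Move.valid′ val leg) (bad-step val leg bad) ab
      (ℕ.≤-pred (ℕ.≤-trans f (Move.free-≤ val leg a b)))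

  ∅ : Col
  ∅ = emptyCol {G} {k}

  unc-∅ : ∀ x → unc ∅ x ≡ deg x
  unc-∅ x = count-cong λ y → Bool.∧-identityʳ (adj G x y)

  unseen-∅ : ∀ x j → seen ∅ x j ≡ false
  unseen-∅ x j = unseen⁺ λ w ()

  fre-∅ : ∀ x → fre ∅ x ≡ k
  fre-∅ x = count-true λ j → cong not (unseen-∅ x j)

  free-∅ : ∀ x y → free ∅ x y ≡ k
  free-∅ x y = count-true λ j → cong₂ (λ a b → not a ∧ not b) (unseen-∅ x j) (unseen-∅ y j)

  valid-∅ : Valid ∅
  valid-∅ = record
    { csym = λ _ _ → refl
    ; onEdge = λ ()
    ; bal = λ x → cong₂ _+_ (fre-∅ x) (≡-sym (unc-∅ x))
    }

  slack-∅ : ∀ {B x y} → deg x + deg y ≤ k + suc B → Slack B ∅ x y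
  slack-∅ {B} {x} {y} p rewrite unc-∅ x | unc-∅ y | free-∅ x y = p

-- Blow-ups of pattern graphs

count-≥length : ∀ {m} {P : Fin m → Bool} {xs} → AllPairs _≢_ xs →
                All (λ x → P x ≡ true) xs → length xs ≤ count P
count-≥length [] [] = z≤n
count-≥length {P = P} {a ∷ xs} (a∉ ∷ u) (p ∷ ps) =
  subst (suc (length xs) ≤_) (≡-sym (count-remove {P = P} p))
    (s≤s (count-≥length {P = remove P a} u
      (All.zipWith (λ (a≢x , Px) → trans (remove-other P (a≢x ∘ ≡-sym)) Px) (a∉ , ps))))

Between : ℕ → ℕ → ℕ × ℕ → Set
Between i j (a , b) = i ≡ a × j ≡ b

hasEdge⁻ : ∀ es {i j} → hasEdge es i j ≡ true → Any (Between i j) es ⊎ Any (Between j i) es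
hasEdge⁻ ((a , b) ∷ es) {i} {j} p with ∨-true {matchᵇ a b i j} p
... | inj₂ q = [ inj₁ ∘ there , inj₂ ∘ there ]′ (hasEdge⁻ es q)
... | inj₁ q with ∨-true {eqℕ a i ∧ eqℕ b j} q
...   | inj₁ r = let s , t = ∧-true r in inj₁ (here (≡-sym (eqℕ⇒≡ s) , ≡-sym (eqℕ⇒≡ t)))
...   | inj₂ r = let s , t = ∧-true r in inj₂ (here (≡-sym (eqℕ⇒≡ s) , ≡-sym (eqℕ⇒≡ t)))

hasEdge⁺ : ∀ {es i j} → Any (Between i j) es → hasEdge es i j ≡ true
hasEdge⁺ {(a , b) ∷ es} (here (refl , refl)) rewrite eqℕ-refl a | eqℕ-refl b = refl
hasEdge⁺ {(a , b) ∷ es} {i} {j} (there p) = ∨-introʳ (matchᵇ a b i j) (hasEdge⁺ p)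

neighbours : List (ℕ × ℕ) → ℕ → List ℕ
neighbours []             i = []
neighbours ((a , b) ∷ es) i =
  (if eqℕ a i then b ∷ [] else []) ++ (if eqℕ b i then a ∷ [] else []) ++ neighbours es i

neighbours-complete : ∀ es {i j} → hasEdge es i j ≡ true → j ∈ neighbours es i
neighbours-complete es {i} {j} p = [ fwd es , bwd es ]′ (hasEdge⁻ es p)
  where
    fwd : ∀ es → Any (Between i j) es → j ∈ neighbours es i
    fwd ((a , b) ∷ es) (here (refl , refl)) rewrite eqℕ-refl a = here refl
    fwd ((a , b) ∷ es) (there m) =
      ∈-++⁺ʳ (if eqℕ a i then b ∷ [] else []) (∈-++⁺ʳ (if eqℕ b i then a ∷ [] else []) (fwd es m))
    bwd : ∀ es → Any (Between j i) es → j ∈ neighbours es i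
    bwd ((a , b) ∷ es) (here (refl , refl)) rewrite eqℕ-refl b =
      ∈-++⁺ʳ (if eqℕ a b then b ∷ [] else []) (here refl)
    bwd ((a , b) ∷ es) (there m) =
      ∈-++⁺ʳ (if eqℕ a i then b ∷ [] else []) (∈-++⁺ʳ (if eqℕ b i then a ∷ [] else []) (bwd es m))

-- A union of components of G, blown up from a pattern graph on the labels
-- 0, …, q − 1 with edge list es: the labels below s are taken by exactly one
-- vertex each, the others by any number; labels ≥ q mark the other vertices of G.
record Blowup (G : Graph) (s q : ℕ) (es : List (ℕ × ℕ)) : Set where
  field
    lab       : Fin (n G) → ℕ
    core      : Fin s → Fin (n G)
    lab-core  : ∀ i → lab (core i) ≡ toℕ i
    core-uniq : ∀ {x} i → lab x ≡ toℕ i → x ≡ core i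
    adj-lab   : ∀ {x y} → lab x < q → lab y < q → adj G x y ≡ hasEdge es (lab x) (lab y)
    closed    : ∀ {x y} → adj G x y ≡ true → lab x < q → lab y < q

  Inside : Fin (n G) → Set
  Inside x = lab x < q

  Link : Fin (n G) → Fin (n G) → Set
  Link x y = Any (Between (lab x) (lab y)) es

  link : ∀ {x y} → adj G x y ≡ true → Inside x → Link x y ⊎ Link y x
  link a i = hasEdge⁻ es (trans (≡-sym (adj-lab i (closed a i))) a)

  linked : ∀ {x y} → Inside x → Inside y → Link x y → adj G x y ≡ true
  linked i j m = trans (adj-lab i j) (hasEdge⁺ m)

  near : ∀ {x y i} → adj G x y ≡ true → Inside x → lab x ≡ i → lab y ∈ neighbours es i
  near a i refl = neighbours-complete es (trans (≡-sym (adj-lab i (closed a i))) a)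

  apart : ∀ {x y i j} → lab x ≡ i → lab y ≡ j → eqℕ i j ≡ false → x ≢ y
  apart refl refl e refl = true≢false (eqℕ-refl (lab _)) e

  -- If all pattern neighbours of a label are core labels, each of them stands for a single vertex.
  -- The condition is decided by evaluation, so degree bounds in the concrete patterns need no
  -- further argument.
  degree-≤ : ∀ {x i} → Inside x → lab x ≡ i →
             {_ : True (All.all? (ℕ._<? s) (neighbours es i))} →
             count (adj G x) ≤ length (neighbours es i)
  degree-≤ {x} {i} ins e {w} = ℕ.≤-trans
      (count-≤length (cores (neighbours es i) (toWitness w))
        λ y a → pick (neighbours es i) (toWitness w) (near a ins e))
      (ℕ.≤-reflexive (len (neighbours es i) (toWitness w)))
    where
      cores : ∀ ls → All (_< s) ls → List (Fin (n G))
      cores []       []       = []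
      cores (l ∷ ls) (p ∷ ps) = core (Fin.fromℕ< p) ∷ cores ls ps
      len : ∀ ls ps → length (cores ls ps) ≡ length ls
      len []       []       = refl
      len (l ∷ ls) (p ∷ ps) = cong suc (len ls ps)
      pick : ∀ ls ps {y} → lab y ∈ ls → y ∈ cores ls ps
      pick (l ∷ ls) (p ∷ ps) (here e)  = here (core-uniq _ (trans e (≡-sym (Fin.toℕ-fromℕ< p))))
      pick (l ∷ ls) (p ∷ ps) (there m) = there (pick ls ps m)

module _ {G : Graph} {s q : ℕ} {es : List (ℕ × ℕ)} (B : Blowup G s q es) (π : ℕ → ℕ) (πᶜ : Fin s → Fin s)
  (core-π : ∀ i → toℕ (πᶜ i) ≡ π (toℕ i)) (involutive : ∀ i → π (π i) ≡ i)
  (bounded : ∀ {i} → i < q → π i < q)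
  (symmetry : ∀ (i j : Fin q) → hasEdge es (toℕ i) (toℕ j) ≡ hasEdge es (π (toℕ i)) (π (toℕ j))) where
  open Blowup B

  unbounded : ∀ {i} → π i < q → i < q
  unbounded {i} p = subst (_< q) (involutive i) (bounded p)

  -- A symmetry of the pattern turns one blow-up into another, so that mirror images of Alice's
  -- strategies need not be written out.
  relabel : Blowup G s q es
  relabel = record
    { lab = π ∘ lab
    ; core = core ∘ πᶜ
    ; lab-core = λ i → trans (cong π (trans (lab-core (πᶜ i)) (core-π i))) (involutive _)
    ; core-uniq = λ i e → core-uniq (πᶜ i)
        (trans (trans (≡-sym (involutive _)) (cong π e)) (≡-sym (core-π i)))
    ; adj-lab = λ {x} {y} p q → trans (adj-lab (unbounded p) (unbounded q))
        (symmetry′ (unbounded p) (unbounded q))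
    ; closed = λ a p → bounded (closed a (unbounded p))
    }
    where
      symmetry′ : ∀ {i j} → i < q → j < q → hasEdge es i j ≡ hasEdge es (π i) (π j)
      symmetry′ p q = subst (λ i → hasEdge es i _ ≡ hasEdge es (π i) _) (Fin.toℕ-fromℕ< p)
        (subst (λ j → hasEdge es _ j ≡ hasEdge es _ (π j)) (Fin.toℕ-fromℕ< q)
          (symmetry (Fin.fromℕ< p) (Fin.fromℕ< q)))

-- The labels are numbered in the order in which the templates number their vertices.
doubleStarᵖ vaseᵖ candyᵖ shootingStarᵖ doubleVaseᵖ amaryllisᵖ : List (ℕ × ℕ)
doubleStarᵖ   = (0 , 1) ∷ (0 , 2) ∷ (1 , 3) ∷ []
vaseᵖ         = (0 , 1) ∷ (1 , 2) ∷ (2 , 0) ∷ (0 , 3) ∷ []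
candyᵖ        = (0 , 2) ∷ (1 , 2) ∷ (0 , 3) ∷ (1 , 4) ∷ []
shootingStarᵖ = (1 , 0) ∷ (0 , 2) ∷ (2 , 3) ∷ (1 , 4) ∷ (0 , 5) ∷ []
doubleVaseᵖ   = (0 , 1) ∷ (1 , 2) ∷ (2 , 0) ∷ (0 , 3) ∷ (3 , 4) ∷ (4 , 0) ∷ (0 , 5) ∷ []
amaryllisᵖ    = (1 , 0) ∷ (0 , 2) ∷ (2 , 3) ∷ (3 , 0) ∷ (1 , 4) ∷ (0 , 5) ∷ []

-- Tools for Alice's strategies

module Position (G : Graph) (k : ℕ) where
  open Game G k public

  -- An upper bound on the colours at x, enough to prove moves legal. Being a record, it keeps c, x
  -- and S recoverable by unification.
  record Sees (c : Col) (x : V) (S : List (Fin k)) : Set where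
    constructor sees
    field see : ∀ w j → c x w ≡ just j → j ∈ S

  sees-∅ : ∀ {x} → Sees ∅ x []
  sees-∅ = sees λ w j ()

  sees-upd : ∀ {c u v j x S} → Sees c x S → Sees (upd c u v j) x (j ∷ S)
  sees-upd {c} {x = x} (sees f) = sees λ w i e → case upd-cases {c} x w e of λ where
    (inj₁ (_ , q)) → here q
    (inj₂ q)       → there (f w i q)

  sees-off : ∀ {c u v j x S} → x ≢ u → x ≢ v → Sees c x S → Sees (upd c u v j) x S
  sees-off {c} p q (sees f) = sees λ w i e → f w i (trans (≡-sym (upd-miss {c} (p ∘ proj₁) (q ∘ proj₁))) e)

  none-off : ∀ {c u v j x y} → x ≢ u → x ≢ v → c x y ≡ nothing → upd c u v j x y ≡ nothing
  none-off {c} p q e = trans (upd-miss {c} (p ∘ proj₁) (q ∘ proj₁)) e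

  none-offʳ : ∀ {c u v j x y} → y ≢ u → y ≢ v → c x y ≡ nothing → upd c u v j x y ≡ nothing
  none-offʳ {c} p q e = trans (upd-miss {c} (q ∘ proj₂) (p ∘ proj₂)) e

  leg-intro : ∀ {c x y j S T} → Adj x y → c x y ≡ nothing → Sees c x S → Sees c y T →
              j ∉ S → j ∉ T → Leg c x y j
  leg-intro a e s t p q = a , e , (λ w e → p (Sees.see s w _ e)) , (λ w e → q (Sees.see t w _ e))

  ≢⇒∉ : ∀ {j d : Fin k} → j ≢ d → j ∉ (d ∷ [])
  ≢⇒∉ p (here q) = p q

  swap-wins : ∀ {c u v j p} → Wins (upd c u v j) p → Wins (upd c v u j) p
  swap-wins {c} {u} {v} {j} = wins-ext (upd-swap {c} u v j)

  fresh : 2 ≤ k → ∀ d → ∃[ j ] j ≢ d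
  fresh 2≤k d = let j , p , _ = count-≥2 {m = k} {P = λ _ → true} d
                                  (subst (2 ≤_) (≡-sym (count-true {k} {λ _ → true} λ _ → refl)) 2≤k)
                in j , p

  after : ∀ {c u v j x y m} → Valid c → Leg c u v j → suc m ≤ free c x y → m ≤ free (upd c u v j) x y
  after val leg h = ℕ.≤-pred (ℕ.≤-trans h (Move.free-≤ val leg _ _))

  -- The two edges v c₁, v c₂ become safe as soon as the colour of c₁c₂ shows up at v.
  two-petals : ∀ {c v c₁ c₂ z d} → Valid c →
    Adj v c₁ → Adj v c₂ → Adj c₁ c₂ →
    (∀ {y} → Adj c₁ y → y ≡ v ⊎ y ≡ c₂) → (∀ {y} → Adj c₂ y → y ≡ v ⊎ y ≡ c₁) →
    BadOnly ((v , c₁) ∷ (v , c₂) ∷ []) c →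
    c v c₁ ≡ nothing → c v c₂ ≡ nothing → c c₁ c₂ ≡ nothing →
    Slack 1 c v c₁ → Slack 1 c v c₂ →
    Sees c v (d ∷ []) → seen c v d ≡ true → Sees c c₁ [] → Sees c c₂ [] →
    Adj v z → c v z ≡ nothing → z ≢ c₁ → z ≢ c₂ → Sees c z (d ∷ []) →
    2 ≤ free c v c₁ → 2 ≤ free c v c₂ → Wins c bob
  two-petals {c} {v} {c₁} {c₂} {z} {d} val vc₁ vc₂ c₁c₂ N₁ N₂ bad e₁ e₂ e₁₂ s₁ s₂ Sv vd S₁ S₂ vz ez z≢c₁ z≢c₂ Sz f₁ f₂ =
      bobTurn (bad-live val bad (ℕ.<⇒≤ f₁ ∷ ℕ.<⇒≤ f₂ ∷ [])) turn
    where
      v≢c₁ = adj⇒≢ vc₁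
      v≢c₂ = adj⇒≢ vc₂

      at₁ : ∀ j → Leg c v c₁ j → Wins (upd c v c₁ j) alice
      at₁ j leg = one-threatᴬ (Move.valid′ val leg)
        (restrict (Move.valid′ val leg) (bad-step val leg bad)
          (coloured (upd-hit {c} (inj₁ (refl , refl))) ∷ keep (here refl) ∷ []))
        vc₂ (after val leg f₂)

      at₂ : ∀ j → Leg c v c₂ j → Wins (upd c v c₂ j) alice
      at₂ j leg = one-threatᴬ (Move.valid′ val leg)
        (restrict (Move.valid′ val leg) (bad-step val leg bad)
          (keep (here refl) ∷ coloured (upd-hit {c} (inj₁ (refl , refl))) ∷ []))
        vc₁ (after val leg f₁)

      -- If Bob uses d, then v sees it already. Otherwise Alice repeats his colour at v on the spare
      -- edge vz; this is why z may see no colour but d.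
      at₁₂ : ∀ j → Leg c c₁ c₂ j → Wins (upd c c₁ c₂ j) alice
      at₁₂ j leg with j Fin.≟ d
      ... | yes refl = safe-wins (Move.valid′ val leg) (restrict (Move.valid′ val leg) (bad-step val leg bad)
              (slack (slack-sym {0} {_} {c₁} (slack-gain (inj₁ refl) v≢c₁ v≢c₂ vd (slack-sym {1} {c} {v} s₁))) ∷
               slack (slack-sym {0} {_} {c₂} (slack-gain (inj₂ refl) v≢c₁ v≢c₂ vd (slack-sym {1} {c} {v} s₂))) ∷ [])) alice
        where open Move val leg
      ... | no j≢d = aliceTurn leg′ (safe-wins (Move.valid′ val′ leg′)
              (restrict (Move.valid′ val′ leg′) (bad-step val′ leg′ (bad-step val leg bad))
                (slack (Move.slack-gain val′ leg′ (inj₁ refl) (v≢c₁ ∘ ≡-sym) (z≢c₁ ∘ ≡-sym)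
                    (Move.seen-hit val leg (inj₁ refl)) (Move.slack-step val leg vc₁ (none-off {c} v≢c₁ v≢c₂ e₁) s₁)) ∷
                 slack (Move.slack-gain val′ leg′ (inj₁ refl) (v≢c₂ ∘ ≡-sym) (z≢c₂ ∘ ≡-sym)
                    (Move.seen-hit val leg (inj₂ refl)) (Move.slack-step val leg vc₂ (none-off {c} v≢c₁ v≢c₂ e₂) s₂)) ∷ [])) bob)
        where
          val′ = Move.valid′ val leg
          leg′ : Leg (upd c c₁ c₂ j) v z j
          leg′ = leg-intro vz (none-off {c} v≢c₁ v≢c₂ ez) (sees-off {c} v≢c₁ v≢c₂ Sv) (sees-off {c} z≢c₁ z≢c₂ Sz)
                   (≢⇒∉ j≢d) (≢⇒∉ j≢d)

      -- Bob has left c₁ and c₂ bare, so Alice can give c₁c₂ the colour d that v sees.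
      away : ∀ x y j → Leg c x y j → c₁ ≢ x → c₁ ≢ y → c₂ ≢ x → c₂ ≢ y → Wins (upd c x y j) alice
      away x y j leg p₁ q₁ p₂ q₂ = aliceTurn leg′ (safe-wins (Move.valid′ val′ leg′)
              (restrict (Move.valid′ val′ leg′) (bad-step val′ leg′ (bad-step val leg bad))
                (slack (slack-sym {0} {_} {c₁} (Move.slack-gain val′ leg′ (inj₁ refl) v≢c₁ v≢c₂ (Move.seen-mono val leg vd)
                    (slack-sym {1} {_} {v} (Move.slack-step val leg vc₁ (none-offʳ {c} p₁ q₁ e₁) s₁)))) ∷
                 slack (slack-sym {0} {_} {c₂} (Move.slack-gain val′ leg′ (inj₂ refl) v≢c₁ v≢c₂ (Move.seen-mono val leg vd)
                    (slack-sym {1} {_} {v} (Move.slack-step val leg vc₂ (none-offʳ {c} p₂ q₂ e₂) s₂)))) ∷ [])) bob)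
        where
          val′ = Move.valid′ val leg
          leg′ : Leg (upd c x y j) c₁ c₂ d
          leg′ = leg-intro c₁c₂ (none-off {c} p₁ q₁ e₁₂) (sees-off {c} p₁ q₁ S₁) (sees-off {c} p₂ q₂ S₂) (λ ()) (λ ())

      flip : ∀ {x y j} → (Leg c y x j → Wins (upd c y x j) alice) → Leg c x y j → Wins (upd c x y j) alice
      flip f leg = swap-wins {c} (f (legal-swap {c} val leg))

      turn : ∀ x y j → Leg c x y j → Wins (upd c x y j) alice
      turn x y j leg with c₁ Fin.≟ x | c₁ Fin.≟ y | c₂ Fin.≟ x | c₂ Fin.≟ y
      ... | no p₁ | no q₁ | no p₂ | no q₂ = away x y j leg p₁ q₁ p₂ q₂
      ... | yes refl | _ | _ | _ = case N₁ (proj₁ leg) of λ where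
              (inj₁ refl) → flip (at₁ j) leg
              (inj₂ refl) → at₁₂ j leg
      ... | no _ | yes refl | _ | _ = case N₁ (adj-sym (proj₁ leg)) of λ where
              (inj₁ refl) → at₁ j leg
              (inj₂ refl) → flip (at₁₂ j) leg
      ... | no _ | no _ | yes refl | _ = case N₂ (proj₁ leg) of λ where
              (inj₁ refl) → flip (at₂ j) leg
              (inj₂ refl) → flip (at₁₂ j) leg
      ... | no _ | no _ | no _ | yes refl = case N₂ (adj-sym (proj₁ leg)) of λ where
              (inj₁ refl) → at₂ j leg
              (inj₂ refl) → at₁₂ j leg

module Single {G : Graph} {s q : ℕ} {es : List (ℕ × ℕ)} (k : ℕ) (B : Blowup G s q es)
  (full : ∀ {x y} → adj G x y ≡ true → Blowup.Inside B x) (s≤q : s ≤ q)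
  (deg≤k : ∀ x → count (adj G x) ≤ k) where
  open Position G k public
  open Blowup B public

  -- Without loss of generality Bob names the ends of his edge in the order of the pattern's edge
  -- list, which halves the cases.
  bobTurnᵒ : ∀ {c} → Valid c → Live c →
             (∀ u v j → Leg c u v j → Link u v → Wins (upd c u v j) alice) → Wins c bob
  bobTurnᵒ {c} val live f = bobTurn live λ u v j leg → case link (proj₁ leg) (full (proj₁ leg)) of λ where
    (inj₁ m) → f u v j leg m
    (inj₂ m) → swap-wins {c} (f v u j (legal-swap {c} val leg) m)

  bad-∅ : ∀ L → (∀ x y → Adj x y → Link x y → deg x + deg y ≤ suc k ⊎ Any (SameEdge x y) L) → BadOnly L ∅
  bad-∅ L f x y a _ with link a (full a)
  ... | inj₁ m with f x y a m
  ...   | inj₁ p = inj₁ (slack-∅ (ℕ.≤-trans p (ℕ.≤-reflexive (ℕ.+-comm 1 k))))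
  ...   | inj₂ p = inj₂ p
  bad-∅ L f x y a _ | inj₂ m with f y x (adj-sym a) m
  ...   | inj₁ p = inj₁ (slack-sym {0} {∅} {y} (slack-∅ (ℕ.≤-trans p (ℕ.≤-reflexive (ℕ.+-comm 1 k)))))
  ...   | inj₂ p = inj₂ (Any.map (λ where (inj₁ (p , q)) → inj₂ (q , p)
                                          (inj₂ (p , q)) → inj₁ (q , p)) p)

  core-inside : ∀ i → Inside (core i)
  core-inside i = subst (_< q) (≡-sym (lab-core i)) (ℕ.≤-trans (Fin.toℕ<n i) s≤q)

  core-adj : ∀ i j → hasEdge es (toℕ i) (toℕ j) ≡ true → Adj (core i) (core j)
  core-adj i j e = trans (adj-lab (core-inside i) (core-inside j))
    (trans (cong₂ (hasEdge es) (lab-core i) (lab-core j)) e)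

  -- This is why leaf edges never become threats: their degree sum is at most k + 1, the bound for
  -- `Slack 0` at the start.
  leaf-sum : ∀ {x y} → deg y ≤ 1 → deg x + deg y ≤ suc k
  leaf-sum {x} p = ℕ.≤-trans (ℕ.+-mono-≤ (deg≤k x) p) (ℕ.≤-reflexive (ℕ.+-comm k 1))

  slack₁ : ∀ {x y} → deg y ≤ 2 → Slack 1 ∅ x y
  slack₁ {x} {y} p = slack-∅ (ℕ.+-mono-≤ (deg≤k x) p)

  degree-≥ : ∀ {x} xs → AllPairs _≢_ xs → All (Adj x) xs → length xs ≤ k
  degree-≥ {x} xs u ps = ℕ.≤-trans (count-≥length u ps) (deg≤k x)

-- Alice's strategy on a shooting star

module ShootingStar {G : Graph} (k : ℕ) (B : Blowup G 4 6 shootingStarᵖ)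
  (full : ∀ {x y} → adj G x y ≡ true → Blowup.Inside B x)
  (deg≤k : ∀ x → count (adj G x) ≤ k) where
  open Single k B full (ℕ.m≤m+n 4 2) deg≤k

  v w a b : V
  v = core 0F
  w = core 1F
  a = core 2F
  b = core 3F

  lv = lab-core 0F
  lw = lab-core 1F
  la = lab-core 2F
  lb = lab-core 3F

  vw : Adj v w
  vw = core-adj 0F 1F refl
  va : Adj v a
  va = core-adj 0F 2F refl
  ab : Adj a b
  ab = core-adj 2F 3F refl

  v≢w = adj⇒≢ vw
  v≢a = adj⇒≢ va
  w≢a = apart lw la refl
  w≢b = apart lw lb refl
  v≢b = apart lv lb refl

  2≤k : 2 ≤ k
  2≤k = degree-≥ {v} (w ∷ a ∷ []) ((w≢a ∷ []) ∷ [] ∷ []) (vw ∷ va ∷ [])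

  inside : ∀ {x i} → lab x ≡ i → i < 6 → Inside x
  inside refl p = p

  leaf₄ : ∀ {x} → lab x ≡ 4 → deg x ≤ 1
  leaf₄ e = degree-≤ (inside e (ℕ.m≤m+n 5 1)) e

  leaf₅ : ∀ {x} → lab x ≡ 5 → deg x ≤ 1
  leaf₅ e = degree-≤ (inside e (ℕ.m≤m+n 6 0)) e

  deg-a : deg a ≤ 2
  deg-a = degree-≤ (core-inside 2F) la

  deg-b : deg b ≤ 1
  deg-b = degree-≤ (core-inside 3F) lb

  bad : BadOnly ((v , w) ∷ (v , a) ∷ []) ∅
  bad = bad-∅ _ λ where
    x y _ (here (lx , ly)) → inj₂ (here (inj₂ (core-uniq 1F lx , core-uniq 0F ly)))
    x y _ (there (here (lx , ly))) → inj₂ (there (here (inj₁ (core-uniq 0F lx , core-uniq 2F ly))))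
    x y _ (there (there (here (lx , ly)))) → inj₁ (leaf-sum {x} (subst (λ z → deg z ≤ 1) (≡-sym (core-uniq 3F ly)) deg-b))
    x y _ (there (there (there (here (lx , ly))))) → inj₁ (leaf-sum {x} (leaf₄ ly))
    x y _ (there (there (there (there (here (lx , ly)))))) → inj₁ (leaf-sum {x} (leaf₅ ly))

  va-slack : Slack 1 ∅ v a
  va-slack = slack₁ {v} deg-a

  -- If Bob colours one of the threats vw and va, Alice colours the other. Otherwise she repeats his
  -- colour: on vw after ab, on va after a leaf edge at w, on ab after a leaf edge at v.
  turn : ∀ x y j → Leg ∅ x y j → Link x y → Wins (upd ∅ x y j) alice
  turn x y j leg (here (lx , ly)) with refl ← core-uniq 1F lx | refl ← core-uniq 0F ly =
    one-threatᴬ (Move.valid′ valid-∅ leg)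
      (restrict (Move.valid′ valid-∅ leg) (bad-step valid-∅ leg bad)
        (coloured (upd-hit {∅} (inj₂ (refl , refl))) ∷ keep (here refl) ∷ []))
      va (after valid-∅ leg (subst (2 ≤_) (≡-sym (free-∅ v a)) 2≤k))
  turn x y j leg (there (here (lx , ly))) with refl ← core-uniq 0F lx | refl ← core-uniq 2F ly =
    one-threatᴬ (Move.valid′ valid-∅ leg)
      (restrict (Move.valid′ valid-∅ leg) (bad-step valid-∅ leg bad)
        (keep (here refl) ∷ coloured (upd-hit {∅} (inj₁ (refl , refl))) ∷ []))
      vw (after valid-∅ leg (subst (2 ≤_) (≡-sym (free-∅ v w)) 2≤k))
  turn x y j leg (there (there (here (lx , ly)))) with refl ← core-uniq 2F lx | refl ← core-uniq 3F ly =
      aliceTurn leg′ (safe-wins (Move.valid′ val′ leg′)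
        (restrict (Move.valid′ val′ leg′) (bad-step val′ leg′ (bad-step valid-∅ leg bad))
          (coloured (upd-hit {upd ∅ a b j} (inj₁ (refl , refl))) ∷
           slack (Move.slack-gain val′ leg′ (inj₁ refl) (v≢a ∘ ≡-sym) (w≢a ∘ ≡-sym) (Move.seen-hit valid-∅ leg (inj₁ refl))
             (Move.slack-step valid-∅ leg va (none-off {∅} v≢a v≢b refl) va-slack)) ∷ [])) bob)
    where
      val′ = Move.valid′ valid-∅ leg
      leg′ : Leg (upd ∅ a b j) v w j
      leg′ = leg-intro vw (none-off {∅} v≢a v≢b refl) (sees-off {∅} v≢a v≢b sees-∅)
               (sees-off {∅} w≢a w≢b sees-∅) (λ ()) (λ ())
  turn x y j leg (there (there (there (here (lx , ly))))) with refl ← core-uniq 1F lx =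
      aliceTurn leg′ (last (2 ℕ.≟ k))
    where
      val′ = Move.valid′ valid-∅ leg
      y≢v : v ≢ y
      y≢v = apart lv ly refl
      y≢a : a ≢ y
      y≢a = apart la ly refl
      leg′ : Leg (upd ∅ w y j) v a j
      leg′ = leg-intro va (none-off {∅} v≢w y≢v refl) (sees-off {∅} v≢w y≢v sees-∅)
               (sees-off {∅} (w≢a ∘ ≡-sym) y≢a sees-∅) (λ ()) (λ ())
      val″ = Move.valid′ val′ leg′
      none : upd ∅ w y j v w ≡ nothing
      none = none-off {∅} v≢w y≢v refl
      last : Dec (2 ≡ k) → Wins (upd (upd ∅ w y j) v a j) bob
      -- With k = 2 only one colour is free for vw, too few for `one-threatᴮ`. But then deg v + deg
      -- w ≤ 4 = k + 2, so the one repetition of j makes vw safe.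
      last (yes refl) = safe-wins val″ (restrict val″ (bad-step val′ leg′ (bad-step valid-∅ leg bad))
        (slack (Move.slack-gain val′ leg′ (inj₁ refl) (v≢w ∘ ≡-sym) w≢a (Move.seen-hit valid-∅ leg (inj₁ refl))
           (Move.slack-step valid-∅ leg vw none (slack-∅ (ℕ.+-mono-≤ (deg≤k v) (deg≤k w))))) ∷
         coloured (upd-hit {upd ∅ w y j} (inj₁ (refl , refl))) ∷ [])) bob
      last (no 2≢k) = one-threatᴮ val″ (restrict val″ (bad-step val′ leg′ (bad-step valid-∅ leg bad))
         (keep (here refl) ∷ coloured (upd-hit {upd ∅ w y j} (inj₁ (refl , refl))) ∷ [])) vw
         (ℕ.≤-trans (after valid-∅ leg (subst (3 ≤_) (≡-sym (free-∅ v w)) (ℕ.≤∧≢⇒< 2≤k 2≢k)))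
           (Move.free-gain val′ leg′ v (Move.seen-hit valid-∅ leg (inj₁ refl))))
  turn x y j leg (there (there (there (there (here (lx , ly)))))) with refl ← core-uniq 0F lx =
      aliceTurn leg′ (one-threatᴮ (Move.valid′ val′ leg′)
        (restrict (Move.valid′ val′ leg′) (bad-step val′ leg′ (bad-step valid-∅ leg bad))
          (keep (here refl) ∷
           slack (slack-sym {0} {_} {a} (Move.slack-gain val′ leg′ (inj₁ refl) v≢a v≢b (Move.seen-hit valid-∅ leg (inj₁ refl))
             (slack-sym {1} {_} {v} (Move.slack-step valid-∅ leg va (none-offʳ {∅} (v≢a ∘ ≡-sym) a≢y refl) va-slack)))) ∷ []))
        vw (ℕ.≤-trans (after valid-∅ leg (subst (3 ≤_) (≡-sym (free-∅ v w)) 3≤k))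
             (ℕ.≤-reflexive (≡-sym (Move.free-off val′ leg′ v≢a v≢b w≢a w≢b)))))
    where
      val′ = Move.valid′ valid-∅ leg
      a≢y : a ≢ y
      a≢y = apart la ly refl
      b≢y : b ≢ y
      b≢y = apart lb ly refl
      leg′ : Leg (upd ∅ v y j) a b j
      leg′ = leg-intro ab (none-off {∅} (v≢a ∘ ≡-sym) a≢y refl) (sees-off {∅} (v≢a ∘ ≡-sym) a≢y sees-∅)
               (sees-off {∅} (v≢b ∘ ≡-sym) b≢y sees-∅) (λ ()) (λ ())
      3≤k : 3 ≤ k
      -- Bob's leaf y is a third neighbour of v; hence two colours remain free for vw after his
      -- move, and Alice's reply ab does not touch vw.
      3≤k = degree-≥ {v} (w ∷ a ∷ y ∷ []) ((w≢a ∷ apart lw ly refl ∷ []) ∷ (a≢y ∷ []) ∷ [] ∷ [])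
              (vw ∷ va ∷ proj₁ leg ∷ [])

  wins : Wins ∅ bob
  wins = bobTurnᵒ valid-∅ (bad-live valid-∅ bad (1≤ v w ∷ 1≤ v a ∷ [])) turn
    where
      1≤ : ∀ x y → 1 ≤ free ∅ x y
      1≤ x y = subst (1 ≤_) (≡-sym (free-∅ x y)) (ℕ.<⇒≤ 2≤k)

-- Alice's strategy on an amaryllis

module Amaryllis {G : Graph} (k : ℕ) (B : Blowup G 4 6 amaryllisᵖ)
  (full : ∀ {x y} → adj G x y ≡ true → Blowup.Inside B x)
  (deg≤k : ∀ x → count (adj G x) ≤ k) where
  open Single k B full (ℕ.m≤m+n 4 2) deg≤k public

  v w c₁ c₂ : V
  v  = core 0F
  w  = core 1F
  c₁ = core 2F
  c₂ = core 3F

  lv = lab-core 0F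
  lw = lab-core 1F
  l₁ = lab-core 2F
  l₂ = lab-core 3F

  vw : Adj v w
  vw = core-adj 0F 1F refl
  vc₁ : Adj v c₁
  vc₁ = core-adj 0F 2F refl
  vc₂ : Adj v c₂
  vc₂ = core-adj 0F 3F refl
  c₁c₂ : Adj c₁ c₂
  c₁c₂ = core-adj 2F 3F refl

  v≢w  = adj⇒≢ vw
  v≢c₁ = adj⇒≢ vc₁
  v≢c₂ = adj⇒≢ vc₂
  c₁≢c₂ = adj⇒≢ c₁c₂
  w≢c₁ = apart lw l₁ refl
  w≢c₂ = apart lw l₂ refl

  3≤k : 3 ≤ k
  3≤k = degree-≥ {v} (w ∷ c₁ ∷ c₂ ∷ []) ((w≢c₁ ∷ w≢c₂ ∷ []) ∷ (c₁≢c₂ ∷ []) ∷ [] ∷ []) (vw ∷ vc₁ ∷ vc₂ ∷ [])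

  deg-c₁ : deg c₁ ≤ 2
  deg-c₁ = degree-≤ (core-inside 2F) l₁

  deg-c₂ : deg c₂ ≤ 2
  deg-c₂ = degree-≤ (core-inside 3F) l₂

  inside : ∀ {x i} → lab x ≡ i → i < 6 → Inside x
  inside refl p = p

  leaf₄ : ∀ {x} → lab x ≡ 4 → deg x ≤ 1
  leaf₄ e = degree-≤ (inside e (ℕ.m≤m+n 5 1)) e

  leaf₅ : ∀ {x} → lab x ≡ 5 → deg x ≤ 1
  leaf₅ e = degree-≤ (inside e (ℕ.m≤m+n 6 0)) e

  bad : BadOnly ((v , w) ∷ (v , c₁) ∷ (v , c₂) ∷ []) ∅
  bad = bad-∅ _ λ where
    x y _ (here (lx , ly)) → inj₂ (here (inj₂ (core-uniq 1F lx , core-uniq 0F ly)))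
    x y _ (there (here (lx , ly))) → inj₂ (there (here (inj₁ (core-uniq 0F lx , core-uniq 2F ly))))
    x y _ (there (there (here (lx , ly)))) → inj₁ (ℕ.≤-trans
      (subst (λ z → deg z + deg y ≤ 4) (≡-sym (core-uniq 2F lx))
        (subst (λ z → deg c₁ + deg z ≤ 4) (≡-sym (core-uniq 3F ly)) (ℕ.+-mono-≤ deg-c₁ deg-c₂)))
      (s≤s 3≤k))
    x y _ (there (there (there (here (lx , ly))))) → inj₂ (there (there (here (inj₂ (core-uniq 3F lx , core-uniq 0F ly)))))
    x y _ (there (there (there (there (here (lx , ly)))))) → inj₁ (leaf-sum {x} (leaf₄ ly))
    x y _ (there (there (there (there (there (here (lx , ly))))))) → inj₁ (leaf-sum {x} (leaf₅ ly))

  slack-vc₁ : Slack 1 ∅ v c₁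
  slack-vc₁ = slack₁ {v} deg-c₁
  slack-vc₂ : Slack 1 ∅ v c₂
  slack-vc₂ = slack₁ {v} deg-c₂

  free-∅≥ : ∀ {m} → m ≤ k → ∀ x y → m ≤ free ∅ x y
  free-∅≥ m≤k x y = subst (_ ≤_) (≡-sym (free-∅ x y)) m≤k

  near₁ : ∀ {y} → Adj c₁ y → y ≡ v ⊎ y ≡ c₂
  near₁ a = case near a (core-inside 2F) l₁ of λ where
    (here e)         → inj₁ (core-uniq 0F e)
    (there (here e)) → inj₂ (core-uniq 3F e)

  near₂ : ∀ {y} → Adj c₂ y → y ≡ v ⊎ y ≡ c₁
  near₂ a = case near a (core-inside 3F) l₂ of λ where
    (here e)         → inj₂ (core-uniq 2F e)
    (there (here e)) → inj₁ (core-uniq 0F e)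

  -- The colour d is on vc₁ and is seen at w, and vw and vc₂ are the threats. If Bob colours one,
  -- Alice colours the other. On c₁c₂ and on leaf edges at w he cannot use d, so his colour is still
  -- free for Alice to repeat on vw or vc₂ respectively, which makes the other threat safe.
  no-flower-position : (∀ y → lab y ≢ 5) → ∀ {c d} → Valid c →
    BadOnly ((v , w) ∷ (v , c₂) ∷ []) c →
    c v w ≡ nothing → c v c₂ ≡ nothing → c c₁ c₂ ≡ nothing → c v c₁ ≡ just d →
    Slack 1 c v w → Slack 1 c v c₂ →
    Sees c v (d ∷ []) → Sees c w (d ∷ []) → seen c w d ≡ true → Sees c c₂ [] →
    2 ≤ free c v w → 2 ≤ free c v c₂ → Wins c bob
  no-flower-position noY {c} {d} val bad ew e₂ e₁₂ e₁ sw s₂ Sv Sw wd S₂ fw f₂ =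
      bobTurnᵒ val (bad-live val bad (ℕ.<⇒≤ fw ∷ ℕ.<⇒≤ f₂ ∷ [])) turn
    where
      turn : ∀ x y j → Leg c x y j → Link x y → Wins (upd c x y j) alice
      turn x y j leg (here (lx , ly)) with refl ← core-uniq 1F lx | refl ← core-uniq 0F ly =
        one-threatᴬ (Move.valid′ val leg) (restrict (Move.valid′ val leg) (bad-step val leg bad)
          (coloured (upd-hit {c} (inj₂ (refl , refl))) ∷ keep (here refl) ∷ [])) vc₂ (after val leg f₂)
      turn x y j leg (there (here (lx , ly))) with refl ← core-uniq 0F lx | refl ← core-uniq 2F ly =
        case trans (≡-sym e₁) (proj₁ (proj₂ leg)) of λ ()
      turn x y j leg (there (there (here (lx , ly)))) with refl ← core-uniq 2F lx | refl ← core-uniq 3F ly =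
          aliceTurn leg′ (safe-wins (Move.valid′ val′ leg′)
            (restrict (Move.valid′ val′ leg′) (bad-step val′ leg′ (bad-step val leg bad))
              (coloured (upd-hit {upd c c₁ c₂ j} (inj₁ (refl , refl))) ∷
               slack (Move.slack-gain val′ leg′ (inj₁ refl) (v≢c₂ ∘ ≡-sym) (w≢c₂ ∘ ≡-sym) (Move.seen-hit val leg (inj₂ refl))
                 (Move.slack-step val leg vc₂ (none-off {c} v≢c₁ v≢c₂ e₂) s₂)) ∷ [])) bob)
        where
          val′ = Move.valid′ val leg
          j≢d : j ≢ d
          j≢d refl = proj₁ (proj₂ (proj₂ leg)) v (trans (Valid.csym val c₁ v) e₁)
          leg′ : Leg (upd c c₁ c₂ j) v w j
          leg′ = leg-intro vw (none-off {c} v≢c₁ v≢c₂ ew) (sees-off {c} v≢c₁ v≢c₂ Sv) (sees-off {c} w≢c₁ w≢c₂ Sw)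
                   (≢⇒∉ j≢d) (≢⇒∉ j≢d)
      turn x y j leg (there (there (there (here (lx , ly))))) with refl ← core-uniq 3F lx | refl ← core-uniq 0F ly =
        one-threatᴬ (Move.valid′ val leg) (restrict (Move.valid′ val leg) (bad-step val leg bad)
          (keep (here refl) ∷ coloured (upd-hit {c} (inj₂ (refl , refl))) ∷ [])) vw (after val leg fw)
      turn x y j leg (there (there (there (there (here (lx , ly)))))) with refl ← core-uniq 1F lx =
          aliceTurn leg′ (safe-wins (Move.valid′ val′ leg′)
            (restrict (Move.valid′ val′ leg′) (bad-step val′ leg′ (bad-step val leg bad))
              (slack (Move.slack-gain val′ leg′ (inj₁ refl) (v≢w ∘ ≡-sym) w≢c₂ (Move.seen-hit val leg (inj₁ refl))
                 (Move.slack-step val leg vw (none-off {c} v≢w v≢y ew) sw)) ∷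
               coloured (upd-hit {upd c w y j} (inj₁ (refl , refl))) ∷ [])) bob)
        where
          val′ = Move.valid′ val leg
          v≢y : v ≢ y
          v≢y = apart lv ly refl
          j≢d : j ≢ d
          j≢d refl = let z , e = seen⁻ wd in proj₁ (proj₂ (proj₂ leg)) z e
          leg′ : Leg (upd c w y j) v c₂ j
          leg′ = leg-intro vc₂ (none-off {c} v≢w v≢y e₂) (sees-off {c} v≢w v≢y Sv)
                   (sees-off {c} (w≢c₂ ∘ ≡-sym) (apart l₂ ly refl) S₂) (≢⇒∉ j≢d) (λ ())
      turn x y j leg (there (there (there (there (there (here (lx , ly))))))) = ⊥-elim (noY y ly)

  module Flower (z : V) (lz : lab z ≡ 5) where
    vz : Adj v z
    vz = linked (core-inside 0F) (inside lz (ℕ.m≤m+n 6 0)) (there (there (there (there (there (here (lv , lz)))))))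

    4≤k : 4 ≤ k
    4≤k = degree-≥ {v} (w ∷ c₁ ∷ c₂ ∷ z ∷ [])
      ((w≢c₁ ∷ w≢c₂ ∷ apart lw lz refl ∷ []) ∷ (c₁≢c₂ ∷ apart l₁ lz refl ∷ []) ∷ (apart l₂ lz refl ∷ []) ∷ [] ∷ [])
      (vw ∷ vc₁ ∷ vc₂ ∷ vz ∷ [])

    -- With k ≥ 4 Alice can afford a second colour at v: she settles vw, and the remaining petal
    -- edge keeps k - 2 ≥ 2 free colours.
    turn-vc : ∀ {x y j} → (leg : Leg ∅ x y j) → ∀ {c} → Adj v c →
              upd ∅ x y j v w ≡ nothing → Sees (upd ∅ x y j) w [] →
              BadOnly ((v , w) ∷ (v , c) ∷ []) (upd ∅ x y j) → Wins (upd ∅ x y j) alice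
    turn-vc {x} {y} {j} leg vc e Sw bad′ =
      let d , d≢j = fresh (ℕ.≤-trans (ℕ.m≤m+n 2 1) 3≤k) j
          leg′ = leg-intro vw e (sees-upd sees-∅) Sw (≢⇒∉ d≢j) (λ ())
          val′ = Move.valid′ valid-∅ leg
      in aliceTurn leg′ (one-threatᴮ (Move.valid′ val′ leg′)
           (restrict (Move.valid′ val′ leg′) (bad-step val′ leg′ bad′)
             (coloured (upd-hit {upd ∅ x y j} (inj₁ (refl , refl))) ∷ keep (here refl) ∷ []))
           vc (after val′ leg′ (after valid-∅ leg (free-∅≥ 4≤k v _))))

    -- Alice settles vw at once. Its colour plays the part of d in `two-petals`, and the flower z
    -- supplies the spare edge at v.
    turn-wx : ∀ {y j} → lab y ≡ 4 → Leg ∅ w y j → Wins (upd ∅ w y j) alice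
    turn-wx {y} {j} ly leg =
      let v≢y = apart lv ly refl
          y≢c₁ = apart l₁ ly refl
          y≢c₂ = apart l₂ ly refl
          z≢w = apart lz lw refl
          z≢y = apart lz ly refl
          z≢v = apart lz lv refl
          val′ = Move.valid′ valid-∅ leg
          Sv = sees-off {∅} {w} {y} {j} v≢w v≢y sees-∅
          d , d≢j = fresh (ℕ.≤-trans (ℕ.m≤m+n 2 1) 3≤k) j
          leg′ = leg-intro vw (none-off {∅} v≢w v≢y refl) Sv (sees-upd {∅} sees-∅) (λ ()) (≢⇒∉ d≢j)
          val″ = Move.valid′ val′ leg′
          n₁ = none-offʳ {upd ∅ w y j} {v} {w} {d} {v} {c₁} (v≢c₁ ∘ ≡-sym) (w≢c₁ ∘ ≡-sym)
                 (none-off {∅} v≢w v≢y refl)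
          n₂ = none-offʳ {upd ∅ w y j} {v} {w} {d} {v} {c₂} (v≢c₂ ∘ ≡-sym) (w≢c₂ ∘ ≡-sym)
                 (none-off {∅} v≢w v≢y refl)
      in aliceTurn leg′ (two-petals val″ vc₁ vc₂ c₁c₂ near₁ near₂
           (restrict val″ (bad-step val′ leg′ (bad-step valid-∅ leg bad))
             (coloured (upd-hit {upd ∅ w y j} (inj₁ (refl , refl))) ∷ keep (here refl) ∷ keep (there (here refl)) ∷ []))
           n₁ n₂
           (none-off {upd ∅ w y j} (v≢c₁ ∘ ≡-sym) (w≢c₁ ∘ ≡-sym) (none-off {∅} (w≢c₁ ∘ ≡-sym) y≢c₁ refl))
           (Move.slack-step val′ leg′ vc₁ n₁ (Move.slack-step valid-∅ leg vc₁ (upd-none {upd ∅ w y j} n₁) slack-vc₁))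
           (Move.slack-step val′ leg′ vc₂ n₂ (Move.slack-step valid-∅ leg vc₂ (upd-none {upd ∅ w y j} n₂) slack-vc₂))
           (sees-upd Sv) (Move.seen-hit val′ leg′ (inj₁ refl))
           (sees-off (v≢c₁ ∘ ≡-sym) (w≢c₁ ∘ ≡-sym) (sees-off {∅} (w≢c₁ ∘ ≡-sym) y≢c₁ sees-∅))
           (sees-off (v≢c₂ ∘ ≡-sym) (w≢c₂ ∘ ≡-sym) (sees-off {∅} (w≢c₂ ∘ ≡-sym) y≢c₂ sees-∅))
           vz (none-offʳ {upd ∅ w y j} z≢v z≢w (none-offʳ {∅} z≢w z≢y refl))
           (apart lz l₁ refl) (apart lz l₂ refl)
           (sees-upd (sees-off {∅} z≢w z≢y sees-∅))
           (after val′ leg′ (after valid-∅ leg (free-∅≥ 4≤k v c₁)))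
           (after val′ leg′ (after valid-∅ leg (free-∅≥ 4≤k v c₂))))

    -- Repeating j on c₁c₂ makes both petal edges safe in one move, while vw keeps k - 2 ≥ 2 free
    -- colours.
    turn-vy : ∀ {y j} → lab y ≡ 5 → Leg ∅ v y j → Wins (upd ∅ v y j) alice
    turn-vy {y} {j} ly leg = aliceTurn leg′ (one-threatᴮ val″
        (restrict val″ (bad-step val′ leg′ (bad-step valid-∅ leg bad))
          (keep (here refl) ∷ gain (inj₁ refl) vc₁ (none-offʳ {∅} (v≢c₁ ∘ ≡-sym) y≢c₁ refl) slack-vc₁ ∷
           gain (inj₂ refl) vc₂ (none-offʳ {∅} (v≢c₂ ∘ ≡-sym) y≢c₂ refl) slack-vc₂ ∷ []))
        vw (after val′ leg′ (after valid-∅ leg (free-∅≥ 4≤k v w))))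
      where
        y≢c₁ : c₁ ≢ y
        y≢c₁ = apart l₁ ly refl
        y≢c₂ : c₂ ≢ y
        y≢c₂ = apart l₂ ly refl
        val′ = Move.valid′ valid-∅ leg
        leg′ : Leg (upd ∅ v y j) c₁ c₂ j
        leg′ = leg-intro c₁c₂ (none-off {∅} (v≢c₁ ∘ ≡-sym) y≢c₁ refl)
                 (sees-off {∅} (v≢c₁ ∘ ≡-sym) y≢c₁ sees-∅) (sees-off {∅} (v≢c₂ ∘ ≡-sym) y≢c₂ sees-∅) (λ ()) (λ ())
        val″ = Move.valid′ val′ leg′
        gain : ∀ {x L} → x ≡ c₁ ⊎ x ≡ c₂ → Adj v x → upd ∅ v y j v x ≡ nothing → Slack 1 ∅ v x →
               Status L (upd (upd ∅ v y j) c₁ c₂ j) (v , x)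
        gain {x} t a e s = slack (slack-sym {0} {_} {x} (Move.slack-gain val′ leg′ t v≢c₁ v≢c₂
          (Move.seen-hit valid-∅ leg (inj₁ refl)) (slack-sym {1} {_} {v} (Move.slack-step valid-∅ leg a e s))))

  deg-v : (∀ y → lab y ≢ 5) → deg v ≤ 3
  deg-v noY = count-≤length (w ∷ c₁ ∷ c₂ ∷ []) λ y a → case near a (core-inside 0F) lv of λ where
    (here e)                         → here (core-uniq 1F e)
    (there (here e))                 → there (here (core-uniq 2F e))
    (there (there (here e)))         → there (there (here (core-uniq 3F e)))
    (there (there (there (here e)))) → ⊥-elim (noY y e)

  deg-w : (∀ y → lab y ≢ 4) → deg w ≤ 1
  deg-w noX = count-≤length (v ∷ []) λ y a → case near a (core-inside 1F) lw of λ where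
    (here e)         → here (core-uniq 0F e)
    (there (here e)) → ⊥-elim (noX y e)

  module NoFlower (noY : ∀ y → lab y ≢ 5) where
    -- Without flowers deg v is 3, so vw is only two repeated colours short of being safe. Alice's
    -- first reply provides one repetition.
    slack-vw : Slack 2 ∅ v w
    slack-vw = slack-∅ (ℕ.≤-trans (ℕ.+-mono-≤ (deg-v noY) (deg≤k w)) (ℕ.≤-reflexive (ℕ.+-comm 3 k)))

    -- Repeating j on vc₁ settles one threat and provides the first repetition for vw.
    turn-wx : ∀ {y j} → lab y ≡ 4 → Leg ∅ w y j → Wins (upd ∅ w y j) alice
    turn-wx {y} {j} ly leg = aliceTurn leg′ (no-flower-position noY val″
        (restrict val″ (bad-step val′ leg′ (bad-step valid-∅ leg bad))
          (keep (here refl) ∷ coloured (upd-hit {upd ∅ w y j} (inj₁ (refl , refl))) ∷ keep (there (here refl)) ∷ []))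
        (none-offʳ {upd ∅ w y j} (v≢w ∘ ≡-sym) w≢c₁ (none-off {∅} v≢w v≢y refl)) n₂
        (none-offʳ {upd ∅ w y j} (v≢c₂ ∘ ≡-sym) (c₁≢c₂ ∘ ≡-sym) (none-off {∅} (w≢c₁ ∘ ≡-sym) y≢c₁ refl))
        (upd-hit {upd ∅ w y j} (inj₁ (refl , refl)))
        (Move.slack-gain val′ leg′ (inj₁ refl) (v≢w ∘ ≡-sym) w≢c₁ (Move.seen-hit valid-∅ leg (inj₁ refl))
          (Move.slack-step valid-∅ leg vw (none-off {∅} v≢w v≢y refl) slack-vw))
        (Move.slack-step val′ leg′ vc₂ n₂ (Move.slack-step valid-∅ leg vc₂ (upd-none {upd ∅ w y j} n₂) slack-vc₂))
        (sees-upd (sees-off {∅} v≢w v≢y sees-∅)) (sees-off (v≢w ∘ ≡-sym) w≢c₁ (sees-upd {∅} sees-∅))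
        (Move.seen-mono val′ leg′ (Move.seen-hit valid-∅ leg (inj₁ refl)))
        (sees-off (v≢c₂ ∘ ≡-sym) (c₁≢c₂ ∘ ≡-sym) (sees-off {∅} (w≢c₂ ∘ ≡-sym) y≢c₂ sees-∅))
        (ℕ.≤-trans (after valid-∅ leg (free-∅≥ 3≤k v w)) (Move.free-gain val′ leg′ v (Move.seen-hit valid-∅ leg (inj₁ refl))))
        (after val′ leg′ (ℕ.≤-trans (free-∅≥ 3≤k v c₂)
          (ℕ.≤-reflexive (≡-sym (Move.free-off valid-∅ leg v≢w v≢y (w≢c₂ ∘ ≡-sym) y≢c₂))))))
      where
        v≢y : v ≢ y
        v≢y = apart lv ly refl
        y≢c₁ : c₁ ≢ y
        y≢c₁ = apart l₁ ly refl
        y≢c₂ : c₂ ≢ y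
        y≢c₂ = apart l₂ ly refl
        val′ = Move.valid′ valid-∅ leg
        leg′ : Leg (upd ∅ w y j) v c₁ j
        leg′ = leg-intro vc₁ (none-off {∅} v≢w v≢y refl) (sees-off {∅} v≢w v≢y sees-∅)
                 (sees-off {∅} (w≢c₁ ∘ ≡-sym) y≢c₁ sees-∅) (λ ()) (λ ())
        val″ = Move.valid′ val′ leg′
        n₂ : upd (upd ∅ w y j) v c₁ j v c₂ ≡ nothing
        n₂ = none-offʳ {upd ∅ w y j} (v≢c₂ ∘ ≡-sym) (c₁≢c₂ ∘ ≡-sym) (none-off {∅} v≢w v≢y refl)

    -- If w has a leaf, Alice repeats j there and reaches the kind of position that arises in
    -- `turn-wx` with the two moves in the other order. If w has none, vw is itself a leaf edge and
    -- only vc₂ is threatened.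
    turn-vc₁ : ∀ {j} → Leg ∅ v c₁ j → Wins (upd ∅ v c₁ j) alice
    turn-vc₁ {j} leg with Fin.any? (λ y → lab y ℕ.≟ 4)
    ... | no noX = one-threatᴬ val′ (restrict val′ (bad-step valid-∅ leg bad)
            (slack (Move.slack-step valid-∅ leg vw (none-offʳ {∅} (v≢w ∘ ≡-sym) w≢c₁ refl)
               (slack-∅ (ℕ.≤-trans (leaf-sum {v} (deg-w λ y e → noX (y , e))) (ℕ.≤-reflexive (ℕ.+-comm 1 k))))) ∷
             coloured (upd-hit {∅} (inj₁ (refl , refl))) ∷ keep (here refl) ∷ []))
            vc₂ (after valid-∅ leg (free-∅≥ (ℕ.≤-trans (ℕ.m≤m+n 2 1) 3≤k) v c₂))
      where val′ = Move.valid′ valid-∅ leg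
    ... | yes (y , ly) = aliceTurn leg′ (no-flower-position noY val″
            (restrict val″ (bad-step val′ leg′ (bad-step valid-∅ leg bad))
              (keep (here refl) ∷
               coloured (trans (upd-miss {c′} (v≢w ∘ proj₁) (v≢y ∘ proj₁)) (upd-hit {∅} (inj₁ (refl , refl)))) ∷
               keep (there (here refl)) ∷ []))
            (none-off {c′} v≢w v≢y nw)
            n₂
            (none-off {c′} (w≢c₁ ∘ ≡-sym) y≢c₁ (none-offʳ {∅} (v≢c₂ ∘ ≡-sym) (c₁≢c₂ ∘ ≡-sym) refl))
            (trans (upd-miss {c′} (v≢w ∘ proj₁) (v≢y ∘ proj₁)) (upd-hit {∅} (inj₁ (refl , refl))))
            (slack-sym {1} {_} {w} (Move.slack-gain val′ leg′ (inj₁ refl) v≢w v≢y (Move.seen-hit valid-∅ leg (inj₁ refl))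
              (slack-sym {2} {_} {v} (Move.slack-step valid-∅ leg vw nw slack-vw))))
            (Move.slack-step val′ leg′ vc₂ n₂ (Move.slack-step valid-∅ leg vc₂ (upd-none {c′} n₂) slack-vc₂))
            (sees-off v≢w v≢y (sees-upd {∅} sees-∅)) (sees-upd (sees-off {∅} (v≢w ∘ ≡-sym) w≢c₁ sees-∅))
            (Move.seen-hit val′ leg′ (inj₁ refl))
            (sees-off (w≢c₂ ∘ ≡-sym) y≢c₂ (sees-off {∅} (v≢c₂ ∘ ≡-sym) (c₁≢c₂ ∘ ≡-sym) sees-∅))
            (ℕ.≤-trans (after valid-∅ leg (free-∅≥ 3≤k v w))
              (subst (λ m → free c′ v w ≤ m) (free-sym _ w v)
                (subst (_≤ free (upd c′ w y j) w v) (free-sym c′ w v)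
                  (Move.free-gain val′ leg′ w (Move.seen-hit valid-∅ leg (inj₁ refl))))))
            (ℕ.≤-trans (after valid-∅ leg (free-∅≥ 3≤k v c₂))
              (ℕ.≤-reflexive (≡-sym (Move.free-off val′ leg′ v≢w v≢y (w≢c₂ ∘ ≡-sym) y≢c₂)))))
      where
        c′ = upd ∅ v c₁ j
        v≢y : v ≢ y
        v≢y = apart lv ly refl
        y≢c₁ : c₁ ≢ y
        y≢c₁ = apart l₁ ly refl
        y≢c₂ : c₂ ≢ y
        y≢c₂ = apart l₂ ly refl
        wy : Adj w y
        wy = linked (core-inside 1F) (inside ly (ℕ.m≤m+n 5 1)) (there (there (there (there (here (lw , ly))))))
        val′ = Move.valid′ valid-∅ leg
        nw : c′ v w ≡ nothing
        nw = none-offʳ {∅} (v≢w ∘ ≡-sym) w≢c₁ refl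
        leg′ : Leg c′ w y j
        leg′ = leg-intro wy (none-off {∅} (v≢w ∘ ≡-sym) w≢c₁ refl) (sees-off {∅} (v≢w ∘ ≡-sym) w≢c₁ sees-∅)
                 (sees-off {∅} (v≢y ∘ ≡-sym) (y≢c₁ ∘ ≡-sym) sees-∅) (λ ()) (λ ())
        val″ = Move.valid′ val′ leg′
        n₂ : upd c′ w y j v c₂ ≡ nothing
        n₂ = none-off {c′} v≢w v≢y (none-offʳ {∅} (v≢c₂ ∘ ≡-sym) (c₁≢c₂ ∘ ≡-sym) refl)

  -- The edges vw and c₁c₂ are disjoint, and the same colour on both makes vc₁ and vc₂ safe.
  -- `turn-cc` is this pair of moves in the other order.
  turn-vw : ∀ {j} → Leg ∅ w v j → Wins (upd ∅ w v j) alice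
  turn-vw {j} leg = aliceTurn leg′ (safe-wins val″
      (restrict val″ (bad-step val′ leg′ (bad-step valid-∅ leg bad))
        (coloured (trans (upd-miss {upd ∅ w v j} (v≢c₁ ∘ proj₁) (v≢c₂ ∘ proj₁)) (upd-hit {∅} (inj₂ (refl , refl)))) ∷
         gain (inj₁ refl) vc₁ (none-offʳ {∅} (w≢c₁ ∘ ≡-sym) (v≢c₁ ∘ ≡-sym) refl) slack-vc₁ ∷
         gain (inj₂ refl) vc₂ (none-offʳ {∅} (w≢c₂ ∘ ≡-sym) (v≢c₂ ∘ ≡-sym) refl) slack-vc₂ ∷ [])) bob)
    where
      val′ = Move.valid′ valid-∅ leg
      leg′ : Leg (upd ∅ w v j) c₁ c₂ j
      leg′ = leg-intro c₁c₂ (none-off {∅} (w≢c₁ ∘ ≡-sym) (v≢c₁ ∘ ≡-sym) refl)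
               (sees-off {∅} (w≢c₁ ∘ ≡-sym) (v≢c₁ ∘ ≡-sym) sees-∅)
               (sees-off {∅} (w≢c₂ ∘ ≡-sym) (v≢c₂ ∘ ≡-sym) sees-∅) (λ ()) (λ ())
      val″ = Move.valid′ val′ leg′
      gain : ∀ {x L} → x ≡ c₁ ⊎ x ≡ c₂ → Adj v x → upd ∅ w v j v x ≡ nothing → Slack 1 ∅ v x →
             Status L (upd (upd ∅ w v j) c₁ c₂ j) (v , x)
      gain {x} t a e s = slack (slack-sym {0} {_} {x} (Move.slack-gain val′ leg′ t v≢c₁ v≢c₂
        (Move.seen-hit valid-∅ leg (inj₂ refl)) (slack-sym {1} {_} {v} (Move.slack-step valid-∅ leg a e s))))

  turn-cc : ∀ {j} → Leg ∅ c₁ c₂ j → Wins (upd ∅ c₁ c₂ j) alice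
  turn-cc {j} leg = aliceTurn leg′ (safe-wins val″
      (restrict val″ (bad-step val′ leg′ (bad-step valid-∅ leg bad))
        (coloured (upd-hit {upd ∅ c₁ c₂ j} (inj₁ (refl , refl))) ∷
         gain (inj₁ refl) (v≢c₁ ∘ ≡-sym) (w≢c₁ ∘ ≡-sym) vc₁ slack-vc₁ ∷
         gain (inj₂ refl) (v≢c₂ ∘ ≡-sym) (w≢c₂ ∘ ≡-sym) vc₂ slack-vc₂ ∷ [])) bob)
    where
      val′ = Move.valid′ valid-∅ leg
      leg′ : Leg (upd ∅ c₁ c₂ j) v w j
      leg′ = leg-intro vw (none-off {∅} v≢c₁ v≢c₂ refl) (sees-off {∅} v≢c₁ v≢c₂ sees-∅)
               (sees-off {∅} w≢c₁ w≢c₂ sees-∅) (λ ()) (λ ())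
      val″ = Move.valid′ val′ leg′
      gain : ∀ {x L} → x ≡ c₁ ⊎ x ≡ c₂ → x ≢ v → x ≢ w → Adj v x → Slack 1 ∅ v x →
             Status L (upd (upd ∅ c₁ c₂ j) v w j) (v , x)
      gain {x} t x≢v x≢w a s = slack (Move.slack-gain val′ leg′ (inj₁ refl) x≢v x≢w
        (Move.seen-hit valid-∅ leg t) (Move.slack-step valid-∅ leg a (none-off {∅} v≢c₁ v≢c₂ refl) s))

module AmaryllisWins {G : Graph} (k : ℕ) (B : Blowup G 4 6 amaryllisᵖ)
  (full : ∀ {x y} → adj G x y ≡ true → Blowup.Inside B x)
  (deg≤k : ∀ x → count (adj G x) ≤ k) where
  open Amaryllis k B full deg≤k

  -- The reflection exchanging c₁ and c₂. It reduces Bob's opening on vc₂ in the case without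
  -- flowers to that on vc₁.
  π : ℕ → ℕ
  π 2 = 3
  π 3 = 2
  π i = i

  πᶜ : Fin 4 → Fin 4
  πᶜ 0F = 0F
  πᶜ 1F = 1F
  πᶜ 2F = 3F
  πᶜ 3F = 2F

  core-π : ∀ i → toℕ (πᶜ i) ≡ π (toℕ i)
  core-π 0F = refl
  core-π 1F = refl
  core-π 2F = refl
  core-π 3F = refl

  involutive : ∀ i → π (π i) ≡ i
  involutive 0 = refl
  involutive 1 = refl
  involutive 2 = refl
  involutive 3 = refl
  involutive (suc (suc (suc (suc i)))) = refl

  bounded : ∀ {i} → i < 6 → π i < 6
  bounded {0} p = p
  bounded {1} p = p
  bounded {2} p = ℕ.m≤m+n 4 2
  bounded {3} p = ℕ.m≤m+n 3 3
  bounded {suc (suc (suc (suc i)))} p = p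

  symmetry : ∀ (i j : Fin 6) →
             hasEdge amaryllisᵖ (toℕ i) (toℕ j) ≡ hasEdge amaryllisᵖ (π (toℕ i)) (π (toℕ j))
  symmetry = toWitness {a? = Fin.all? λ i → Fin.all? λ j → _ Bool.≟ _} _

  module Mirror = Amaryllis k (relabel B π πᶜ core-π involutive bounded symmetry) (λ a → bounded (full a)) deg≤k

  turn : Dec (∃[ z ] lab z ≡ 5) → ∀ x y j → Leg ∅ x y j → Link x y → Wins (upd ∅ x y j) alice
  turn _ x y j leg (here (lx , ly)) with refl ← core-uniq 1F lx | refl ← core-uniq 0F ly = turn-vw leg
  turn _ x y j leg (there (there (here (lx , ly)))) with refl ← core-uniq 2F lx | refl ← core-uniq 3F ly = turn-cc leg
  turn (yes (z , lz)) x y j leg (there (here (lx , ly)))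
    with refl ← core-uniq 0F lx | refl ← core-uniq 2F ly =
    Flower.turn-vc z lz leg vc₂ (none-offʳ {∅} (v≢w ∘ ≡-sym) w≢c₁ refl) (sees-off {∅} (v≢w ∘ ≡-sym) w≢c₁ sees-∅)
      (restrict (Move.valid′ valid-∅ leg) (bad-step valid-∅ leg bad)
        (keep (here refl) ∷ coloured (upd-hit {∅} (inj₁ (refl , refl))) ∷ keep (there (here refl)) ∷ []))
  turn (yes (z , lz)) x y j leg (there (there (there (here (lx , ly)))))
    with refl ← core-uniq 3F lx | refl ← core-uniq 0F ly =
    swap-wins {∅} (Flower.turn-vc z lz leg′ vc₁ (none-offʳ {∅} (v≢w ∘ ≡-sym) w≢c₂ refl) (sees-off {∅} (v≢w ∘ ≡-sym) w≢c₂ sees-∅)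
      (restrict (Move.valid′ valid-∅ leg′) (bad-step valid-∅ leg′ bad)
        (keep (here refl) ∷ keep (there (here refl)) ∷ coloured (upd-hit {∅} (inj₁ (refl , refl))) ∷ [])))
    where leg′ = legal-swap {∅} valid-∅ leg
  turn (yes (z , lz)) x y j leg (there (there (there (there (here (lx , ly))))))
    with refl ← core-uniq 1F lx = Flower.turn-wx z lz ly leg
  turn (yes (z , lz)) x y j leg (there (there (there (there (there (here (lx , ly)))))))
    with refl ← core-uniq 0F lx = Flower.turn-vy z lz ly leg
  turn (no noY) x y j leg (there (here (lx , ly)))
    with refl ← core-uniq 0F lx | refl ← core-uniq 2F ly = NoFlower.turn-vc₁ (λ y e → noY (y , e)) leg
  turn (no noY) x y j leg (there (there (there (here (lx , ly)))))
    with refl ← core-uniq 3F lx | refl ← core-uniq 0F ly =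
    swap-wins {∅} (Mirror.NoFlower.turn-vc₁ (λ y e → noY (y , trans (≡-sym (involutive (lab y))) (cong π e)))
      (legal-swap {∅} valid-∅ leg))
  turn (no noY) x y j leg (there (there (there (there (here (lx , ly))))))
    with refl ← core-uniq 1F lx = NoFlower.turn-wx (λ y e → noY (y , e)) ly leg
  turn (no noY) x y j leg (there (there (there (there (there (here (lx , ly))))))) = ⊥-elim (noY (y , ly))

  wins : Wins ∅ bob
  wins = bobTurnᵒ valid-∅ (bad-live valid-∅ bad (1≤ v w ∷ 1≤ v c₁ ∷ 1≤ v c₂ ∷ [])) (turn (Fin.any? λ z → lab z ℕ.≟ 5))
    where
      1≤ : ∀ x y → 1 ≤ free ∅ x y
      1≤ = free-∅≥ (ℕ.≤-trans (ℕ.m≤m+n 1 2) 3≤k)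

-- Alice's strategy on a double vase

module DoubleVase {G : Graph} (k : ℕ) (B : Blowup G 5 6 doubleVaseᵖ)
  (full : ∀ {x y} → adj G x y ≡ true → Blowup.Inside B x)
  (deg≤k : ∀ x → count (adj G x) ≤ k) where
  open Single k B full (ℕ.m≤m+n 5 1) deg≤k

  v x₁ x₂ y₁ y₂ : V
  v  = core 0F
  x₁ = core 1F
  x₂ = core 2F
  y₁ = core 3F
  y₂ = core 4F

  vx₁ : Adj v x₁
  vx₁ = core-adj 0F 1F refl
  vx₂ : Adj v x₂
  vx₂ = core-adj 0F 2F refl
  vy₁ : Adj v y₁
  vy₁ = core-adj 0F 3F refl
  vy₂ : Adj v y₂
  vy₂ = core-adj 0F 4F refl
  x₁x₂ : Adj x₁ x₂
  x₁x₂ = core-adj 1F 2F refl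
  y₁y₂ : Adj y₁ y₂
  y₁y₂ = core-adj 3F 4F refl

  x₁≢y₁ = apart (lab-core 1F) (lab-core 3F) refl
  x₁≢y₂ = apart (lab-core 1F) (lab-core 4F) refl
  x₂≢y₁ = apart (lab-core 2F) (lab-core 3F) refl
  x₂≢y₂ = apart (lab-core 2F) (lab-core 4F) refl

  4≤k : 4 ≤ k
  4≤k = degree-≥ {v} (x₁ ∷ x₂ ∷ y₁ ∷ y₂ ∷ [])
    ((adj⇒≢ x₁x₂ ∷ x₁≢y₁ ∷ x₁≢y₂ ∷ []) ∷ (x₂≢y₁ ∷ x₂≢y₂ ∷ []) ∷ (adj⇒≢ y₁y₂ ∷ []) ∷ [] ∷ [])
    (vx₁ ∷ vx₂ ∷ vy₁ ∷ vy₂ ∷ [])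

  free-∅≥ : ∀ {m} → m ≤ k → ∀ x y → m ≤ free ∅ x y
  free-∅≥ m≤k x y = subst (_ ≤_) (≡-sym (free-∅ x y)) m≤k

  deg-x₁ : deg x₁ ≤ 2
  deg-x₁ = degree-≤ (core-inside 1F) (lab-core 1F)
  deg-x₂ : deg x₂ ≤ 2
  deg-x₂ = degree-≤ (core-inside 2F) (lab-core 2F)
  deg-y₁ : deg y₁ ≤ 2
  deg-y₁ = degree-≤ (core-inside 3F) (lab-core 3F)
  deg-y₂ : deg y₂ ≤ 2
  deg-y₂ = degree-≤ (core-inside 4F) (lab-core 4F)

  inside₅ : ∀ {x} → lab x ≡ 5 → Inside x
  inside₅ e = subst (_< 6) (≡-sym e) (ℕ.m≤m+n 6 0)

  leaf₅ : ∀ {x} → lab x ≡ 5 → deg x ≤ 1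
  leaf₅ e = degree-≤ (inside₅ e) e

  far-edge : ∀ {a b x y} → deg a ≤ 2 → deg b ≤ 2 → x ≡ a → y ≡ b → deg x + deg y ≤ suc k
  far-edge p q refl refl = ℕ.≤-trans (ℕ.+-mono-≤ p q) (ℕ.m≤n⇒m≤1+n 4≤k)

  bad : BadOnly ((v , x₁) ∷ (v , x₂) ∷ (v , y₁) ∷ (v , y₂) ∷ []) ∅
  bad = bad-∅ _ λ where
    x y _ (here (lx , ly)) → inj₂ (here (inj₁ (core-uniq 0F lx , core-uniq 1F ly)))
    x y _ (there (here (lx , ly))) → inj₁ (far-edge deg-x₁ deg-x₂ (core-uniq 1F lx) (core-uniq 2F ly))
    x y _ (there (there (here (lx , ly)))) → inj₂ (there (here (inj₂ (core-uniq 2F lx , core-uniq 0F ly))))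
    x y _ (there (there (there (here (lx , ly))))) → inj₂ (there (there (here (inj₁ (core-uniq 0F lx , core-uniq 3F ly)))))
    x y _ (there (there (there (there (here (lx , ly)))))) → inj₁ (far-edge deg-y₁ deg-y₂ (core-uniq 3F lx) (core-uniq 4F ly))
    x y _ (there (there (there (there (there (here (lx , ly))))))) →
      inj₂ (there (there (there (here (inj₂ (core-uniq 4F lx , core-uniq 0F ly))))))
    x y _ (there (there (there (there (there (there (here (lx , ly)))))))) → inj₁ (leaf-sum {x} (leaf₅ ly))

  -- Openings on an edge of a triangle, stated for arbitrary names: Bob plays in the triangle of a₁
  -- and a₂. Four instances cover both triangles and both of the edges at v in each.
  module Petals {a₁ a₂ b₁ b₂ : V} (va₁ : Adj v a₁) (va₂ : Adj v a₂) (vb₁ : Adj v b₁) (vb₂ : Adj v b₂)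
    (a₁a₂ : Adj a₁ a₂) (b₁b₂ : Adj b₁ b₂) (a₁≢b₁ : a₁ ≢ b₁) (a₁≢b₂ : a₁ ≢ b₂) (a₂≢b₁ : a₂ ≢ b₁) (a₂≢b₂ : a₂ ≢ b₂)
    (deg-a₁ : deg a₁ ≤ 2) (deg-a₂ : deg a₂ ≤ 2) (deg-b₁ : deg b₁ ≤ 2) (deg-b₂ : deg b₂ ≤ 2)
    (bad : BadOnly ((v , a₁) ∷ (v , a₂) ∷ (v , b₁) ∷ (v , b₂) ∷ []) ∅) where

    v≢a₁ = adj⇒≢ va₁
    v≢a₂ = adj⇒≢ va₂
    v≢b₁ = adj⇒≢ vb₁
    v≢b₂ = adj⇒≢ vb₂

    -- Alice's j on vb₁ settles that threat and makes va₁ and va₂ safe; vb₂ keeps k - 2 ≥ 2 free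
    -- colours.
    turn-far : ∀ {j} → Leg ∅ a₁ a₂ j → Wins (upd ∅ a₁ a₂ j) alice
    turn-far {j} leg = aliceTurn leg′ (one-threatᴮ (Move.valid′ val′ leg′)
        (restrict (Move.valid′ val′ leg′) (bad-step val′ leg′ (bad-step valid-∅ leg bad))
          (gain (inj₁ refl) va₁ a₁≢b₁ deg-a₁ ∷ gain (inj₂ refl) va₂ a₂≢b₁ deg-a₂ ∷
           coloured (upd-hit {upd ∅ a₁ a₂ j} (inj₁ (refl , refl))) ∷ keep (here refl) ∷ []))
        vb₂ (after val′ leg′ (after valid-∅ leg (free-∅≥ 4≤k v b₂))))
      where
        val′ = Move.valid′ valid-∅ leg
        leg′ : Leg (upd ∅ a₁ a₂ j) v b₁ j
        leg′ = leg-intro vb₁ (none-off {∅} v≢a₁ v≢a₂ refl) (sees-off {∅} v≢a₁ v≢a₂ sees-∅)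
                 (sees-off {∅} (a₁≢b₁ ∘ ≡-sym) (a₂≢b₁ ∘ ≡-sym) sees-∅) (λ ()) (λ ())
        gain : ∀ {x L} → x ≡ a₁ ⊎ x ≡ a₂ → Adj v x → x ≢ b₁ → deg x ≤ 2 →
               Status L (upd (upd ∅ a₁ a₂ j) v b₁ j) (v , x)
        gain t a x≢b₁ d = slack (Move.slack-gain val′ leg′ (inj₁ refl) (adj⇒≢ a ∘ ≡-sym) x≢b₁
          (Move.seen-hit valid-∅ leg t) (Move.slack-step valid-∅ leg a (none-off {∅} v≢a₁ v≢a₂ refl) (slack₁ {v} d)))

    -- Alice's j on the far edge of the other triangle makes both vb₁ and vb₂ safe; va₂ keeps k - 2
    -- ≥ 2 free colours.
    turn-near : ∀ {j} → Leg ∅ v a₁ j → Wins (upd ∅ v a₁ j) alice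
    turn-near {j} leg = aliceTurn leg′ (one-threatᴮ (Move.valid′ val′ leg′)
        (restrict (Move.valid′ val′ leg′) (bad-step val′ leg′ (bad-step valid-∅ leg bad))
          (coloured (trans (upd-miss {upd ∅ v a₁ j} (v≢b₁ ∘ proj₁) (v≢b₂ ∘ proj₁)) (upd-hit {∅} (inj₁ (refl , refl)))) ∷
           keep (here refl) ∷ gain (inj₁ refl) vb₁ (a₁≢b₁ ∘ ≡-sym) deg-b₁ ∷ gain (inj₂ refl) vb₂ (a₁≢b₂ ∘ ≡-sym) deg-b₂ ∷ []))
        va₂ (after val′ leg′ (after valid-∅ leg (free-∅≥ 4≤k v a₂))))
      where
        val′ = Move.valid′ valid-∅ leg
        leg′ : Leg (upd ∅ v a₁ j) b₁ b₂ j
        leg′ = leg-intro b₁b₂ (none-off {∅} (v≢b₁ ∘ ≡-sym) (a₁≢b₁ ∘ ≡-sym) refl)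
                 (sees-off {∅} (v≢b₁ ∘ ≡-sym) (a₁≢b₁ ∘ ≡-sym) sees-∅)
                 (sees-off {∅} (v≢b₂ ∘ ≡-sym) (a₁≢b₂ ∘ ≡-sym) sees-∅) (λ ()) (λ ())
        gain : ∀ {x L} → x ≡ b₁ ⊎ x ≡ b₂ → Adj v x → x ≢ a₁ → deg x ≤ 2 →
               Status L (upd (upd ∅ v a₁ j) b₁ b₂ j) (v , x)
        gain {x} t a x≢a₁ d = slack (slack-sym {0} {_} {x} (Move.slack-gain val′ leg′ t v≢b₁ v≢b₂
          (Move.seen-hit valid-∅ leg (inj₁ refl)) (slack-sym {1} {_} {v}
            (Move.slack-step valid-∅ leg a (none-offʳ {∅} (adj⇒≢ a ∘ ≡-sym) x≢a₁ refl) (slack₁ {v} d)))))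

  module P₁ = Petals vx₁ vx₂ vy₁ vy₂ x₁x₂ y₁y₂ x₁≢y₁ x₁≢y₂ x₂≢y₁ x₂≢y₂ deg-x₁ deg-x₂ deg-y₁ deg-y₂ bad

  rearranged : ∀ {L} → All (_∈ L) ((v , x₁) ∷ (v , x₂) ∷ (v , y₁) ∷ (v , y₂) ∷ []) → BadOnly L ∅
  rearranged ms = restrict valid-∅ bad (All.map keep ms)

  module P₂ = Petals vx₂ vx₁ vy₁ vy₂ (adj-sym x₁x₂) y₁y₂ x₂≢y₁ x₂≢y₂ x₁≢y₁ x₁≢y₂ deg-x₂ deg-x₁ deg-y₁ deg-y₂
    (rearranged (there (here refl) ∷ here refl ∷ there (there (here refl)) ∷ there (there (there (here refl))) ∷ []))
  module P₃ = Petals vy₁ vy₂ vx₁ vx₂ y₁y₂ x₁x₂ (x₁≢y₁ ∘ ≡-sym) (x₂≢y₁ ∘ ≡-sym) (x₁≢y₂ ∘ ≡-sym) (x₂≢y₂ ∘ ≡-sym)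
    deg-y₁ deg-y₂ deg-x₁ deg-x₂
    (rearranged (there (there (here refl)) ∷ there (there (there (here refl))) ∷ here refl ∷ there (here refl) ∷ []))
  module P₄ = Petals vy₂ vy₁ vx₁ vx₂ (adj-sym y₁y₂) x₁x₂ (x₁≢y₂ ∘ ≡-sym) (x₂≢y₂ ∘ ≡-sym) (x₁≢y₁ ∘ ≡-sym) (x₂≢y₁ ∘ ≡-sym)
    deg-y₂ deg-y₁ deg-x₁ deg-x₂
    (rearranged (there (there (here refl)) ∷ there (there (there (here refl))) ∷ there (here refl) ∷ here refl ∷ []))

  near₃ : ∀ {y} → Adj y₁ y → y ≡ v ⊎ y ≡ y₂
  near₃ a = case near a (core-inside 3F) (lab-core 3F) of λ where
    (here e)         → inj₁ (core-uniq 0F e)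
    (there (here e)) → inj₂ (core-uniq 4F e)

  near₄ : ∀ {y} → Adj y₂ y → y ≡ v ⊎ y ≡ y₁
  near₄ a = case near a (core-inside 4F) (lab-core 4F) of λ where
    (here e)         → inj₂ (core-uniq 3F e)
    (there (here e)) → inj₁ (core-uniq 0F e)

  -- Alice's j on x₁x₂ makes one triangle safe. The other one is left to `two-petals`, with the safe
  -- but still open vx₁ as spare edge.
  turn-leaf : ∀ {z j} → lab z ≡ 5 → Leg ∅ v z j → Wins (upd ∅ v z j) alice
  turn-leaf {z} {j} lz leg = aliceTurn leg′ (two-petals val″ vy₁ vy₂ y₁y₂ near₃ near₄
      (restrict val″ (bad-step val′ leg′ (bad-step valid-∅ leg bad))
        (gain (inj₁ refl) vx₁ x₁≢z deg-x₁ ∷ gain (inj₂ refl) vx₂ x₂≢z deg-x₂ ∷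
         keep (here refl) ∷ keep (there (here refl)) ∷ []))
      (none-v y₁≢z v≢y₁) (none-v y₂≢z v≢y₂)
      (none-off {c′} (x₁≢y₁ ∘ ≡-sym) (x₂≢y₁ ∘ ≡-sym) (none-off {∅} (v≢y₁ ∘ ≡-sym) y₁≢z refl))
      (keep-slack vy₁ deg-y₁ y₁≢z v≢y₁) (keep-slack vy₂ deg-y₂ y₂≢z v≢y₂)
      (sees-off v≢x₁ v≢x₂ (sees-upd {∅} sees-∅)) (Move.seen-mono val′ leg′ (Move.seen-hit valid-∅ leg (inj₁ refl)))
      (sees-off (x₁≢y₁ ∘ ≡-sym) (x₂≢y₁ ∘ ≡-sym) (sees-off {∅} (v≢y₁ ∘ ≡-sym) y₁≢z sees-∅))
      (sees-off (x₁≢y₂ ∘ ≡-sym) (x₂≢y₂ ∘ ≡-sym) (sees-off {∅} (v≢y₂ ∘ ≡-sym) y₂≢z sees-∅))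
      vx₁ (none-v x₁≢z v≢x₁) x₁≢y₁ x₁≢y₂
      (sees-upd (sees-off {∅} (v≢x₁ ∘ ≡-sym) x₁≢z sees-∅))
      (after val′ leg′ (after valid-∅ leg (free-∅≥ 4≤k v y₁)))
      (after val′ leg′ (after valid-∅ leg (free-∅≥ 4≤k v y₂))))
    where
      c′ = upd ∅ v z j
      v≢x₁ = adj⇒≢ vx₁
      v≢x₂ = adj⇒≢ vx₂
      v≢y₁ = adj⇒≢ vy₁
      v≢y₂ = adj⇒≢ vy₂
      x₁≢z : x₁ ≢ z
      x₁≢z = apart (lab-core 1F) lz refl
      x₂≢z : x₂ ≢ z
      x₂≢z = apart (lab-core 2F) lz refl
      y₁≢z : y₁ ≢ z
      y₁≢z = apart (lab-core 3F) lz refl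
      y₂≢z : y₂ ≢ z
      y₂≢z = apart (lab-core 4F) lz refl
      val′ = Move.valid′ valid-∅ leg
      leg′ : Leg c′ x₁ x₂ j
      leg′ = leg-intro x₁x₂ (none-off {∅} (v≢x₁ ∘ ≡-sym) x₁≢z refl)
               (sees-off {∅} (v≢x₁ ∘ ≡-sym) x₁≢z sees-∅) (sees-off {∅} (v≢x₂ ∘ ≡-sym) x₂≢z sees-∅) (λ ()) (λ ())
      val″ = Move.valid′ val′ leg′
      none-v : ∀ {x} → x ≢ z → v ≢ x → upd c′ x₁ x₂ j v x ≡ nothing
      none-v p q = none-off {c′} v≢x₁ v≢x₂ (none-offʳ {∅} (q ∘ ≡-sym) p refl)
      keep-slack : ∀ {x} → Adj v x → deg x ≤ 2 → x ≢ z → v ≢ x → Slack 1 (upd c′ x₁ x₂ j) v x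
      keep-slack a d p q = Move.slack-step val′ leg′ a (none-v p q)
        (Move.slack-step valid-∅ leg a (upd-none {c′} (none-v p q)) (slack₁ {v} d))
      gain : ∀ {x L} → x ≡ x₁ ⊎ x ≡ x₂ → Adj v x → x ≢ z → deg x ≤ 2 →
             Status L (upd c′ x₁ x₂ j) (v , x)
      gain {x} t a x≢z d = slack (slack-sym {0} {_} {x} (Move.slack-gain val′ leg′ t v≢x₁ v≢x₂
        (Move.seen-hit valid-∅ leg (inj₁ refl)) (slack-sym {1} {_} {v}
          (Move.slack-step valid-∅ leg a (none-offʳ {∅} (adj⇒≢ a ∘ ≡-sym) x≢z refl) (slack₁ {v} d)))))

  turn : ∀ x y j → Leg ∅ x y j → Link x y → Wins (upd ∅ x y j) alice
  turn x y j leg (here (lx , ly)) with refl ← core-uniq 0F lx | refl ← core-uniq 1F ly = P₁.turn-near leg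
  turn x y j leg (there (here (lx , ly))) with refl ← core-uniq 1F lx | refl ← core-uniq 2F ly = P₁.turn-far leg
  turn x y j leg (there (there (here (lx , ly)))) with refl ← core-uniq 2F lx | refl ← core-uniq 0F ly =
    swap-wins {∅} (P₂.turn-near (legal-swap {∅} valid-∅ leg))
  turn x y j leg (there (there (there (here (lx , ly))))) with refl ← core-uniq 0F lx | refl ← core-uniq 3F ly =
    P₃.turn-near leg
  turn x y j leg (there (there (there (there (here (lx , ly)))))) with refl ← core-uniq 3F lx | refl ← core-uniq 4F ly =
    P₃.turn-far leg
  turn x y j leg (there (there (there (there (there (here (lx , ly)))))))
    with refl ← core-uniq 4F lx | refl ← core-uniq 0F ly =
    swap-wins {∅} (P₄.turn-near (legal-swap {∅} valid-∅ leg))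
  turn x y j leg (there (there (there (there (there (there (here (lx , ly)))))))) with refl ← core-uniq 0F lx =
    turn-leaf ly leg

  wins : Wins ∅ bob
  wins = bobTurnᵒ valid-∅ (bad-live valid-∅ bad (1≤ v x₁ ∷ 1≤ v x₂ ∷ 1≤ v y₁ ∷ 1≤ v y₂ ∷ [])) turn
    where
      1≤ : ∀ x y → 1 ≤ free ∅ x y
      1≤ = free-∅≥ (ℕ.≤-trans (ℕ.m≤m+n 1 3) 4≤k)

-- Alice's strategy on a candy

count-unique : ∀ {m} {P : Fin m → Bool} {x y} → count P ≡ 1 → P x ≡ true → P y ≡ true → x ≡ y
count-unique {P = P} {x} {y} e p q with x Fin.≟ y
... | yes r = r
... | no x≢y with s≤s () ← subst (2 ≤_) e
        (count-≥length {P = P} {x ∷ y ∷ []} ((x≢y ∷ []) ∷ [] ∷ []) (p ∷ q ∷ []))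

module TwoCentres (G : Graph) (k : ℕ) (deg≤k : ∀ x → count (adj G x) ≤ k) where
  open Position G k public

  Open : Col → V → V → Set
  Open c x y = Adj x y × c x y ≡ nothing

  -- The edge a–y is safe, or it lacks a single repeated colour and b–y is still open.
  Fine : Col → V → V → Set
  Fine c a b = ∀ {y} → Adj a y → c a y ≡ nothing →
               Slack 0 c a y ⊎ (Slack 1 c a y × Adj b y × c b y ≡ nothing)

  unc≤fre : ∀ {c x} → Valid c → unc c x ≤ fre c x
  unc≤fre {c} {x} val = ℕ.+-cancelʳ-≤ k (unc c x) (fre c x)
    (ℕ.≤-trans (ℕ.≤-reflexive (trans (ℕ.+-comm (unc c x) k) (≡-sym (Valid.bal val x))))
      (ℕ.+-monoʳ-≤ (fre c x) (deg≤k x)))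

  open-mono : ∀ {c x y} → Adj x y → c x y ≡ nothing → uncolouredAt c x y ≡ true
  open-mono {c} = uncolouredAt⁺ {c}

  module Pair (a b : V) (a≢b : a ≢ b) (¬ab : ¬ Adj a b)
    (cover : ∀ {x y} → Adj x y → (x ≡ a ⊎ x ≡ b) ⊎ (y ≡ a ⊎ y ≡ b)) where

    ends : ∀ {y x} → Adj a y → Adj y x → x ≡ a ⊎ x ≡ b
    ends p q with cover q
    ... | inj₁ (inj₁ refl) = ⊥-elim (adj⇒≢ p refl)
    ... | inj₁ (inj₂ refl) = ⊥-elim (¬ab p)
    ... | inj₂ r           = r

    y≢b : ∀ {y} → Adj a y → b ≢ y
    y≢b p refl = ¬ab p

    bare : ∀ {c y} → Valid c → Adj a y → c a y ≡ nothing → c b y ≡ nothing → ∀ j → seen c y j ≡ false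
    bare {c} {y} val p e f j = unseen⁺ λ w g → case ends p (Valid.onEdge val g) of λ where
      (inj₁ refl) → case trans (≡-sym e) (trans (Valid.csym val a y) g) of λ ()
      (inj₂ refl) → case trans (≡-sym f) (trans (Valid.csym val b y) g) of λ ()

    -- Nothing is seen at y, so every colour free at a is free for ay, and since deg a ≤ k there are
    -- at least as many of them as open edges at a.
    bare-free : ∀ {c y} → Valid c → Adj a y → c a y ≡ nothing → c b y ≡ nothing → 1 ≤ free c a y
    bare-free {c} {y} val p e f = ℕ.≤-trans (count-pos⁺ {x = y} (open-mono {c} p e))
      (ℕ.≤-trans (unc≤fre val) (ℕ.≤-reflexive
        (count-cong λ j → trans (≡-sym (Bool.∧-identityʳ _))
          (cong (λ s → not (seen c a j) ∧ not s) (≡-sym (bare val p e f j))))))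

    fine-live : ∀ {c} → Valid c → Fine c a b → ∀ {y} → Adj a y → c a y ≡ nothing → 1 ≤ free c a y
    fine-live val fine p e with fine p e
    ... | inj₁ s           = slack⇒live val p e s
    ... | inj₂ (_ , q , f) = bare-free val p e f

    fine-∅ : Fine ∅ a b
    fine-∅ {y} p _ with bool? (adj G b y)
    ... | inj₁ q = inj₂ (slack-∅ (ℕ.+-mono-≤ (deg≤k a) two) , q , refl)
      where
        two : deg y ≤ 2
        two = count-≤length (a ∷ b ∷ []) λ x r → case ends p r of λ where
          (inj₁ e) → here e
          (inj₂ e) → there (here e)
    ... | inj₂ q = inj₁ (slack-∅ (ℕ.+-mono-≤ (deg≤k a) one))
      where
        one : deg y ≤ 1
        one = count-≤length (a ∷ []) λ x r → case ends p r of λ where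
          (inj₁ e)    → here e
          (inj₂ refl) → ⊥-elim (true≢false (adj-sym r) q)

    fine-off : ∀ {c y j} → Valid c → Leg c a y j → Fine c a b → Fine (upd c a y j) a b
    fine-off {c} val leg fine p e with fine p (upd-none {c} e)
    ... | inj₁ s           = inj₁ (Move.slack-step val leg p e s)
    ... | inj₂ (s , q , f) = inj₂ (Move.slack-step val leg p e s , q ,
                               none-off {c} (a≢b ∘ ≡-sym) (y≢b (proj₁ leg)) f)

  -- The invariant for two centres of degree k. `noEnd` excludes the fatal ending: one open edge
  -- left at each centre, both leading to the same w, when a single colour is missing at both
  -- centres and would have to serve for both edges.
  record Balanced (a b : V) (c : Col) : Set where
    field
      valid : Valid c
      same  : ∀ j → seen c a j ≡ seen c b j
      fineᵃ : Fine c a b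
      fineᵇ : Fine c b a
      noEnd : ∀ {w} → unc c a ≡ 1 → Open c a w → Open c b w → ⊥

  unc≡fre : ∀ {c x} → Valid c → deg x ≡ k → unc c x ≡ fre c x
  unc≡fre {c} {x} val e = ℕ.+-cancelʳ-≡ k (unc c x) (fre c x)
    (trans (ℕ.+-comm (unc c x) k) (trans (≡-sym (Valid.bal val x)) (cong (fre c x +_) e)))

  balanced-unc : ∀ {a b c} → deg a ≡ k → deg b ≡ k → Balanced a b c → unc c a ≡ unc c b
  balanced-unc da db inv = trans (unc≡fre valid da) (trans (count-cong λ j → cong not (same j)) (≡-sym (unc≡fre valid db)))
    where open Balanced inv

  balanced-swap : ∀ {a b c} → deg a ≡ k → deg b ≡ k → Balanced a b c → Balanced b a c
  balanced-swap da db inv = record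
    { valid = valid
    ; same  = λ j → ≡-sym (same j)
    ; fineᵃ = fineᵇ
    ; fineᵇ = fineᵃ
    ; noEnd = λ u p q → noEnd (trans (balanced-unc da db inv) u) q p
    }
    where open Balanced inv

  module Reply (a b : V) (a≢b : a ≢ b) (¬ab : ¬ Adj a b)
    (cover : ∀ {x y} → Adj x y → (x ≡ a ⊎ x ≡ b) ⊎ (y ≡ a ⊎ y ≡ b))
    (da : deg a ≡ k) (db : deg b ≡ k) where
    open Pair a b a≢b ¬ab cover

    -- The end z′ of Alice's reply to Bob's move az. The last clause protects `noEnd`: if the round
    -- leaves one open edge aw at a whose partner bw is open, Alice has to close that partner.
    Chosen : Col → V → V → Set
    Chosen c z z′ = z′ ≢ z × Open c b z′ ×
      (∀ {w} → unc c a ≡ 2 → w ≢ z → Open c a w → Open c b w → w ≡ z′)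

    two-left : ∀ {c z w w′} → unc c a ≡ 2 → Open c a z → Open c a w → Open c a w′ → w ≢ z → w′ ≢ z → w′ ≡ w
    two-left {c} {z} {w} {w′} u oz ow ow′ w≢z w′≢z with w′ Fin.≟ w
    ... | yes e = e
    ... | no w′≢w with s≤s (s≤s ()) ← subst (3 ≤_) u
            (count-≥length {P = uncolouredAt c a} {w′ ∷ w ∷ z ∷ []} ((w′≢w ∷ w′≢z ∷ []) ∷ (w≢z ∷ []) ∷ [] ∷ [])
              (open-mono {c} (proj₁ ow′) (proj₂ ow′) ∷ open-mono {c} (proj₁ ow) (proj₂ ow) ∷ open-mono {c} (proj₁ oz) (proj₂ oz) ∷ []))

    -- A vertex open to both centres is preferred; when a has two open edges it is the only
    -- candidate. If there is none, any open edge at b other than bz will do. It exists because b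
    -- has as many open edges as a, and a single one cannot be bz by `noEnd`.
    choose : ∀ {c z} → Balanced a b c → Open c a z → ∃[ z′ ] Chosen c z z′
    choose {c} {z} inv oz with Fin.any? (λ w → ¬? (w Fin.≟ z) ×-dec (uncolouredAt c a w Bool.≟ true) ×-dec (uncolouredAt c b w Bool.≟ true))
    ... | yes (w , w≢z , ow , ow′) = w , w≢z , uncolouredAt⁻ {c} ow′ ,
            λ u p q _ → two-left {c} u oz (uncolouredAt⁻ {c} ow) q w≢z p
    ... | no none with ℕ.m≤n⇒m<n∨m≡n (ℕ.≤-trans (count-pos⁺ {x = z} (open-mono {c} (proj₁ oz) (proj₂ oz)))
                        (ℕ.≤-reflexive (balanced-unc da db inv)))
    ...   | inj₁ 2≤ = let z′ , p , q = count-≥2 {P = uncolouredAt c b} z 2≤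
                      in z′ , p , uncolouredAt⁻ {c} q ,
                         λ {w} _ w≢z r s → ⊥-elim (none (w , w≢z , open-mono {c} (proj₁ r) (proj₂ r) , open-mono {c} (proj₁ s) (proj₂ s)))
    ...   | inj₂ 1≡ = let z′ , q = count-pos {P = uncolouredAt c b} (ℕ.≤-reflexive 1≡)
                      in z′ , (λ where refl → Balanced.noEnd inv (trans (balanced-unc da db inv) (≡-sym 1≡)) oz (uncolouredAt⁻ {c} q)) ,
                         uncolouredAt⁻ {c} q ,
                         λ {w} _ w≢z r s → ⊥-elim (none (w , w≢z , open-mono {c} (proj₁ r) (proj₂ r) , open-mono {c} (proj₁ s) (proj₂ s)))

    reply : ∀ {c z j} → Balanced a b c → Leg c a z j →
            ∃[ z′ ] (Leg (upd c a z j) b z′ j × Balanced a b (upd (upd c a z j) b z′ j))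
    reply {c} {z} {j} inv leg
      with choose inv (proj₁ leg , proj₁ (proj₂ leg))
    ... | z′ , z′≢z , (bz′ , e′) , forced = z′ , leg′ , record
          { valid = M′.valid′
          ; same  = same′
          ; fineᵃ = fineᵃ′
          ; fineᵇ = fineᵇ′
          ; noEnd = λ {w} u (p , e) (q , f) →
              upd-none-≢ {c′} f (inj₁ (refl , forced
                (trans (M.unc-hit (inj₁ refl)) (cong suc (trans (≡-sym (M′.unc-off a≢b a≢z′)) u)))
                (λ where refl → upd-none-≢ {c} (upd-none {c′} e) (inj₁ (refl , refl)))
                (p , upd-none {c} (upd-none {c′} e)) (q , upd-none {c} (upd-none {c′} f))))
          }
      where
        open Balanced inv
        module M = Move valid leg
        c′ = upd c a z j
        b≢a = a≢b ∘ ≡-sym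
        a≢z = adj⇒≢ (proj₁ leg)
        b≢z = y≢b (proj₁ leg)
        b≢z′ = adj⇒≢ bz′
        a≢z′ : a ≢ z′
        a≢z′ refl = ¬ab (adj-sym bz′)
        leg′ : Leg c′ b z′ j
        -- b has not seen j because a had not. An edge of colour j at z′ would lead to a, which had
        -- not seen j, or would be bz′, which is open.
        leg′ = bz′ , none-off {c} b≢a b≢z e′
          , unseen⁻ (trans (M.seen-off b≢a b≢z) (trans (≡-sym (same j)) (M.unseen-before (inj₁ refl))))
          , λ w f → case cover (M.valid′ .Valid.onEdge f) of λ where
              (inj₁ (inj₁ refl)) → a≢z′ refl
              (inj₁ (inj₂ refl)) → b≢z′ refl
              (inj₂ (inj₁ refl)) → proj₁ (proj₂ (proj₂ leg)) z′
                (trans (Valid.csym valid a z′) (trans (≡-sym (M.upd-off (a≢z′ ∘ ≡-sym) z′≢z)) f))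
              (inj₂ (inj₂ refl)) → case trans (≡-sym e′) (trans (Valid.csym valid b z′)
                (trans (≡-sym (M.upd-off (a≢z′ ∘ ≡-sym) z′≢z)) f)) of λ ()
        module M′ = Move M.valid′ leg′
        c″ = upd c′ b z′ j
        same′ : ∀ i → seen c″ a i ≡ seen c″ b i
        same′ i with i Fin.≟ j
        ... | yes refl = trans (M′.seen-mono (M.seen-hit (inj₁ refl))) (≡-sym (M′.seen-hit (inj₁ refl)))
        ... | no i≢j   = trans (≡-sym (M′.seen-same i≢j)) (trans (≡-sym (M.seen-same i≢j)) (trans (same i)
                           (trans (M.seen-same i≢j) (M′.seen-same i≢j))))
        fineᵃ′ : Fine c″ a b
        fineᵃ′ {y} p e with fineᵃ p (upd-none {c} (upd-none {c′} e))
        ... | inj₁ s = inj₁ (M′.slack-step p e (M.slack-step p (upd-none {c′} e) s))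
        ... | inj₂ (s , q , f) with y Fin.≟ z′
        ...   | no y≢z′ = inj₂ (M′.slack-step p e (M.slack-step p (upd-none {c′} e) s) , q ,
                  trans (upd-miss {c′} (y≢z′ ∘ proj₂) (b≢z′ ∘ proj₁)) (none-off {c} b≢a b≢z f))
        -- The partner bz′ is closed with the colour j that a already sees, so az′ receives its
        -- missing repetition at the very moment when it loses its partner.
        ...   | yes refl = inj₁ (slack-sym {0} {c″} {y} (M′.slack-gain (inj₂ refl) a≢b a≢z′ (M.seen-hit (inj₁ refl))
                  (slack-sym {1} {c′} {a} (M.slack-step p (upd-none {c′} e) s))))
        fineᵇ′ : Fine c″ b a
        fineᵇ′ {y} p e with fineᵇ p (upd-none {c} (upd-none {c′} e))
        ... | inj₁ s = inj₁ (M′.slack-step p e (M.slack-step p (upd-none {c′} e) s))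
        ... | inj₂ (s , q , f) with y Fin.≟ z
        ...   | no y≢z = inj₂ (M′.slack-step p e (M.slack-step p (upd-none {c′} e) s) , q ,
                  none-off {c′} a≢b a≢z′ (trans (upd-miss {c} (y≢z ∘ proj₂) (a≢z ∘ proj₁)) f))
        ...   | yes refl = inj₁ (M′.slack-gain (inj₁ refl) (b≢z ∘ ≡-sym) (z′≢z ∘ ≡-sym) (M.seen-hit (inj₂ refl))
                  (M.slack-step p (upd-none {c′} e) s))

  module Equal (a b : V) (a≢b : a ≢ b) (¬ab : ¬ Adj a b)
    (cover : ∀ {x y} → Adj x y → (x ≡ a ⊎ x ≡ b) ⊎ (y ≡ a ⊎ y ≡ b))
    (da : deg a ≡ k) (db : deg b ≡ k) (2≤k : 2 ≤ k) where

    cover′ : ∀ {x y} → Adj x y → (x ≡ b ⊎ x ≡ a) ⊎ (y ≡ b ⊎ y ≡ a)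
    cover′ p = case cover p of λ where
      (inj₁ (inj₁ e)) → inj₁ (inj₂ e)
      (inj₁ (inj₂ e)) → inj₁ (inj₁ e)
      (inj₂ (inj₁ e)) → inj₂ (inj₂ e)
      (inj₂ (inj₂ e)) → inj₂ (inj₁ e)

    module Pᵃ = Pair a b a≢b ¬ab cover
    module Pᵇ = Pair b a (a≢b ∘ ≡-sym) (¬ab ∘ adj-sym) cover′
    module Rᵃ = Reply a b a≢b ¬ab cover da db
    module Rᵇ = Reply b a (a≢b ∘ ≡-sym) (¬ab ∘ adj-sym) cover′ db da

    live : ∀ {c} → Balanced a b c → Live c
    live {c} inv x y p e with cover p
    ... | inj₁ (inj₁ refl) = Pᵃ.fine-live valid fineᵃ p e
      where open Balanced inv
    ... | inj₁ (inj₂ refl) = Pᵇ.fine-live valid fineᵇ p e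
      where open Balanced inv
    ... | inj₂ (inj₁ refl) = subst (1 ≤_) (free-sym c y x)
            (Pᵃ.fine-live valid fineᵃ (adj-sym p) (trans (Valid.csym valid y x) e))
      where open Balanced inv
    ... | inj₂ (inj₂ refl) = subst (1 ≤_) (free-sym c y x)
            (Pᵇ.fine-live valid fineᵇ (adj-sym p) (trans (Valid.csym valid y x) e))
      where open Balanced inv

    wins : Wins ∅ bob
    wins = go (tot ∅) ℕ.≤-refl start
      where
        start : Balanced a b ∅
        start = record
          { valid = valid-∅
          ; same  = λ j → trans (unseen-∅ a j) (≡-sym (unseen-∅ b j))
          ; fineᵃ = Pᵃ.fine-∅
          ; fineᵇ = Pᵇ.fine-∅
          -- At the start a has k ≥ 2 open edges.
          ; noEnd = λ u _ _ → case subst (2 ≤_) (trans (≡-sym da) (trans (≡-sym (unc-∅ a)) u)) 2≤k of λ where (s≤s ())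
          }

        go : ∀ {c} m → tot c ≤ m → Balanced a b c → Wins c bob
        answerᵃ : ∀ {c z j} m → tot c ≤ m → Balanced a b c → Leg c a z j → Wins (upd c a z j) alice
        answerᵇ : ∀ {c z j} m → tot c ≤ m → Balanced a b c → Leg c b z j → Wins (upd c b z j) alice
        answerᵃ {c} {z} {j} m t inv leg with ℕ.≤-trans (tot-< (Balanced.valid inv) leg) t
        answerᵃ {c} {z} {j} (suc m) t inv leg | s≤s t′ =
          let z′ , leg′ , inv′ = Rᵃ.reply inv leg
          in aliceTurn leg′ (go m (ℕ.≤-trans (ℕ.<⇒≤ (tot-< (Move.valid′ (Balanced.valid inv) leg) leg′)) t′) inv′)
        answerᵇ {c} {z} {j} m t inv leg with ℕ.≤-trans (tot-< (Balanced.valid inv) leg) t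
        answerᵇ {c} {z} {j} (suc m) t inv leg | s≤s t′ =
          let z′ , leg′ , inv′ = Rᵇ.reply (balanced-swap da db inv) leg
          in aliceTurn leg′ (go m (ℕ.≤-trans (ℕ.<⇒≤ (tot-< (Move.valid′ (Balanced.valid inv) leg) leg′)) t′)
               (balanced-swap db da inv′))
        go {c} m t inv = bobTurn (live inv) λ x y j leg → case cover (proj₁ leg) of λ where
          (inj₁ (inj₁ refl)) → answerᵃ m t inv leg
          (inj₁ (inj₂ refl)) → answerᵇ m t inv leg
          (inj₂ (inj₁ refl)) → swap-wins {c} (answerᵃ m t inv (legal-swap {c} (Balanced.valid inv) leg))
          (inj₂ (inj₂ refl)) → swap-wins {c} (answerᵇ m t inv (legal-swap {c} (Balanced.valid inv) leg))

  module Unequal (a b : V) (a≢b : a ≢ b) (¬ab : ¬ Adj a b)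
    (cover : ∀ {x y} → Adj x y → (x ≡ a ⊎ x ≡ b) ⊎ (y ≡ a ⊎ y ≡ b))
    (da : deg a ≡ k) (db : deg b < k) (2≤k : 2 ≤ k) where
    open Pair a b a≢b ¬ab cover

    b≢a : b ≢ a
    b≢a = a≢b ∘ ≡-sym

    SafeAt : V → Col → Set
    SafeAt x c = ∀ {y} → Adj x y → c x y ≡ nothing → Slack 0 c x y

    -- With deg b < k every edge at b is safe from the start and only the edges at a need care.
    -- Mirroring Bob's moves fails here in general, as b may run out of open edges before a does.
    record Half (c : Col) : Set where
      field
        valid : Valid c
        fineᵃ : Fine c a b
        safeᵇ : SafeAt b c

    all-safe : ∀ {c} → Valid c → SafeAt a c → SafeAt b c → AllSafe c
    all-safe {c} val sa sb x y p e with cover p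
    ... | inj₁ (inj₁ refl) = inj₁ (sa p e)
    ... | inj₁ (inj₂ refl) = inj₁ (sb p e)
    ... | inj₂ (inj₁ refl) = inj₁ (slack-sym {0} {c} {y} (sa (adj-sym p) (trans (Valid.csym val y x) e)))
    ... | inj₂ (inj₂ refl) = inj₁ (slack-sym {0} {c} {y} (sb (adj-sym p) (trans (Valid.csym val y x) e)))

    half-live : ∀ {c} → Half c → Live c
    half-live {c} h x y p e with cover p
    ... | inj₁ (inj₁ refl) = fine-live valid fineᵃ p e
      where open Half h
    ... | inj₁ (inj₂ refl) = slack⇒live valid p e (safeᵇ p e)
      where open Half h
    ... | inj₂ (inj₁ refl) = subst (1 ≤_) (free-sym c y x)
            (fine-live valid fineᵃ (adj-sym p) (trans (Valid.csym valid y x) e))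
      where open Half h
    ... | inj₂ (inj₂ refl) = subst (1 ≤_) (free-sym c y x)
            (slack⇒live valid (adj-sym p) e′ (safeᵇ (adj-sym p) e′))
      where open Half h
            e′ = trans (Valid.csym valid y x) e

    safe-step : ∀ {c u v j x} → Valid c → Leg c u v j → SafeAt x c → SafeAt x (upd c u v j)
    safe-step {c} val leg s p e = Move.slack-step val leg p e (s p (upd-none {c} e))

    half-step : ∀ {c y j} → Half c → Leg c a y j → Half (upd c a y j)
    half-step h leg = record
      { valid = Move.valid′ valid leg
      ; fineᵃ = fine-off valid leg fineᵃ
      ; safeᵇ = safe-step valid leg safeᵇ
      }
      where open Half h

    last-safe : ∀ {c y} → unc c a ≡ 1 → Open c a y → Slack 0 c a y → SafeAt a c
    last-safe {c} {y} u (p , e) s q f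
      with refl ← count-unique {P = uncolouredAt c a} u (open-mono {c} p e) (open-mono {c} q f) = s

    -- The recursive call of the strategy: Alice may leave to Bob any `Half` position with two open
    -- edges at a. It is passed as an argument so that the recursion on `tot` stays in `wins`.
    Next : Col → Set
    Next c = ∀ {u v j} → Leg c u v j → Half (upd c u v j) → 2 ≤ unc (upd c u v j) a → Wins (upd c u v j) bob

    -- A colour seen at a, played on the edge b–y, makes a–y safe and keeps the number
    -- of open edges at a.
    common : ∀ {c y} → Half c → Next c → 2 ≡ unc c a → 2 ≤ unc c b → Open c a y → Open c b y → Wins c alice
    common {c} {y} h next u 2≤unc (p , e) (q , f) =
        aliceTurn leg (next leg half (ℕ.≤-trans (ℕ.≤-reflexive u) (ℕ.≤-reflexive (≡-sym (M.unc-off a≢b a≢y)))))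
      where
        open Half h
        a≢y = adj⇒≢ p
        -- As deg b < k, the balance at b gives `fre c b` > `unc c b` ≥ 2, whereas deg a = k gives
        -- `fre c a` = `unc c a` = 2. So some colour is free at b but seen at a.
        2<fre : fre c a < fre c b
        2<fre = ℕ.+-cancelʳ-≤ (deg b) (suc (fre c a)) (fre c b) (ℕ.≤-trans
          (ℕ.≤-trans (ℕ.≤-reflexive (≡-sym (ℕ.+-suc (fre c a) (deg b)))) (ℕ.+-monoʳ-≤ (fre c a) db))
          (ℕ.≤-trans (ℕ.≤-reflexive (trans (cong (_+ k) (trans (≡-sym (unc≡fre valid da)) (≡-sym u))) (ℕ.+-comm 2 k)))
            (ℕ.≤-trans (ℕ.+-monoʳ-≤ k 2≤unc) (ℕ.≤-reflexive (≡-sym (Valid.bal valid b))))))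
        colour : ∃[ j ] (not (seen c b j) ≡ true × not (seen c a j) ≡ false)
        colour = count-<⇒∃ 2<fre
        j = proj₁ colour
        leg : Leg c b y j
        leg = q , f , unseen⁻ (not-true (proj₁ (proj₂ colour))) , unseen⁻ (bare valid p e f j)
        module M = Move valid leg
        half : Half (upd c b y j)
        half = record
          { valid = M.valid′
          ; fineᵃ = λ {w} r g → case fineᵃ r (upd-none {c} g) of λ where
              (inj₁ s) → inj₁ (M.slack-step r g s)
              (inj₂ (s , t , g′)) → case w Fin.≟ y of λ where
                (no w≢y)   → inj₂ (M.slack-step r g s , t , trans (upd-miss {c} (w≢y ∘ proj₂) (b≢y ∘ proj₁)) g′)
                (yes refl) → inj₁ (slack-sym {0} {_} {w} (M.slack-gain (inj₂ refl) a≢b a≢y seen-a (slack-sym {1} {c} {a} s)))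
          ; safeᵇ = safe-step valid leg safeᵇ
          }
          where
            b≢y = adj⇒≢ q
            seen-a : seen c a j ≡ true
            seen-a = case bool? (seen c a j) of λ where
              (inj₁ r) → r
              (inj₂ r) → ⊥-elim (true≢false (cong not r) (proj₂ (proj₂ colour)))

    -- Alice has nothing to repair and must move. With three open edges at a she may colour any of
    -- them. With two, she colours one and leaves a safe one to the end; if neither is safe, both
    -- have open partners at b and `common` applies.
    tempo : ∀ {c} → Half c → Next c → 2 ≤ unc c a → Wins c alice
    tempo {c} h next 2≤
      with y₁ , o₁ ← count-pos {P = uncolouredAt c a} (ℕ.<⇒≤ 2≤)
      with y₂ , y₂≢y₁ , o₂ ← count-≥2 {P = uncolouredAt c a} y₁ 2≤
      with p₁ , e₁ ← uncolouredAt⁻ {c} o₁ | p₂ , e₂ ← uncolouredAt⁻ {c} o₂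
      with ℕ.m≤n⇒m<n∨m≡n 2≤
    ... | inj₁ 3≤ =
          let j , leg = free-move p₁ e₁ (fine-live (Half.valid h) (Half.fineᵃ h) p₁ e₁)
          in aliceTurn leg (next leg (half-step h leg)
               (ℕ.≤-pred (subst (3 ≤_) (Move.unc-hit (Half.valid h) leg (inj₁ refl)) 3≤)))
    ... | inj₂ 2≡ = finish (Half.fineᵃ h p₁ e₁) (Half.fineᵃ h p₂ e₂)
      where
        -- Both open edges at a are played away, the safe one last.
        spare : ∀ {y z} → Open c a y → Open c a z → y ≢ z → Slack 0 c a z → Wins c alice
        spare {y} {z} (p , e) (q , f) y≢z s =
          let open Half h
              j , leg = free-move p e (fine-live valid fineᵃ p e)
              module M = Move valid leg
              f′ = trans (upd-miss {c} (y≢z ∘ ≡-sym ∘ proj₂) (adj⇒≢ p ∘ proj₁)) f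
          in aliceTurn leg (safe-wins M.valid′ (all-safe M.valid′
               (last-safe (ℕ.suc-injective (trans (≡-sym (M.unc-hit (inj₁ refl))) (≡-sym 2≡))) (q , f′) (M.slack-step q f′ s))
               (safe-step valid leg safeᵇ)) bob)
        finish : _ → _ → Wins c alice
        finish (inj₁ s) _ = spare (p₂ , e₂) (p₁ , e₁) y₂≢y₁ s
        finish (inj₂ _) (inj₁ s) = spare (p₁ , e₁) (p₂ , e₂) (y₂≢y₁ ∘ ≡-sym) s
        finish (inj₂ (_ , q₁ , f₁)) (inj₂ (_ , q₂ , f₂)) = common h next 2≡
          (count-≥length {P = uncolouredAt c b} {y₂ ∷ y₁ ∷ []} ((y₂≢y₁ ∷ []) ∷ [] ∷ [])
            (open-mono {c} q₂ f₂ ∷ open-mono {c} q₁ f₁ ∷ []))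
          (p₁ , e₁) (q₁ , f₁)

    -- If Bob has left one open edge at a, it is safe, or else its other end is bare and Alice can
    -- colour it now.
    at-a : ∀ {c} → Half c → Next c → 1 ≤ unc c a → Wins c alice
    at-a {c} h next 1≤ with ℕ.m≤n⇒m<n∨m≡n 1≤
    ... | inj₁ 2≤ = tempo h next 2≤
    ... | inj₂ 1≡ with y , o ← count-pos {P = uncolouredAt c a} 1≤
                  with p , e ← uncolouredAt⁻ {c} o
                  with Half.fineᵃ h p e
    ...   | inj₁ s = safe-wins valid (all-safe valid (last-safe (≡-sym 1≡) (p , e) s) safeᵇ) alice
      where open Half h
    ...   | inj₂ (_ , _ , f) = one-threatᴬ valid bad p (bare-free valid p e f)
      where
        open Half h
        only : ∀ {x} → Open c a x → x ≡ y
        only (q , g) = count-unique {P = uncolouredAt c a} (≡-sym 1≡) (open-mono {c} q g) o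
        bad : BadOnly ((a , y) ∷ []) c
        bad x z q g with cover q
        ... | inj₁ (inj₁ refl) = inj₂ (here (inj₁ (refl , only (q , g))))
        ... | inj₁ (inj₂ refl) = inj₁ (safeᵇ q g)
        ... | inj₂ (inj₁ refl) = inj₂ (here (inj₂ (only (adj-sym q , trans (Valid.csym valid z x) g) , refl)))
        ... | inj₂ (inj₂ refl) = inj₁ (slack-sym {0} {c} {z} (safeᵇ (adj-sym q) (trans (Valid.csym valid z x) g)))

    -- Bob has closed the partner of az. If az is open, not yet safe and j is new at a, Alice
    -- supplies the missing repetition by playing j on another open edge at a; in all other cases
    -- the invariant survives and she has a free move.
    at-b : ∀ {c z j} → Half c → (leg : Leg c b z j) → Next (upd c b z j) → 2 ≤ unc c a → Wins (upd c b z j) alice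
    at-b {c} {z} {j} h leg next 2≤ = threatened (bool? (adj G a z)) (none? (c a z))
      where
        open Half h
        module M = Move valid leg
        c′ = upd c b z j
        a≢z : a ≢ z
        a≢z refl = ¬ab (adj-sym (proj₁ leg))
        2≤′ : 2 ≤ unc c′ a
        2≤′ = ℕ.≤-trans 2≤ (ℕ.≤-reflexive (≡-sym (M.unc-off a≢b a≢z)))

        fine-elsewhere : ∀ {y} → y ≢ z → Adj a y → c′ a y ≡ nothing →
                         Slack 0 c′ a y ⊎ (Slack 1 c′ a y × Adj b y × c′ b y ≡ nothing)
        fine-elsewhere y≢z p e with fineᵃ p (upd-none {c} e)
        ... | inj₁ s = inj₁ (M.slack-step p e s)
        ... | inj₂ (s , q , f) = inj₂ (M.slack-step p e s , q ,
                trans (upd-miss {c} (y≢z ∘ proj₂) (adj⇒≢ (proj₁ leg) ∘ proj₁)) f)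

        half : (Adj a z → c′ a z ≡ nothing → Slack 0 c′ a z) → Half c′
        half s = record
          { valid = M.valid′
          ; fineᵃ = λ {y} p e → case y Fin.≟ z of λ where
              (no y≢z)   → fine-elsewhere y≢z p e
              (yes refl) → inj₁ (s p e)
          ; safeᵇ = safe-step valid leg safeᵇ
          }

        respond : Adj a z → c a z ≡ nothing → Slack 1 c a z → seen c a j ≡ false → Wins c′ alice
        respond az e s unseen
          with z′ , z′≢z , o ← count-≥2 {P = uncolouredAt c′ a} z 2≤′
          with p , e′ ← uncolouredAt⁻ {c′} o = aliceTurn leg′ (continue (ℕ.m≤n⇒m<n∨m≡n left))
          where
            leg′ : Leg c′ a z′ j
            -- z′ sees at most the colour of bz′, which is not j because j was new at b when Bob
            -- played it on bz.
            leg′ = p , e′ , unseen⁻ (trans (M.seen-off a≢b a≢z) unseen) , λ w f → case ends p (Valid.onEdge M.valid′ f) of λ where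
              (inj₁ refl) → case trans (≡-sym e′) (trans (Valid.csym M.valid′ a z′) f) of λ ()
              (inj₂ refl) → proj₁ (proj₂ (proj₂ leg)) z′ (trans (≡-sym (upd-miss {c} (z′≢z ∘ proj₂)
                  (adj⇒≢ (proj₁ leg) ∘ proj₁))) (trans (Valid.csym M.valid′ b z′) f))
            module M′ = Move M.valid′ leg′
            c″ = upd c′ a z′ j
            ez : c′ a z ≡ nothing
            ez = none-off {c} a≢b a≢z e
            ez′ : c″ a z ≡ nothing
            ez′ = trans (upd-miss {c′} (z′≢z ∘ ≡-sym ∘ proj₂) (adj⇒≢ p ∘ proj₁)) ez
            now-safe : Slack 0 c″ a z
            now-safe = M′.slack-gain (inj₁ refl) (a≢z ∘ ≡-sym) (z′≢z ∘ ≡-sym) (M.seen-hit (inj₂ refl)) (M.slack-step az ez s)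
            left : 1 ≤ unc c″ a
            left = ℕ.≤-pred (subst (2 ≤_) (M′.unc-hit (inj₁ refl)) 2≤′)
            safeᵇ″ : SafeAt b c″
            safeᵇ″ = safe-step M.valid′ leg′ (safe-step valid leg safeᵇ)
            half″ : Half c″
            half″ = record
              { valid = M′.valid′
              ; fineᵃ = λ {y} q f → case y Fin.≟ z of λ where
                  (yes refl) → inj₁ now-safe
                  (no y≢z) → case fine-elsewhere y≢z q (upd-none {c′} f) of λ where
                    (inj₁ t) → inj₁ (M′.slack-step q f t)
                    (inj₂ (t , r , g)) → inj₂ (M′.slack-step q f t , r , none-off {c′} b≢a (y≢b p) g)
              ; safeᵇ = safeᵇ″
              }
            continue : 1 < unc c″ a ⊎ 1 ≡ unc c″ a → Wins c″ bob
            continue (inj₁ 2≤″) = next leg′ half″ 2≤″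
            continue (inj₂ 1≡)  = safe-wins M′.valid′ (all-safe M′.valid′
              (last-safe (≡-sym 1≡) (az , ez′) now-safe) safeᵇ″) bob

        threatened : Adj a z ⊎ adj G a z ≡ false → c a z ≡ nothing ⊎ ∃[ i ] c a z ≡ just i → Wins c′ alice
        threatened (inj₂ ¬az) _ = tempo (half λ az → ⊥-elim (true≢false az ¬az)) next 2≤′
        threatened (inj₁ az) (inj₂ (_ , col)) =
          tempo (half λ _ e → case trans (≡-sym (upd-none {c} e)) col of λ ()) next 2≤′
        threatened (inj₁ az) (inj₁ e) with fineᵃ az e
        ... | inj₁ s = tempo (half λ _ e′ → M.slack-step az e′ s) next 2≤′
        ... | inj₂ (s , _) with bool? (seen c a j)
        ...   | inj₁ sn = tempo (half λ _ _ → slack-sym {0} {c′} {z} (M.slack-gain (inj₂ refl) a≢b a≢z sn (slack-sym {1} {c} {a} s))) next 2≤′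
        ...   | inj₂ un = respond az e s un

    wins : Wins ∅ bob
    wins = go (tot ∅) ℕ.≤-refl start (ℕ.≤-trans 2≤k (ℕ.≤-reflexive (trans (≡-sym da) (≡-sym (unc-∅ a)))))
      where
        start : Half ∅
        start = record
          { valid = valid-∅
          ; fineᵃ = fine-∅
          ; safeᵇ = λ {y} p _ → slack-∅ (ℕ.≤-trans (ℕ.+-monoʳ-≤ (deg b) (two p))
              (ℕ.≤-trans (ℕ.≤-reflexive (ℕ.+-suc (deg b) 1)) (ℕ.+-monoˡ-≤ 1 db)))
          }
          where
            two : ∀ {y} → Adj b y → deg y ≤ 2
            two p = count-≤length (a ∷ b ∷ []) λ x r → case cover r of λ where
              (inj₁ (inj₁ refl)) → ⊥-elim (¬ab (adj-sym p))
              (inj₁ (inj₂ refl)) → ⊥-elim (adj⇒≢ p refl)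
              (inj₂ (inj₁ e)) → here e
              (inj₂ (inj₂ e)) → there (here e)

        go : ∀ {c} m → tot c ≤ m → Half c → 2 ≤ unc c a → Wins c bob
        next : ∀ {c u v j} m → tot c ≤ m → Valid c → Leg c u v j → Next (upd c u v j)
        next m t val leg leg′ h 2≤ with ℕ.≤-trans (tot-< val leg) t
        next (suc m) t val leg leg′ h 2≤ | s≤s t′ =
          go m (ℕ.≤-trans (ℕ.<⇒≤ (tot-< (Move.valid′ val leg) leg′)) t′) h 2≤
        turnᵃ : ∀ {c z j} m → tot c ≤ m → Half c → 2 ≤ unc c a → Leg c a z j → Wins (upd c a z j) alice
        turnᵃ m t h 2≤ leg = at-a (half-step h leg) (next m t (Half.valid h) leg)
          (ℕ.≤-pred (subst (2 ≤_) (Move.unc-hit (Half.valid h) leg (inj₁ refl)) 2≤))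
        turnᵇ : ∀ {c z j} m → tot c ≤ m → Half c → 2 ≤ unc c a → Leg c b z j → Wins (upd c b z j) alice
        turnᵇ m t h 2≤ leg = at-b h leg (next m t (Half.valid h) leg) 2≤
        go {c} m t h 2≤ = bobTurn (half-live h) λ x y j leg → case cover (proj₁ leg) of λ where
          (inj₁ (inj₁ refl)) → turnᵃ m t h 2≤ leg
          (inj₁ (inj₂ refl)) → turnᵇ m t h 2≤ leg
          (inj₂ (inj₁ refl)) → swap-wins {c} (turnᵃ m t h 2≤ (legal-swap {c} (Half.valid h) leg))
          (inj₂ (inj₂ refl)) → swap-wins {c} (turnᵇ m t h 2≤ (legal-swap {c} (Half.valid h) leg))

  wins : ∀ a b → a ≢ b → ¬ Adj a b → (∀ {x y} → Adj x y → (x ≡ a ⊎ x ≡ b) ⊎ (y ≡ a ⊎ y ≡ b)) → 2 ≤ k → Wins ∅ bob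
  wins a b a≢b ¬ab cover 2≤k = go (ℕ.m≤n⇒m<n∨m≡n (deg≤k a)) (ℕ.m≤n⇒m<n∨m≡n (deg≤k b))
    where
      cover′ : ∀ {x y} → Adj x y → (x ≡ b ⊎ x ≡ a) ⊎ (y ≡ b ⊎ y ≡ a)
      cover′ p = [ inj₁ ∘ Sum.swap , inj₂ ∘ Sum.swap ]′ (cover p)
      small : ∀ {x y} → deg x < k → x ≡ a ⊎ x ≡ b → Adj x y → Slack 0 ∅ x y
      small {x} {y} d x∈ p = slack-∅ (ℕ.≤-trans (ℕ.+-monoʳ-≤ (deg x) two)
          (ℕ.≤-trans (ℕ.≤-reflexive (ℕ.+-suc (deg x) 1)) (ℕ.+-monoˡ-≤ 1 d)))
        where
          two : deg y ≤ 2
          two = count-≤length (a ∷ b ∷ []) λ w r → case (x∈ , cover r) of λ where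
            (_ , inj₂ (inj₁ e)) → here e
            (_ , inj₂ (inj₂ e)) → there (here e)
            (inj₁ refl , inj₁ (inj₁ refl)) → ⊥-elim (adj⇒≢ p refl)
            (inj₁ refl , inj₁ (inj₂ refl)) → ⊥-elim (¬ab p)
            (inj₂ refl , inj₁ (inj₁ refl)) → ⊥-elim (¬ab (adj-sym p))
            (inj₂ refl , inj₁ (inj₂ refl)) → ⊥-elim (adj⇒≢ p refl)
      go : deg a < k ⊎ deg a ≡ k → deg b < k ⊎ deg b ≡ k → Wins ∅ bob
      go (inj₂ da) (inj₂ db) = Equal.wins a b a≢b ¬ab cover da db 2≤k
      go (inj₂ da) (inj₁ db) = Unequal.wins a b a≢b ¬ab cover da db 2≤k
      go (inj₁ da) (inj₂ db) = Unequal.wins b a (a≢b ∘ ≡-sym) (¬ab ∘ adj-sym) cover′ db da 2≤k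
      -- All ends other than the centres have degree at most 2, so centres of degree below k make
      -- every edge safe.
      go (inj₁ da) (inj₁ db) = safe-wins valid-∅ (λ x y p _ → case cover p of λ where
        (inj₁ (inj₁ refl)) → inj₁ (small da (inj₁ refl) p)
        (inj₁ (inj₂ refl)) → inj₁ (small db (inj₂ refl) p)
        (inj₂ (inj₁ refl)) → inj₁ (slack-sym {0} {∅} {y} (small da (inj₁ refl) (adj-sym p)))
        (inj₂ (inj₂ refl)) → inj₁ (slack-sym {0} {∅} {y} (small db (inj₂ refl) (adj-sym p)))) bob

-- Alice's strategy on unions of double stars and vases

all-or-some : ∀ {m} {P Q : Fin m → Set} → (∀ x → P x ⊎ Q x) → (∀ x → P x) ⊎ ∃ Q
all-or-some {zero}  f = inj₁ λ ()
all-or-some {suc m} f with f zero | all-or-some (f ∘ suc)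
... | inj₂ q | _             = inj₂ (zero , q)
... | inj₁ _ | inj₂ (x , q) = inj₂ (suc x , q)
... | inj₁ p | inj₁ ps      = inj₁ λ where
  zero    → p
  (suc x) → ps x

module Components (G : Graph) (k : ℕ) (deg≤k : ∀ x → count (adj G x) ≤ k)
  (triangle : ∀ {x y z} → adj G x y ≡ true → adj G y z ≡ true → adj G z x ≡ true → 3 ≤ k)
  (Rep : Set) (_≟ᴿ_ : (r s : Rep) → Dec (r ≡ s))
  (rep : Fin (n G) → Rep) (rep-adj : ∀ {x y} → adj G x y ≡ true → rep x ≡ rep y) where
  open Position G k public

  BadIn : Rep → List (V × V) → Col → Set
  BadIn r L c = ∀ {x y} → Adj x y → rep x ≡ r → c x y ≡ nothing → Slack 0 c x y ⊎ Any (SameEdge x y) L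

  record VaseAt (r : Rep) (w₁ w₂ w₃ l : V) : Set where
    field
      rep-w₁ : rep w₁ ≡ r
      w₁w₂   : Adj w₁ w₂
      w₁w₃   : Adj w₁ w₃
      w₂w₃   : Adj w₂ w₃
      w₁l    : Adj w₁ l
      l≢w₂   : l ≢ w₂
      l≢w₃   : l ≢ w₃
      edges  : ∀ {x y} → Adj x y → rep x ≡ r →
               Any (SameEdge x y) ((w₁ , w₂) ∷ (w₁ , w₃) ∷ (w₂ , w₃) ∷ []) ⊎
               (x ≡ w₁ × y ≢ w₂ × y ≢ w₃ ⊎ y ≡ w₁ × x ≢ w₂ × x ≢ w₃)

  -- The state of a component when Bob is to move.
  data State (r : Rep) (c : Col) : Set where
    done      : BadIn r [] c → State r c
    oneThreat : ∀ a b → rep a ≡ r → Adj a b → BadIn r ((a , b) ∷ []) c → 2 ≤ free c a b → State r c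
    freshVase : ∀ w₁ w₂ w₃ l → VaseAt r w₁ w₂ w₃ l →
                BadIn r ((w₁ , w₂) ∷ (w₁ , w₃) ∷ []) c →
                Sees c w₁ [] → Sees c w₂ [] → Sees c w₃ [] → Sees c l [] →
                Slack 1 c w₁ w₂ → Slack 1 c w₁ w₃ → 3 ≤ free c w₁ w₂ → 3 ≤ free c w₁ w₃ → State r c

  unseen-none : ∀ {c x y} → Sees c x [] → c x y ≡ nothing
  unseen-none {c} {x} {y} (sees f) with none? (c x y)
  ... | inj₁ e = e
  ... | inj₂ (j , e) with () ← f y j e

  badIn-step : ∀ {r L c u v j} → Valid c → Leg c u v j → BadIn r L c → BadIn r L (upd c u v j)
  badIn-step {c = c} val leg bad a ρ e with bad a ρ (upd-none {c} e)
  ... | inj₁ s = inj₁ (Move.slack-step val leg a e s)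
  ... | inj₂ m = inj₂ m

  restrictIn : ∀ {r L L′ c} → Valid c → BadIn r L c → All (Status L′ c) L → BadIn r L′ c
  restrictIn val bad st a ρ e with bad a ρ e
  ... | inj₁ s = inj₁ s
  ... | inj₂ m = resolve val e m st

  state-off : ∀ {r c u v j} → Valid c → Leg c u v j → rep u ≢ r → State r c → State r (upd c u v j)
  state-off {r} {c} {u} {v} {j} val leg ρ = go
    where
      open Move val leg
      off : ∀ {x} → rep x ≡ r → x ≢ u × x ≢ v
      off p = (λ where refl → ρ p) , (λ where refl → ρ (trans (rep-adj (proj₁ leg)) p))
      far : ∀ {x y} → rep x ≡ r → Adj x y → free c′ x y ≡ free c x y
      far p a = let x≢u , x≢v = off p ; y≢u , y≢v = off (trans (≡-sym (rep-adj a)) p)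
                in free-off x≢u x≢v y≢u y≢v
      still : ∀ {x} → rep x ≡ r → Sees c x [] → Sees c′ x []
      still p s = let x≢u , x≢v = off p in sees-off x≢u x≢v s
      go : State r c → State r c′
      go (done bad) = done (badIn-step val leg bad)
      go (oneThreat a b p ab bad f) =
        oneThreat a b p ab (badIn-step val leg bad) (subst (2 ≤_) (≡-sym (far p ab)) f)
      go (freshVase w₁ w₂ w₃ l vase bad S₁ S₂ S₃ Sl s₂ s₃ f₂ f₃) =
        freshVase w₁ w₂ w₃ l vase (badIn-step val leg bad)
          S₁′ (still (near w₁w₂) S₂) (still (near w₁w₃) S₃) (still (near w₁l) Sl)
          (slack-step w₁w₂ (unseen-none S₁′) s₂) (slack-step w₁w₃ (unseen-none S₁′) s₃)
          (subst (3 ≤_) (≡-sym (far rep-w₁ w₁w₂)) f₂) (subst (3 ≤_) (≡-sym (far rep-w₁ w₁w₃)) f₃)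
        where
          open VaseAt vase
          near : ∀ {y} → Adj w₁ y → rep y ≡ r
          near a = trans (≡-sym (rep-adj a)) rep-w₁
          S₁′ = still rep-w₁ S₁

  -- A move inside component r after which r is again in a state suitable for Bob's turn.
  Answer : Rep → Col → Set
  Answer r c = ∃[ x ] ∃[ y ] ∃[ i ] (Leg c x y i × rep x ≡ r × State r (upd c x y i))

  colour-last : ∀ {r c a b} → Valid c → Adj a b → rep a ≡ r → BadIn r ((a , b) ∷ []) c → 1 ≤ free c a b →
                BadIn r [] c ⊎ Answer r c
  colour-last {r} {c} {a} {b} val ab ρ bad f with none? (c a b)
  ... | inj₂ (_ , q) = inj₁ (restrictIn val bad (coloured q ∷ []))
  ... | inj₁ e = let j , leg = free-move ab e f ; val′ = Move.valid′ val leg in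
    inj₂ (a , b , j , leg , ρ , done (restrictIn val′ (badIn-step val leg bad)
      (coloured (upd-hit {c} (inj₁ (refl , refl))) ∷ [])))

  same-sym : ∀ {x y a b} → SameEdge x y (a , b) → SameEdge a b (x , y)
  same-sym (inj₁ (refl , refl)) = inj₁ (refl , refl)
  same-sym (inj₂ (refl , refl)) = inj₂ (refl , refl)

  -- In a fresh vase Alice colours the second of w₁w₂ and w₁w₃ if Bob takes the first. Otherwise she
  -- repeats his colour: on the leaf edge w₁l after w₂w₃, on w₂w₃ after a leaf edge. Both replies
  -- make w₁w₂ and w₁w₃ safe.
  respond : ∀ {r c u v j} → Valid c → State r c → Leg c u v j → rep u ≡ r →
            BadIn r [] (upd c u v j) ⊎ Answer r (upd c u v j)
  respond val (done bad) leg ρ = inj₁ (badIn-step val leg bad)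
  respond val (oneThreat a b p ab bad f) leg ρ =
    colour-last (Move.valid′ val leg) ab p (badIn-step val leg bad) (after val leg f)
  respond {r} {c} {u} {v} {j} val (freshVase w₁ w₂ w₃ l vase bad S₁ S₂ S₃ Sl s₂ s₃ f₂ f₃) leg ρ
    with VaseAt.edges vase (proj₁ leg) ρ
  ... | inj₁ (here h) = colour-last val′ w₁w₃ rep-w₁
          (restrictIn val′ (badIn-step val leg bad) (coloured (upd-hit {c} (same-sym h)) ∷ keep (here refl) ∷ []))
          (ℕ.<⇒≤ (after val leg f₃))
    where
      open VaseAt vase
      val′ = Move.valid′ val leg
  ... | inj₁ (there (here h)) = colour-last val′ w₁w₂ rep-w₁
          (restrictIn val′ (badIn-step val leg bad) (keep (here refl) ∷ coloured (upd-hit {c} (same-sym h)) ∷ []))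
          (ℕ.<⇒≤ (after val leg f₂))
    where
      open VaseAt vase
      val′ = Move.valid′ val leg
  ... | inj₁ (there (there (here h))) = inj₂ (w₁ , l , j , leg′ , rep-w₁ , done
          (restrictIn (Move.valid′ val′ leg′) (badIn-step val′ leg′ (badIn-step val leg bad))
            (gain w₁w₂ s₂ (l≢w₂ ∘ ≡-sym) (proj₁ (touch h)) ∷ gain w₁w₃ s₃ (l≢w₃ ∘ ≡-sym) (proj₂ (touch h)) ∷ [])))
    where
      open VaseAt vase
      val′ = Move.valid′ val leg
      touch : SameEdge u v (w₂ , w₃) → Move.Touched val leg w₂ × Move.Touched val leg w₃
      touch (inj₁ (refl , refl)) = inj₁ refl , inj₂ refl
      touch (inj₂ (refl , refl)) = inj₂ refl , inj₁ refl
      off : ∀ {x} → x ≢ w₂ → x ≢ w₃ → SameEdge u v (w₂ , w₃) → x ≢ u × x ≢ v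
      off p q (inj₁ (refl , refl)) = p , q
      off p q (inj₂ (refl , refl)) = q , p
      off₁ = off (adj⇒≢ w₁w₂) (adj⇒≢ w₁w₃) h
      offˡ = off l≢w₂ l≢w₃ h
      none : ∀ {y} → upd c u v j w₁ y ≡ nothing
      none = none-off {c} (proj₁ off₁) (proj₂ off₁) (unseen-none S₁)
      leg′ : Leg (upd c u v j) w₁ l j
      leg′ = leg-intro w₁l none (sees-off {c} (proj₁ off₁) (proj₂ off₁) S₁)
               (sees-off {c} (proj₁ offˡ) (proj₂ offˡ) Sl) (λ ()) (λ ())
      gain : ∀ {x L} → Adj w₁ x → Slack 1 c w₁ x → x ≢ l → Move.Touched val leg x →
             Status L (upd (upd c u v j) w₁ l j) (w₁ , x)
      gain a s x≢l t = slack (Move.slack-gain val′ leg′ (inj₁ refl) (adj⇒≢ a ∘ ≡-sym) x≢l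
        (Move.seen-hit val leg t) (Move.slack-step val leg a none s))
  ... | inj₂ h = inj₂ (w₂ , w₃ , j , leg′ , trans (≡-sym (rep-adj w₁w₂)) rep-w₁ , done
          (restrictIn (Move.valid′ val′ leg′) (badIn-step val′ leg′ (badIn-step val leg bad))
            (gain w₁w₂ s₂ (inj₁ refl) (proj₁ off₂) (proj₂ off₂) ∷ gain w₁w₃ s₃ (inj₂ refl) (proj₁ off₃) (proj₂ off₃) ∷ [])))
    where
      open VaseAt vase
      val′ = Move.valid′ val leg
      off : ∀ {x} → (u ≡ w₁ × x ≢ v ⊎ v ≡ w₁ × x ≢ u) → x ≢ w₁ → x ≢ u × x ≢ v
      off (inj₁ (refl , q)) p = p , q
      off (inj₂ (refl , q)) p = q , p
      off₂ = off (case h of λ where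
                    (inj₁ (p , q , _)) → inj₁ (p , q ∘ ≡-sym)
                    (inj₂ (p , q , _)) → inj₂ (p , q ∘ ≡-sym)) (adj⇒≢ w₁w₂ ∘ ≡-sym)
      off₃ = off (case h of λ where
                    (inj₁ (p , _ , q)) → inj₁ (p , q ∘ ≡-sym)
                    (inj₂ (p , _ , q)) → inj₂ (p , q ∘ ≡-sym)) (adj⇒≢ w₁w₃ ∘ ≡-sym)
      touch : Move.Touched val leg w₁
      touch = case h of λ where
        (inj₁ (refl , _)) → inj₁ refl
        (inj₂ (refl , _)) → inj₂ refl
      leg′ : Leg (upd c u v j) w₂ w₃ j
      leg′ = leg-intro w₂w₃ (none-off {c} (proj₁ off₂) (proj₂ off₂) (unseen-none S₂))
               (sees-off {c} (proj₁ off₂) (proj₂ off₂) S₂) (sees-off {c} (proj₁ off₃) (proj₂ off₃) S₃) (λ ()) (λ ())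
      gain : ∀ {x L} → Adj w₁ x → Slack 1 c w₁ x → x ≡ w₂ ⊎ x ≡ w₃ → x ≢ u → x ≢ v →
             Status L (upd (upd c u v j) w₂ w₃ j) (w₁ , x)
      gain {x} a s t p q = slack (slack-sym {0} {_} {x} (Move.slack-gain val′ leg′ t (adj⇒≢ w₁w₂) (adj⇒≢ w₁w₃)
        (Move.seen-hit val leg touch) (slack-sym {1} {_} {w₁}
          (Move.slack-step val leg a (none-offʳ {c} p q (unseen-none S₁)) s))))

  -- When Alice has to move in a component that Bob has left alone, she colours a threat. In a fresh
  -- vase this is w₁w₂, and w₁w₃ remains as a single threat with two of its three free colours,
  -- which is still a valid state.
  tempo : ∀ {r c} → Valid c → State r c → BadIn r [] c ⊎ Answer r c
  tempo val (done bad) = inj₁ bad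
  tempo val (oneThreat a b p ab bad f) = colour-last val ab p bad (ℕ.<⇒≤ f)
  tempo {c = c} val (freshVase w₁ w₂ w₃ l vase bad S₁ S₂ S₃ Sl s₂ s₃ f₂ f₃) =
    let open VaseAt vase
        j , leg = free-move w₁w₂ (unseen-none S₁) (ℕ.≤-trans (ℕ.m≤m+n 1 2) f₂)
        val′ = Move.valid′ val leg
    in inj₂ (w₁ , w₂ , j , leg , rep-w₁ , oneThreat w₁ w₃ rep-w₁ w₁w₃
         (restrictIn val′ (badIn-step val leg bad)
           (coloured (upd-hit {c} (inj₁ (refl , refl))) ∷ keep (here refl) ∷ []))
         (after val leg f₃))

  state-live : ∀ {c} → Valid c → (∀ x → State (rep x) c) → Live c
  state-live {c} val st x y a e = go (st x)
    where
      listed : ∀ {L} → Slack 0 c x y ⊎ Any (SameEdge x y) L → All (λ (a , b) → 1 ≤ free c a b) L → 1 ≤ free c x y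
      listed (inj₁ s) _ = slack⇒live val a e s
      listed (inj₂ (here (inj₁ (refl , refl)))) (p ∷ _) = p
      listed (inj₂ (here (inj₂ (refl , refl)))) (p ∷ _) = subst (1 ≤_) (free-sym c y x) p
      listed (inj₂ (there m)) (_ ∷ ps) = listed (inj₂ m) ps
      go : State (rep x) c → 1 ≤ free c x y
      go (done bad) = listed (bad a refl e) []
      go (oneThreat _ _ _ _ bad f) = listed (bad a refl e) (ℕ.<⇒≤ f ∷ [])
      go (freshVase _ _ _ _ _ bad _ _ _ _ _ _ f₂ f₃) =
        listed (bad a refl e) (ℕ.≤-trans (ℕ.m≤m+n 1 2) f₂ ∷ ℕ.≤-trans (ℕ.m≤m+n 1 2) f₃ ∷ [])

  -- Alice answers in the component in which Bob has moved. If it is already safe, she makes a tempo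
  -- move in some other component; if none offers one, every component is safe.
  states-win : ∀ {c} m → tot c ≤ m → Valid c → (∀ x → State (rep x) c) → Wins c bob
  alice-answers : ∀ {c r} m → tot c ≤ m → Valid c → (∀ x → rep x ≢ r → State (rep x) c) → Answer r c → Wins c alice
  states-win′ : ∀ {c u v j} m → tot c ≤ m → Valid c → (leg : Leg c u v j) → (∀ x → State (rep x) c) → Wins (upd c u v j) alice
  states-win {c} m t val st = bobTurn (state-live val st) λ u v j leg → states-win′ m t val leg st
  states-win′ {c} m t val leg st with ℕ.≤-trans (tot-< val leg) t
  states-win′ {c} {u} (suc m) t val leg st | s≤s t′ with respond val (st u) leg refl
  ... | inj₂ ans = alice-answers m t′ (Move.valid′ val leg) (λ x p → state-off val leg (p ∘ ≡-sym) (st x)) ans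
  ... | inj₁ safe = case all-or-some {P = λ x → BadIn (rep x) [] (upd c u _ _)} (λ x → tempo val′ (st′ x)) of λ where
          (inj₁ safes)     → safe-wins val′ (λ x y a e → safes x a refl e) alice
          (inj₂ (x , ans)) → alice-answers m t′ val′ (λ y _ → st′ y) ans
    where
      val′ = Move.valid′ val leg
      st′ : ∀ x → State (rep x) (upd c u _ _)
      st′ x with rep u ≟ᴿ rep x
      ... | yes e = done (subst (λ r → BadIn r [] _) e safe)
      ... | no ¬e = state-off val leg ¬e (st x)
  alice-answers {r = r} m t val st (x , y , i , leg , ρ , s) =
    aliceTurn leg (states-win m (ℕ.≤-trans (ℕ.<⇒≤ (tot-< val leg)) t) (Move.valid′ val leg) λ z →
      case rep z ≟ᴿ r of λ where
        (yes e) → subst (λ r → State r _) (≡-sym e) s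
        (no ¬e) → state-off val leg (λ e → ¬e (trans (≡-sym e) ρ)) (st z ¬e))

  wins : (∀ x → State (rep x) ∅) → Wins ∅ bob
  wins st = states-win (tot ∅) ℕ.≤-refl valid-∅ st

  module Start {s q : ℕ} {es : List (ℕ × ℕ)} (B : Blowup G s q es) (s≤q : s ≤ q) {r : Rep}
    (covers : ∀ {x} → rep x ≡ r → Blowup.Inside B x) (core-rep : ∀ i → rep (Blowup.core B i) ≡ r) where
    open Blowup B public

    badIn-∅ : ∀ L → (∀ x y → Adj x y → Link x y → deg x + deg y ≤ suc k ⊎ Any (SameEdge x y) L) → BadIn r L ∅
    badIn-∅ L f {x} {y} a ρ _ with link a (covers ρ)
    ... | inj₁ m with f x y a m
    ...   | inj₁ p = inj₁ (slack-∅ (ℕ.≤-trans p (ℕ.≤-reflexive (ℕ.+-comm 1 k))))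
    ...   | inj₂ p = inj₂ p
    badIn-∅ L f {x} {y} a ρ _ | inj₂ m with f y x (adj-sym a) m
    ...   | inj₁ p = inj₁ (slack-sym {0} {∅} {y} (slack-∅ (ℕ.≤-trans p (ℕ.≤-reflexive (ℕ.+-comm 1 k)))))
    ...   | inj₂ p = inj₂ (Any.map (λ where (inj₁ (p , q)) → inj₂ (q , p)
                                            (inj₂ (p , q)) → inj₁ (q , p)) p)

    core-inside : ∀ i → Inside (core i)
    core-inside i = subst (_< q) (≡-sym (lab-core i)) (ℕ.≤-trans (Fin.toℕ<n i) s≤q)

    core-adj : ∀ i j → hasEdge es (toℕ i) (toℕ j) ≡ true → Adj (core i) (core j)
    core-adj i j e = trans (adj-lab (core-inside i) (core-inside j))
      (trans (cong₂ (hasEdge es) (lab-core i) (lab-core j)) e)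

    leaf-sum : ∀ {x y} → deg y ≤ 1 → deg x + deg y ≤ suc k
    leaf-sum {x} p = ℕ.≤-trans (ℕ.+-mono-≤ (deg≤k x) p) (ℕ.≤-reflexive (ℕ.+-comm k 1))

    inside : ∀ {x i} → lab x ≡ i → i < q → Inside x
    inside refl p = p

    free-∅≥ : ∀ {m} → m ≤ k → ∀ x y → m ≤ free ∅ x y
    free-∅≥ m≤k x y = subst (_ ≤_) (≡-sym (free-∅ x y)) m≤k

  doubleStar-state : ∀ {r} (B : Blowup G 2 4 doubleStarᵖ) → (∀ {x} → rep x ≡ r → Blowup.Inside B x) →
                     (∀ i → rep (Blowup.core B i) ≡ r) → State r ∅
  doubleStar-state {r} B covers core-rep = start (ℕ.≤-<-connex (deg a + deg b) (suc k))
    where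
      open Start B (ℕ.m≤m+n 2 2) covers core-rep
      a = core 0F
      b = core 1F
      bad : ∀ L → (∀ x y → x ≡ a → y ≡ b → deg x + deg y ≤ suc k ⊎ Any (SameEdge x y) L) → BadIn r L ∅
      bad L f = badIn-∅ L λ where
        x y _ (here (lx , ly)) → f x y (core-uniq 0F lx) (core-uniq 1F ly)
        x y _ (there (here (lx , ly))) → inj₁ (leaf-sum {x} (degree-≤ (inside ly (ℕ.m≤m+n 3 1)) ly))
        x y _ (there (there (here (lx , ly)))) → inj₁ (leaf-sum {x} (degree-≤ (inside ly (ℕ.m≤m+n 4 0)) ly))
      start : deg a + deg b ≤ suc k ⊎ suc k < deg a + deg b → State r ∅
      start (inj₁ p) = done (bad [] λ where x y refl refl → inj₁ p)
      start (inj₂ p) = oneThreat a b (core-rep 0F) (core-adj 0F 1F refl)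
        (bad _ λ where x y refl refl → inj₂ (here (inj₁ (refl , refl))))
        -- A degree sum of at least k + 2 with both degrees at most k forces k ≥ 2.
        (free-∅≥ (ℕ.+-cancelʳ-≤ k 2 k (ℕ.≤-trans p (ℕ.+-mono-≤ (deg≤k a) (deg≤k b)))) a b)

  vase-state : ∀ {r} (B : Blowup G 3 4 vaseᵖ) → (∀ {x} → rep x ≡ r → Blowup.Inside B x) →
               (∀ i → rep (Blowup.core B i) ≡ r) → State r ∅
  vase-state {r} B covers core-rep = start (Fin.any? λ l → lab l ℕ.≟ 3)
    where
      open Start B (ℕ.m≤m+n 3 1) covers core-rep
      w₁ = core 0F
      w₂ = core 1F
      w₃ = core 2F
      w₁w₂ : Adj w₁ w₂
      w₁w₂ = core-adj 0F 1F refl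
      w₂w₃ : Adj w₂ w₃
      w₂w₃ = core-adj 1F 2F refl
      w₁w₃ : Adj w₁ w₃
      w₁w₃ = core-adj 0F 2F refl
      3≤k : 3 ≤ k
      -- A triangle without flowers has maximum degree 2, so this bound comes from its three
      -- pairwise adjacent edges rather than from degrees.
      3≤k = triangle w₁w₂ w₂w₃ (adj-sym w₁w₃)
      deg-w₂ : deg w₂ ≤ 2
      deg-w₂ = degree-≤ (core-inside 1F) (lab-core 1F)
      deg-w₃ : deg w₃ ≤ 2
      deg-w₃ = degree-≤ (core-inside 2F) (lab-core 2F)
      small : ∀ {x y} → deg x ≤ 2 → deg y ≤ 2 → deg x + deg y ≤ suc k
      small p q = ℕ.≤-trans (ℕ.+-mono-≤ p q) (s≤s 3≤k)
      bad : ∀ L → (∀ {y} → Adj w₁ y → deg y ≤ 2 → y ≡ w₂ ⊎ y ≡ w₃ → deg w₁ + deg y ≤ suc k ⊎ Any (SameEdge w₁ y) L) → BadIn r L ∅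
      bad L f = badIn-∅ L λ where
        x y p (here (lx , ly)) → case (core-uniq 0F lx , core-uniq 1F ly) of λ where
          (refl , refl) → f p deg-w₂ (inj₁ refl)
        x y _ (there (here (lx , ly))) → case (core-uniq 1F lx , core-uniq 2F ly) of λ where
          (refl , refl) → inj₁ (small deg-w₂ deg-w₃)
        x y p (there (there (here (lx , ly)))) → case (core-uniq 2F lx , core-uniq 0F ly) of λ where
          (refl , refl) → case f (adj-sym p) deg-w₃ (inj₂ refl) of λ where
            (inj₁ q) → inj₁ (subst (_≤ suc k) (ℕ.+-comm (deg w₁) (deg w₃)) q)
            (inj₂ m) → inj₂ (Any.map (λ where (inj₁ (p , q)) → inj₂ (q , p)
                                              (inj₂ (p , q)) → inj₁ (q , p)) m)
        x y _ (there (there (there (here (lx , ly))))) → inj₁ (leaf-sum {x} (degree-≤ (inside ly (ℕ.m≤m+n 4 0)) ly))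
      start : Dec (∃[ l ] lab l ≡ 3) → State r ∅
      start (no ¬l) = done (bad [] λ _ d _ → inj₁ (small deg-w₁ d))
        where
          deg-w₁ : deg w₁ ≤ 2
          deg-w₁ = count-≤length (w₂ ∷ w₃ ∷ []) λ y p → case near p (core-inside 0F) (lab-core 0F) of λ where
            (here e)                 → here (core-uniq 1F e)
            (there (here e))         → there (here (core-uniq 2F e))
            (there (there (here e))) → ⊥-elim (¬l (y , e))
      start (yes (l , ll)) = freshVase w₁ w₂ w₃ l (record
          { rep-w₁ = core-rep 0F
          ; w₁w₂ = w₁w₂
          ; w₁w₃ = w₁w₃
          ; w₂w₃ = w₂w₃
          ; w₁l = linked (core-inside 0F) (inside ll (ℕ.m≤m+n 4 0)) (there (there (there (here (lab-core 0F , ll)))))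
          ; l≢w₂ = apart ll (lab-core 1F) refl
          ; l≢w₃ = apart ll (lab-core 2F) refl
          ; edges = λ a ρ → [ edge , (λ m → flip-edge (edge m)) ]′ (link a (covers ρ))
          })
          (bad _ λ where
            _ _ (inj₁ refl) → inj₂ (here (inj₁ (refl , refl)))
            _ _ (inj₂ refl) → inj₂ (there (here (inj₁ (refl , refl)))))
          sees-∅ sees-∅ sees-∅ sees-∅
          (slack-∅ (ℕ.+-mono-≤ (deg≤k w₁) deg-w₂)) (slack-∅ (ℕ.+-mono-≤ (deg≤k w₁) deg-w₃))
          (free-∅≥ 3≤k w₁ w₂) (free-∅≥ 3≤k w₁ w₃)
        where
          Kind : V → V → Set
          Kind x y = Any (SameEdge x y) ((w₁ , w₂) ∷ (w₁ , w₃) ∷ (w₂ , w₃) ∷ []) ⊎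
                     (x ≡ w₁ × y ≢ w₂ × y ≢ w₃ ⊎ y ≡ w₁ × x ≢ w₂ × x ≢ w₃)
          flip-edge : ∀ {x y} → Kind y x → Kind x y
          flip-edge (inj₁ m) = inj₁ (Any.map (λ where (inj₁ (p , q)) → inj₂ (q , p)
                                                      (inj₂ (p , q)) → inj₁ (q , p)) m)
          flip-edge (inj₂ (inj₁ h)) = inj₂ (inj₂ h)
          flip-edge (inj₂ (inj₂ h)) = inj₂ (inj₁ h)
          edge : ∀ {x y} → Link x y → Kind x y
          edge (here (lx , ly)) = inj₁ (here (inj₁ (core-uniq 0F lx , core-uniq 1F ly)))
          edge (there (here (lx , ly))) = inj₁ (there (there (here (inj₁ (core-uniq 1F lx , core-uniq 2F ly)))))
          edge (there (there (here (lx , ly)))) = inj₁ (there (here (inj₂ (core-uniq 2F lx , core-uniq 0F ly))))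
          edge (there (there (there (here (lx , ly))))) =
            inj₂ (inj₁ (core-uniq 0F lx , apart ly (lab-core 1F) refl , apart ly (lab-core 2F) refl))

  isolated-state : ∀ {r} (B : Blowup G 1 1 []) → (∀ {x} → rep x ≡ r → Blowup.Inside B x) → State r ∅
  isolated-state B covers = done λ a ρ _ → case Blowup.link B a (covers ρ) of λ where
    (inj₁ ())
    (inj₂ ())

-- Recognising embeddings and blow-ups in a graph

Reach-trans : ∀ {G x y z} → Reach G x y → Reach G y z → Reach G x z
Reach-trans here       q = q
Reach-trans (step a p) q = step a (Reach-trans p q)

Reach-sym : ∀ {G x y} → Reach G x y → Reach G y x
Reach-sym here = here
Reach-sym {G} (step {u} {v} a p) = Reach-trans (Reach-sym p) (step (trans (sym G v u) a) here)

module _ {G : Graph} {s q : ℕ} {es : List (ℕ × ℕ)} (B : Blowup G s q es) where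
  open Blowup B

  Around : Fin (n G) → Set
  Around u = Inside u × (∀ {x} → Inside x → Reach G u x)

  reach-inside : ∀ {x y} → Inside x → Reach G x y → Inside y
  reach-inside i here       = i
  reach-inside i (step a r) = reach-inside (closed a i) r

Distinct : ∀ {A : Set} {m} → Vec A m → Set
Distinct xs = ∀ {i j} → lookup xs i ≡ lookup xs j → i ≡ j

distinct-∷ : ∀ {A : Set} {m x} {xs : Vec A m} → (∀ i → x ≢ lookup xs i) → Distinct xs → Distinct (x ∷ xs)
distinct-∷ x∉ d {zero}  {zero}  _ = refl
distinct-∷ x∉ d {zero}  {suc j} e = ⊥-elim (x∉ j e)
distinct-∷ x∉ d {suc i} {zero}  e = ⊥-elim (x∉ i (≡-sym e))
distinct-∷ x∉ d {suc i} {suc j} e = cong suc (d e)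

distinct? : ∀ {m N} (idx : Vec (Fin m) N) → Dec (∀ i j → lookup idx i ≡ lookup idx j → i ≡ j)
distinct? idx = Fin.all? λ i → Fin.all? λ j → (lookup idx i Fin.≟ lookup idx j) →-dec (i Fin.≟ j)

select : ∀ {A : Set} {m N} → Vec A m → Vec (Fin m) N → Vec A N
select xs = Vec.map (lookup xs)

distinct-select : ∀ {A : Set} {m N} {xs : Vec A m} → Distinct xs → (idx : Vec (Fin m) N) →
                  {_ : True (distinct? idx)} → Distinct (select xs idx)
distinct-select {xs = xs} d idx {w} {i} {j} e = toWitness w i j
  (d (trans (≡-sym (Vec.lookup-map i (lookup xs) idx)) (trans e (Vec.lookup-map j (lookup xs) idx))))

-- Edge lists carry natural numbers, hence a lookup by numbers; an index beyond the end falls back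
-- on the last entry.
nth : ∀ {A : Set} {N} → Vec A (suc N) → ℕ → A
nth (x ∷ xs)     zero    = x
nth (x ∷ [])     (suc k) = x
nth (x ∷ y ∷ xs) (suc k) = nth (y ∷ xs) k

nth-lookup : ∀ {A : Set} {N} (xs : Vec A (suc N)) i → nth xs (toℕ i) ≡ lookup xs i
nth-lookup (x ∷ xs)     zero    = refl
nth-lookup (x ∷ y ∷ xs) (suc i) = nth-lookup (y ∷ xs) i

Covered : ℕ → List (ℕ × ℕ) → Set
Covered N es = (x : Fin N) → ∃[ y ] adj (fromEdges N es) x y ≡ true

covered? : ∀ N es → Dec (Covered N es)
covered? N es = Fin.all? λ x → Fin.any? λ y → _ Bool.≟ true

-- Forbidden copies are exhibited as vectors of vertices. That the edge list leaves no vertex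
-- isolated is checked by evaluation.
embed : ∀ {G N} es (xs : Vec (Fin (n G)) (suc N)) → {_ : True (covered? (suc N) es)} → Distinct xs →
        All (λ (a , b) → adj G (nth xs a) (nth xs b) ≡ true) es → EdgeSub (fromEdges (suc N) es) G
embed {G} es xs {w} d edges = lookup xs , d , preserves , toWitness w
  where
    edge : ∀ {es i j} → All (λ (a , b) → adj G (nth xs a) (nth xs b) ≡ true) es →
           Any (Between (toℕ i) (toℕ j)) es → adj G (lookup xs i) (lookup xs j) ≡ true
    edge {i = i} {j} (p ∷ _) (here (refl , refl)) =
      trans (cong₂ (adj G) (≡-sym (nth-lookup xs i)) (≡-sym (nth-lookup xs j))) p
    edge (_ ∷ ps) (there m) = edge ps m
    preserves : ∀ x y → adj (fromEdges _ es) x y ≡ true → adj G (lookup xs x) (lookup xs y) ≡ true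
    preserves x y p with hasEdge⁻ es (proj₂ (∧-true {not (eqℕ (toℕ x) (toℕ y))} p))
    ... | inj₁ m = edge edges m
    ... | inj₂ m = trans (sym G (lookup xs x) (lookup xs y)) (edge edges m)

EdgeSub-trans : ∀ {F H G} → EdgeSub F H → EdgeSub H G → EdgeSub F G
EdgeSub-trans (φ , φ-inj , φ-adj , cov) (ψ , ψ-inj , ψ-adj , _) =
  ψ ∘ φ , φ-inj ∘ ψ-inj , (λ x y p → ψ-adj _ _ (φ-adj x y p)) , cov

module Build (G : Graph) (s r : ℕ) (es : List (ℕ × ℕ)) (cs : Vec (Fin (n G)) (suc s)) where

  V : Set
  V = Fin (n G)

  -- `Row` and `Core` form the part of the adjacency table of cs above the diagonal, each entry
  -- paired with the inequality of its two vertices; symmetry and irreflexivity give the rest.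
  Row : V → ∀ {m} → ℕ → ℕ → Vec V m → Set
  Row x i j []       = ⊤
  Row x i j (y ∷ ys) = (x ≢ y × adj G x y ≡ hasEdge es i j) × Row x i (suc j) ys

  Core : ∀ {m} → ℕ → Vec V m → Set
  Core i []       = ⊤
  Core i (x ∷ xs) = Row x i (suc i) xs × Core (suc i) xs

  row-lookup : ∀ {m} x i j (ys : Vec V m) → Row x i j ys → ∀ l →
               x ≢ lookup ys l × adj G x (lookup ys l) ≡ hasEdge es i (j + toℕ l)
  row-lookup x i j (y ∷ ys) (p , _) zero    rewrite ℕ.+-identityʳ j = p
  row-lookup x i j (y ∷ ys) (_ , ps) (suc l) rewrite ℕ.+-suc j (toℕ l) = row-lookup x i (suc j) ys ps l

  core-lookup : ∀ {m} i (xs : Vec V m) → Core i xs → ∀ k l → toℕ k < toℕ l →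
                lookup xs k ≢ lookup xs l × adj G (lookup xs k) (lookup xs l) ≡ hasEdge es (i + toℕ k) (i + toℕ l)
  core-lookup i (x ∷ xs) (p , _) zero (suc l) _
    rewrite ℕ.+-identityʳ i | ℕ.+-suc i (toℕ l) = row-lookup x i (suc i) xs p l
  core-lookup i (x ∷ xs) (_ , ps) (suc k) (suc l) (s≤s lt)
    rewrite ℕ.+-suc i (toℕ k) | ℕ.+-suc i (toℕ l) = core-lookup (suc i) xs ps k l lt

  Fresh : V → Set
  Fresh x = ∀ i → x ≢ lookup cs i

  Unattached : V → Set
  Unattached x = ∀ i → adj G (lookup cs i) x ≡ false

  -- Besides the right adjacency to the core, x has no neighbour outside the core; thus the leaf
  -- classes are independent and the blow-up is closed.
  Attached : V → Fin r → Set
  Attached x l = (∀ i → adj G (lookup cs i) x ≡ hasEdge es (toℕ i) (suc s + toℕ l)) ×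
                 (∀ {y} → Fresh y → adj G x y ≡ true → ⊥)

  core? : ∀ x → (∃[ i ] x ≡ lookup cs i) ⊎ Fresh x
  core? x with Fin.any? (λ i → x Fin.≟ lookup cs i)
  ... | yes p = inj₁ p
  ... | no ¬p = inj₂ λ i e → ¬p (i , e)

  Loopless Independent Anchored : Set
  Loopless    = ∀ (i : Fin (suc s)) → hasEdge es (toℕ i) (toℕ i) ≡ false
  Independent = ∀ (k l : Fin r) → hasEdge es (suc s + toℕ k) (suc s + toℕ l) ≡ false
  Anchored    = ∀ (l : Fin r) → ∃[ i ] hasEdge es (toℕ {suc s} i) (suc s + toℕ l) ≡ true

  pattern? : Dec (Loopless × Independent × Anchored)
  pattern? = (Fin.all? λ i → _ Bool.≟ false) ×-dec (Fin.all? λ k → Fin.all? λ l → _ Bool.≟ false) ×-dec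
             (Fin.all? λ l → Fin.any? λ i → _ Bool.≟ true)

  module _ {w : True pattern?} (ok : Core 0 cs)
    (profile : ∀ x → Fresh x → Unattached x ⊎ ∃[ l ] Attached x l) where

    -- Indexed by the label it assigns. All outer vertices share `suc s + r`, the first label that
    -- is not inside.
    data View (x : V) : ℕ → Set where
      isCore  : ∀ i → x ≡ lookup cs i → View x (toℕ i)
      isLeaf  : ∀ l → Fresh x → Attached x l → View x (suc s + toℕ l)
      isOuter : Fresh x → Unattached x → View x (suc s + r)

    classify : ∀ x → ∃ (View x)
    classify x with core? x
    ... | inj₁ (i , e) = _ , isCore i e
    ... | inj₂ f with profile x f
    ...   | inj₁ u       = _ , isOuter f u
    ...   | inj₂ (l , a) = _ , isLeaf l f a

    distinct : Distinct cs
    distinct {i} {j} e with ℕ.<-cmp (toℕ i) (toℕ j)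
    ... | tri< lt _ _ = ⊥-elim (proj₁ (core-lookup 0 cs ok i j lt) e)
    ... | tri≈ _ eq _ = Fin.toℕ-injective eq
    ... | tri> _ _ gt = ⊥-elim (proj₁ (core-lookup 0 cs ok j i gt) (≡-sym e))

    core-adj : ∀ i j → adj G (lookup cs i) (lookup cs j) ≡ hasEdge es (toℕ i) (toℕ j)
    core-adj i j with ℕ.<-cmp (toℕ i) (toℕ j)
    ... | tri< lt _ _ = proj₂ (core-lookup 0 cs ok i j lt)
    ... | tri> _ _ gt = trans (sym G (lookup cs i) (lookup cs j))
                         (trans (proj₂ (core-lookup 0 cs ok j i gt)) (hasEdge-sym es (toℕ j) (toℕ i)))
    ... | tri≈ _ eq _ with refl ← Fin.toℕ-injective eq =
            trans (irr G (lookup cs i)) (≡-sym (proj₁ (toWitness w) i))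

    leaf≮core : ∀ {l} (i : Fin (suc s)) → suc s + l ≢ toℕ i
    leaf≮core {l} i e = ℕ.<⇒≱ (Fin.toℕ<n i) (ℕ.≤-trans (ℕ.m≤m+n (suc s) l) (ℕ.≤-reflexive e))

    blowup : Blowup G (suc s) (suc s + r) es
    blowup = record
      { lab = λ x → proj₁ (classify x)
      ; core = lookup cs
      ; lab-core = λ i → at-core i (proj₂ (classify (lookup cs i)))
      ; core-uniq = λ {x} i e → unique i e (proj₂ (classify x))
      ; adj-lab = λ {x} {y} p q → pair p q (proj₂ (classify x)) (proj₂ (classify y))
      ; closed = λ {x} {y} a p → close a p (proj₂ (classify x)) (proj₂ (classify y))
      }
      where
        at-core : ∀ i {l} → View (lookup cs i) l → l ≡ toℕ i
        at-core i (isCore j e)   = cong toℕ (≡-sym (distinct e))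
        at-core i (isLeaf _ f _) = ⊥-elim (f i refl)
        at-core i (isOuter f _)  = ⊥-elim (f i refl)
        unique : ∀ {x l} i → l ≡ toℕ i → View x l → x ≡ lookup cs i
        unique i e (isCore j refl) = cong (lookup cs) (Fin.toℕ-injective e)
        unique i e (isLeaf _ _ _)  = ⊥-elim (leaf≮core i e)
        unique i e (isOuter _ _)   = ⊥-elim (leaf≮core i e)
        pair : ∀ {x y k l} → k < suc s + r → l < suc s + r → View x k → View y l → adj G x y ≡ hasEdge es k l
        pair p q (isCore i refl) (isCore j refl) = core-adj i j
        pair p q (isCore i refl) (isLeaf l _ (a , _)) = a i
        pair {x} p q (isLeaf l _ (a , _)) (isCore i refl) =
          trans (sym G x (lookup cs i)) (trans (a i) (hasEdge-sym es (toℕ i) (suc s + toℕ l)))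
        pair p q (isLeaf k _ (_ , ind)) (isLeaf l f _) = trans (≢true (ind f)) (≡-sym (proj₁ (proj₂ (toWitness w)) k l))
        pair p q (isOuter _ _) _ = ⊥-elim (ℕ.n≮n _ p)
        pair p q _ (isOuter _ _) = ⊥-elim (ℕ.n≮n _ q)
        close : ∀ {x y k l} → adj G x y ≡ true → k < suc s + r → View x k → View y l → l < suc s + r
        close a p _ (isCore j _)   = ℕ.≤-trans (Fin.toℕ<n j) (ℕ.m≤m+n (suc s) r)
        close a p _ (isLeaf l _ _) = ℕ.+-monoʳ-< (suc s) (Fin.toℕ<n l)
        close a p (isCore i refl) (isOuter _ u) = ⊥-elim (true≢false a (u i))
        close a p (isLeaf _ _ (_ , ind)) (isOuter f _) = ⊥-elim (ind f a)
        close a p (isOuter _ _) (isOuter _ _) = p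

    open Blowup blowup using (Inside; lab; lab-core; closed)

    core-inside : ∀ i → Inside (lookup cs i)
    core-inside i = subst (_< suc s + r) (≡-sym (lab-core i)) (ℕ.≤-trans (Fin.toℕ<n i) (ℕ.m≤m+n (suc s) r))

    full : (∀ {x y} → Fresh x → Fresh y → adj G x y ≡ true → ⊥) → ∀ {x y} → adj G x y ≡ true → Inside x
    full ind {x} {y} a = go (core? x) (core? y)
      where
        go : (∃[ i ] x ≡ lookup cs i) ⊎ Fresh x → (∃[ i ] y ≡ lookup cs i) ⊎ Fresh y → Inside x
        go (inj₁ (i , refl)) _        = core-inside i
        go (inj₂ _) (inj₁ (j , refl)) = closed (trans (sym G y x) a) (core-inside j)
        go (inj₂ f) (inj₂ g)          = ⊥-elim (ind f g a)

    around : (∀ i → Reach G (lookup cs zero) (lookup cs i)) → ∀ {u} → Inside u → Around blowup u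
    around conn i = i , λ j → Reach-trans (Reach-sym (from i)) (from j)
      where
        from : ∀ {x} → Inside x → Reach G (lookup cs zero) x
        from {x} p with classify x
        ... | _ , isCore i refl = conn i
        ... | _ , isOuter _ _ = ⊥-elim (ℕ.n≮n _ p)
        ... | _ , isLeaf l _ (a , _) = let i , e = proj₂ (proj₂ (toWitness w)) l
                                        in Reach-trans (conn i) (step (trans (a i) e) here)

-- The structure of graphs without the forbidden subgraphs

path₅ᵉ cycle₄ᵉ path₆ᵉ cycle₅ᵉ bullᵉ diamondᵉ caterpillarᵉ path₅+edgeᵉ cycle₄+edgeᵉ : List (ℕ × ℕ)
path₅ᵉ       = (0 , 1) ∷ (1 , 2) ∷ (2 , 3) ∷ (3 , 4) ∷ []
cycle₄ᵉ      = (0 , 1) ∷ (1 , 2) ∷ (2 , 3) ∷ (3 , 0) ∷ []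
path₆ᵉ       = (0 , 1) ∷ (1 , 2) ∷ (2 , 3) ∷ (3 , 4) ∷ (4 , 5) ∷ []
cycle₅ᵉ      = (0 , 1) ∷ (1 , 2) ∷ (2 , 3) ∷ (3 , 4) ∷ (4 , 0) ∷ []
bullᵉ        = (0 , 1) ∷ (1 , 2) ∷ (2 , 0) ∷ (0 , 3) ∷ (1 , 4) ∷ []
diamondᵉ     = (0 , 1) ∷ (0 , 2) ∷ (0 , 3) ∷ (1 , 2) ∷ (1 , 3) ∷ []
caterpillarᵉ = (0 , 1) ∷ (0 , 2) ∷ (0 , 3) ∷ (2 , 4) ∷ (2 , 5) ∷ (3 , 6) ∷ (3 , 7) ∷ []
path₅+edgeᵉ  = (0 , 1) ∷ (1 , 2) ∷ (2 , 3) ∷ (3 , 4) ∷ (5 , 6) ∷ []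
cycle₄+edgeᵉ = (0 , 1) ∷ (1 , 2) ∷ (2 , 3) ∷ (3 , 0) ∷ (4 , 5) ∷ []

P₅ C₄ : Graph
P₅ = fromEdges 5 path₅ᵉ
C₄ = fromEdges 4 cycle₄ᵉ

data SmallComponent (G : Graph) (u : Fin (n G)) : Set where
  isDoubleStar : (B : Blowup G 2 4 doubleStarᵖ) → Around B u → SmallComponent G u
  isVase       : (B : Blowup G 3 4 vaseᵖ) → Around B u → SmallComponent G u
  isIsolated   : (B : Blowup G 1 1 []) → Around B u → SmallComponent G u

record OnlyComponent (G : Graph) (s q : ℕ) (es : List (ℕ × ℕ)) : Set where
  field
    blowup : Blowup G s q es
  open Blowup blowup public
  field
    full   : ∀ {x y} → adj G x y ≡ true → Inside x
    around : ∀ {u} → Inside u → Around blowup u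

-- The common source of Alice's strategy and of the isomorphisms with the templates. A candy comes
-- with a middle vertex, because the pattern alone would allow m = 0.
data Shape (G : Graph) : Set where
  small          : (∀ u → SmallComponent G u) → Shape G
  isCandy        : (C : OnlyComponent G 2 5 candyᵖ) →
                   let open OnlyComponent C in
                   ∃[ w ] (adj G (core 0F) w ≡ true × adj G (core 1F) w ≡ true) → Shape G
  isShootingStar : OnlyComponent G 4 6 shootingStarᵖ → Shape G
  isDoubleVase   : OnlyComponent G 5 6 doubleVaseᵖ → Shape G
  isAmaryllis    : OnlyComponent G 4 6 amaryllisᵖ → Shape G

module Find (G : Graph) where

  V : Set
  V = Fin (n G)

  Adj : V → V → Set
  Adj x y = adj G x y ≡ true

  adj? : ∀ x y → Dec (Adj x y)
  adj? x y = adj G x y Bool.≟ true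

  ~ : ∀ {x y} → Adj x y → Adj y x
  ~ {x} {y} p = trans (sym G y x) p

  adj⇒≢ : ∀ {x y} → Adj x y → x ≢ y
  adj⇒≢ {x} p refl = true≢false p (irr G x)

  ∉₂ : ∀ {x a b : V} → x ≢ a → x ≢ b → ∀ i → x ≢ lookup (a ∷ b ∷ []) i
  ∉₂ p q 0F = p
  ∉₂ p q 1F = q

  ∉₃ : ∀ {x a b c : V} → x ≢ a → x ≢ b → x ≢ c → ∀ i → x ≢ lookup (a ∷ b ∷ c ∷ []) i
  ∉₃ p q r 0F      = p
  ∉₃ p q r (suc i) = ∉₂ q r i

  ∉₄ : ∀ {x a b c d : V} → x ≢ a → x ≢ b → x ≢ c → x ≢ d → ∀ i → x ≢ lookup (a ∷ b ∷ c ∷ d ∷ []) i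
  ∉₄ p q r s 0F      = p
  ∉₄ p q r s (suc i) = ∉₃ q r s i

  distinct₃ : ∀ {a b c : V} → a ≢ b → a ≢ c → b ≢ c → Distinct (a ∷ b ∷ c ∷ [])
  distinct₃ p q r {i} {j} = distinct-∷ (∉₂ p q) (distinct-∷ (λ where 0F → r) single) {i} {j}
    where
      single : ∀ {x : V} → Distinct (x ∷ [])
      single {i = 0F} {0F} _ = refl

  module Small (¬P₅ : ¬ EdgeSub P₅ G) (¬C₄ : ¬ EdgeSub C₄ G) where

    Common : V → V → Set
    Common b c = ∃[ z ] (Adj b z × Adj c z)

    vase-blowup : ∀ {w₁ w₂ w₃} → Adj w₁ w₂ → Adj w₂ w₃ → Adj w₃ w₁ →
      (∀ {x} → Adj w₂ x → x ≡ w₁ ⊎ x ≡ w₃) → (∀ {x} → Adj w₃ x → x ≡ w₁ ⊎ x ≡ w₂) →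
      ∀ {u} → (u ≡ w₁ ⊎ u ≡ w₂ ⊎ u ≡ w₃) ⊎ (Adj u w₁ ⊎ Adj u w₂ ⊎ Adj u w₃) → SmallComponent G u
    vase-blowup {w₁} {w₂} {w₃} e₁₂ e₂₃ e₃₁ N₂ N₃ near = isVase (B.blowup ok profile) (B.around ok profile conn (inside near))
      where
        module B = Build G 2 1 vaseᵖ (w₁ ∷ w₂ ∷ w₃ ∷ [])
        ok : B.Core 0 (w₁ ∷ w₂ ∷ w₃ ∷ [])
        ok = ((adj⇒≢ e₁₂ , e₁₂) , (adj⇒≢ (~ e₃₁) , ~ e₃₁) , tt) , ((adj⇒≢ e₂₃ , e₂₃) , tt) , tt , tt
        profile : ∀ x → B.Fresh x → B.Unattached x ⊎ ∃[ l ] B.Attached x l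
        profile x f with bool? (adj G w₁ x)
        ... | inj₂ ¬p = inj₁ λ where
              0F → ¬p
              1F → ≢true λ p → [ f 0F , f 2F ]′ (N₂ p)
              2F → ≢true λ p → [ f 0F , f 1F ]′ (N₃ p)
        ... | inj₁ p = inj₂ (0F , (λ where
              0F → p
              1F → ≢true λ p → [ f 0F , f 2F ]′ (N₂ p)
              2F → ≢true λ p → [ f 0F , f 1F ]′ (N₃ p)) ,
              λ {y} g q → ¬P₅ (embed {G} path₅ᵉ (y ∷ x ∷ w₁ ∷ w₂ ∷ w₃ ∷ [])
                (distinct-∷ (λ where
                    0F      → adj⇒≢ (~ q)
                    (suc i) → g i)
                  (distinct-∷ f (distinct₃ (adj⇒≢ e₁₂) (adj⇒≢ (~ e₃₁)) (adj⇒≢ e₂₃))))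
                (~ q ∷ ~ p ∷ e₁₂ ∷ e₂₃ ∷ [])))
        conn : ∀ i → Reach G w₁ (lookup (w₁ ∷ w₂ ∷ w₃ ∷ []) i)
        conn 0F = here
        conn 1F = step e₁₂ here
        conn 2F = step (~ e₃₁) here
        open Blowup (B.blowup ok profile) using (Inside; closed)
        inside : ∀ {u} → (u ≡ w₁ ⊎ u ≡ w₂ ⊎ u ≡ w₃) ⊎ (Adj u w₁ ⊎ Adj u w₂ ⊎ Adj u w₃) → Inside u
        inside (inj₁ (inj₁ refl))        = B.core-inside ok profile 0F
        inside (inj₁ (inj₂ (inj₁ refl))) = B.core-inside ok profile 1F
        inside (inj₁ (inj₂ (inj₂ refl))) = B.core-inside ok profile 2F
        inside (inj₂ (inj₁ p))           = closed (~ p) (B.core-inside ok profile 0F)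
        inside (inj₂ (inj₂ (inj₁ p)))    = closed (~ p) (B.core-inside ok profile 1F)
        inside (inj₂ (inj₂ (inj₂ p)))    = closed (~ p) (B.core-inside ok profile 2F)

    doubleStar-blowup : ∀ {b c} → Adj b c → ¬ Common b c →
      (∀ {p q} → Adj b p → p ≢ c → Adj p q → q ≡ b) → (∀ {p q} → Adj c p → p ≢ b → Adj p q → q ≡ c) →
      ∀ {u} → u ≡ b ⊎ Adj u b → SmallComponent G u
    doubleStar-blowup {b} {c} bc ¬common Hb Hc near =
        isDoubleStar (B.blowup ok profile) (B.around ok profile conn (inside near))
      where
        module B = Build G 1 2 doubleStarᵖ (b ∷ c ∷ [])
        ok : B.Core 0 (b ∷ c ∷ [])
        ok = ((adj⇒≢ bc , bc) , tt) , tt , tt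
        profile : ∀ x → B.Fresh x → B.Unattached x ⊎ ∃[ l ] B.Attached x l
        profile x f with bool? (adj G b x) | bool? (adj G c x)
        ... | inj₁ p | inj₁ q = ⊥-elim (¬common (x , p , q))
        ... | inj₁ p | inj₂ q = inj₂ (0F , (λ where
              0F → p
              1F → q) , λ g r → g 0F (Hb p (f 1F) r))
        ... | inj₂ p | inj₁ q = inj₂ (1F , (λ where
              0F → p
              1F → q) , λ g r → g 1F (Hc q (f 0F) r))
        ... | inj₂ p | inj₂ q = inj₁ λ where
              0F → p
              1F → q
        conn : ∀ i → Reach G b (lookup (b ∷ c ∷ []) i)
        conn 0F = here
        conn 1F = step bc here
        open Blowup (B.blowup ok profile) using (Inside; closed)
        inside : ∀ {u} → u ≡ b ⊎ Adj u b → Inside u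
        inside (inj₁ refl) = B.core-inside ok profile 0F
        inside (inj₂ p)    = closed (~ p) (B.core-inside ok profile 0F)

    isolated-blowup : ∀ {u} → (∀ x → ¬ Adj u x) → SmallComponent G u
    isolated-blowup {u} alone = isIsolated (B.blowup tt,tt profile) (B.around tt,tt profile conn (B.core-inside tt,tt profile 0F))
      where
        module B = Build G 0 0 [] (u ∷ [])
        tt,tt : B.Core 0 (u ∷ [])
        tt,tt = tt , tt
        profile : ∀ x → B.Fresh x → B.Unattached x ⊎ ∃[ l ] B.Attached x l
        profile x f = inj₁ λ where 0F → ≢true (alone x)
        conn : ∀ i → Reach G u (lookup (u ∷ []) i)
        conn 0F = here

    -- A second neighbour q of p would give the path q, p, b, c, d, or the cycle p, b, c, d if q =
    -- d.
    leaf-end : ∀ {b c d} → Adj b c → ¬ Common b c → Adj c d → d ≢ b →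
               ∀ {p q} → Adj b p → p ≢ c → Adj p q → q ≡ b
    leaf-end {b} {c} {d} bc ¬common cd d≢b {p} {q} bp p≢c pq with q Fin.≟ b
    ... | yes e = e
    ... | no q≢b with q Fin.≟ d
    ...   | yes refl = ⊥-elim (¬C₄ (embed {G} cycle₄ᵉ (p ∷ b ∷ c ∷ q ∷ [])
              (distinct-∷ (∉₃ (adj⇒≢ (~ bp)) p≢c (adj⇒≢ pq))
                (distinct₃ (adj⇒≢ bc) (q≢b ∘ ≡-sym) (adj⇒≢ cd)))
              (~ bp ∷ bc ∷ cd ∷ ~ pq ∷ [])))
    ...   | no q≢d = ⊥-elim (¬P₅ (embed {G} path₅ᵉ (q ∷ p ∷ b ∷ c ∷ d ∷ [])
              (distinct-∷ (∉₄ (adj⇒≢ (~ pq)) q≢b (λ where refl → ¬common (p , bp , ~ pq)) q≢d)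
                (distinct-∷ (∉₃ (adj⇒≢ (~ bp)) p≢c (λ where refl → ¬common (p , bp , cd)))
                  (distinct₃ (adj⇒≢ bc) (d≢b ∘ ≡-sym) (adj⇒≢ cd))))
              (~ pq ∷ ~ bp ∷ bc ∷ cd ∷ [])))

    Other : V → V → Set
    Other b c = ∃[ p ] (Adj b p × p ≢ c)

    other? : ∀ b c → Dec (Other b c)
    other? b c = Fin.any? λ p → adj? b p ×-dec ¬? (p Fin.≟ c)

    -- In the absence of triangles, the middle edge of a path on four vertices, hence the centre of
    -- a double star with leaves on both sides.
    Inner : V → V → Set
    Inner b c = Adj b c × Other b c × Other c b

    inner? : ∀ b c → Dec (Inner b c)
    inner? b c = adj? b c ×-dec other? b c ×-dec other? c b

    around-inner : ∀ {b c} → Inner b c → ¬ Common b c → ∀ {u} → u ≡ b ⊎ Adj u b → SmallComponent G u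
    around-inner (bc , (a , ba , a≢c) , (d , cd , d≢b)) ¬common =
      doubleStar-blowup bc ¬common (leaf-end bc ¬common cd d≢b)
        (leaf-end (~ bc) (λ (z , p , q) → ¬common (z , q , p)) ba a≢c)

    Triangle : V → V → V → Set
    Triangle x y z = Adj x y × Adj y z × Adj z x

    -- Two corners of a triangle with further neighbours would give a P₅ or a C₄.
    one-corner : ∀ {x y z p q} → Triangle x y z → Adj x p → p ≢ y → p ≢ z → Adj y q → q ≢ x → q ≢ z → ⊥
    one-corner {x} {y} {z} {p} {q} (xy , yz , zx) xp p≢y p≢z yq q≢x q≢z with p Fin.≟ q
    ... | yes refl = ¬C₄ (embed {G} cycle₄ᵉ (p ∷ x ∷ z ∷ y ∷ [])
            (distinct-∷ (∉₃ q≢x p≢z p≢y) (distinct₃ (adj⇒≢ (~ zx)) (adj⇒≢ xy) (adj⇒≢ (~ yz))))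
            (~ xp ∷ ~ zx ∷ ~ yz ∷ yq ∷ []))
    ... | no p≢q = ¬P₅ (embed {G} path₅ᵉ (p ∷ x ∷ z ∷ y ∷ q ∷ [])
            (distinct-∷ (∉₄ (adj⇒≢ (~ xp)) p≢z p≢y p≢q)
              (distinct-∷ (∉₃ (adj⇒≢ (~ zx)) (adj⇒≢ xy) (q≢x ∘ ≡-sym))
                (distinct₃ (adj⇒≢ (~ yz)) (q≢z ∘ ≡-sym) (adj⇒≢ yq))))
            (~ xp ∷ ~ zx ∷ ~ yz ∷ yq ∷ []))

    Outer : V → V → V → Set
    Outer x y z = ∃[ p ] (Adj x p × p ≢ y × p ≢ z)

    outer? : ∀ x y z → Dec (Outer x y z)
    outer? x y z = Fin.any? λ p → adj? x p ×-dec ¬? (p Fin.≟ y) ×-dec ¬? (p Fin.≟ z)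

    no-outer : ∀ {x y z w} → ¬ Outer x y z → Adj x w → w ≡ y ⊎ w ≡ z
    no-outer {x} {y} {z} {w} ¬o xw with w Fin.≟ y | w Fin.≟ z
    ... | yes e | _     = inj₁ e
    ... | no _  | yes e = inj₂ e
    ... | no p  | no q  = ⊥-elim (¬o (w , xw , p , q))

    around-triangle : ∀ {x y z u} → Triangle x y z → u ≡ x ⊎ Adj u x → SmallComponent G u
    around-triangle {x} {y} {z} {u} (xy , yz , zx) at with outer? x y z | outer? y z x
    ... | yes (p , xp , p≢y , p≢z) | _ = vase-blowup xy yz zx
            (Sum.swap ∘ no-outer λ (q , yq , q≢z , q≢x) → one-corner (xy , yz , zx) xp p≢y p≢z yq q≢x q≢z)
            (no-outer λ (q , zq , q≢x , q≢y) → one-corner (~ zx , ~ yz , ~ xy) xp p≢z p≢y zq q≢x q≢y)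
            ([ inj₁ ∘ inj₁ , inj₂ ∘ inj₁ ]′ at)
    ... | no ¬x | yes (p , yp , p≢z , p≢x) = vase-blowup yz zx xy
            (Sum.swap ∘ no-outer λ (q , zq , q≢x , q≢y) → one-corner (yz , zx , xy) yp p≢z p≢x zq q≢y q≢x)
            (no-outer ¬x)
            ([ inj₁ ∘ inj₂ ∘ inj₂ , inj₂ ∘ inj₂ ∘ inj₂ ]′ at)
    ... | no ¬x | no ¬y = vase-blowup zx xy yz (Sum.swap ∘ no-outer ¬x) (no-outer ¬y)
            ([ inj₁ ∘ inj₂ ∘ inj₁ , inj₂ ∘ inj₂ ∘ inj₁ ]′ at)

    -- It is enough to look at u and its neighbours for a triangle or an inner edge. If there is
    -- neither, no edge at u or at a neighbour of u is inner, and any edge uv serves as the centre.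
    component : ∀ u → SmallComponent G u
    component u with Fin.any? (adj? u)
    ... | no alone = isolated-blowup λ x p → alone (x , p)
    ... | yes (v , uv) with Fin.any? (λ x → (x Fin.≟ u ⊎-dec adj? u x) ×-dec
                              Fin.any? λ y → Fin.any? λ z → adj? x y ×-dec adj? y z ×-dec adj? z x)
    ...   | yes (x , at , y , z , t) = around-triangle t (Sum.map ≡-sym id at)
    ...   | no ¬t with Fin.any? (inner? u)
    ...     | yes (c , i) = around-inner i (λ (z , p , q) → ¬t (u , inj₁ refl , c , z , proj₁ i , q , ~ p)) (inj₁ refl)
    ...     | no ¬i with Fin.any? (λ b → adj? u b ×-dec Fin.any? (inner? b))
    ...       | yes (b , ub , c , i) =
                  around-inner i (λ (z , p , q) → ¬t (b , inj₂ ub , c , z , proj₁ i , q , ~ p)) (inj₂ ub)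
    ...       | no ¬i′ = doubleStar-blowup uv (λ (z , p , q) → ¬t (u , inj₁ refl , v , z , uv , q , ~ p))
                  (λ {p} {q} up p≢v pq → case q Fin.≟ u of λ where
                    (yes e)  → e
                    (no q≢u) → ⊥-elim (¬i (p , up , (v , uv , p≢v ∘ ≡-sym) , (q , pq , q≢u))))
                  (λ {p} {q} vp p≢u pq → case q Fin.≟ v of λ where
                    (yes e)  → e
                    (no q≢v) → ⊥-elim (¬i′ (v , uv , p , vp , (u , ~ uv , p≢u ∘ ≡-sym) , (q , pq , q≢v))))
                  (inj₁ refl)

  sub : ∀ {m N} es (D : Vec V m) → Distinct D → (idx : Vec (Fin m) (suc N)) →
        {_ : True (covered? (suc N) es)} {_ : True (distinct? idx)} →
        All (λ (a , b) → Adj (nth (select D idx) a) (nth (select D idx) b)) es → EdgeSub (fromEdges (suc N) es) G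
  sub es D d idx {w} {w′} ps = embed {G} es (select D idx) {w} (distinct-select {xs = D} d idx {w′}) ps

  module Cycle (¬C₄+P₂ : ¬ EdgeSub C4∪P2 G) (¬P₆ : ¬ EdgeSub P6 G) (¬C₅ : ¬ EdgeSub C5 G)
    (¬diamond : ¬ EdgeSub diamond G) where

    record IsCycle (a b c d : V) : Set where
      field
        dist : Distinct (a ∷ b ∷ c ∷ d ∷ [])
        ab   : Adj a b
        bc   : Adj b c
        cd   : Adj c d
        da   : Adj d a

    rotate : ∀ {a b c d} → IsCycle a b c d → IsCycle b c d a
    rotate {a} {b} {c} {d} C = record
      { dist = λ {i} {j} → distinct-select {xs = a ∷ b ∷ c ∷ d ∷ []} dist (1F ∷ 2F ∷ 3F ∷ 0F ∷ []) {_} {i} {j}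
      ; ab = bc ; bc = cd ; cd = da ; da = ab }
      where open IsCycle C

    reflect : ∀ {a b c d} → IsCycle a b c d → IsCycle c b a d
    reflect {a} {b} {c} {d} C = record
      { dist = λ {i} {j} → distinct-select {xs = a ∷ b ∷ c ∷ d ∷ []} dist (2F ∷ 1F ∷ 0F ∷ 3F ∷ []) {_} {i} {j}
      ; ab = ~ bc ; bc = ~ ab ; cd = ~ da ; da = ~ cd }
      where open IsCycle C

    Off : V → V → V → V → V → Set
    Off a b c d x = ∀ i → x ≢ lookup (a ∷ b ∷ c ∷ d ∷ []) i

    rotate-off : ∀ {a b c d x} → Off a b c d x → Off b c d a x
    rotate-off f = ∉₄ (f 1F) (f 2F) (f 3F) (f 0F)

    reflect-off : ∀ {a b c d x} → Off a b c d x → Off c b a d x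
    reflect-off f = ∉₄ (f 2F) (f 1F) (f 0F) (f 3F)

    chordless : ∀ {a b c d} → IsCycle a b c d → ¬ Adj a c
    chordless {a} {b} {c} {d} C ac = ¬diamond (sub diamondᵉ (a ∷ b ∷ c ∷ d ∷ []) dist (0F ∷ 2F ∷ 1F ∷ 3F ∷ [])
      (ac ∷ ab ∷ ~ da ∷ ~ bc ∷ cd ∷ []))
      where open IsCycle C

    -- Outside neighbours of two consecutive vertices extend the path round the cycle to a P₆, or
    -- close it to a C₅ if they coincide.
    not-both : ∀ {a b c d x y} → IsCycle a b c d → Off a b c d x → Off a b c d y → Adj b x → Adj a y → ⊥
    not-both {a} {b} {c} {d} {x} {y} C fx fy bx ay with y Fin.≟ x
    ... | yes refl = ¬C₅ (sub cycle₅ᵉ (x ∷ a ∷ b ∷ c ∷ d ∷ []) (distinct-∷ fx dist) (0F ∷ 2F ∷ 3F ∷ 4F ∷ 1F ∷ [])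
            (~ bx ∷ bc ∷ cd ∷ da ∷ ay ∷ []))
      where open IsCycle C
    ... | no y≢x = ¬P₆ (sub path₆ᵉ (y ∷ x ∷ a ∷ b ∷ c ∷ d ∷ [])
            (distinct-∷ (λ where
                0F      → y≢x
                (suc i) → fy i) (distinct-∷ fx dist))
            (1F ∷ 3F ∷ 4F ∷ 5F ∷ 2F ∷ 0F ∷ []) (~ bx ∷ bc ∷ cd ∷ da ∷ ay ∷ []))
      where open IsCycle C

    -- Outside vertices attach only to a and c, which become the centres, with b and d among the
    -- middle vertices. Chords would give a diamond, and an edge disjoint from the cycle is excluded
    -- as well.
    candy-shape : ∀ {a b c d} → IsCycle a b c d → (∀ {x} → Off a b c d x → ¬ Adj b x) →
                  (∀ {x} → Off a b c d x → ¬ Adj d x) → Shape G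
    candy-shape {a} {b} {c} {d} C ¬b ¬d = isCandy (record
        { blowup = B.blowup ok profile
        ; full   = B.full ok profile independent
        ; around = B.around ok profile conn
        }) (b , ab , ~ bc)
      where
        open IsCycle C
        module B = Build G 1 3 candyᵖ (a ∷ c ∷ [])
        ok : B.Core 0 (a ∷ c ∷ [])
        ok = (((λ e → case dist {0F} {2F} e of λ ()) , ≢true (chordless C)) , tt) , tt , tt
        opposite : ∀ {x y} → x ≡ b ⊎ x ≡ d → B.Fresh y → ¬ Adj x y
        opposite {y = y} (inj₁ refl) g q with y Fin.≟ d
        ... | yes refl = chordless (rotate C) q
        ... | no y≢d   = ¬b (∉₄ (g 0F) (adj⇒≢ (~ q)) (g 1F) y≢d) q
        opposite {y = y} (inj₂ refl) g q with y Fin.≟ b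
        ... | yes refl = chordless (rotate C) (~ q)
        ... | no y≢b   = ¬d (∉₄ (g 0F) y≢b (g 1F) (adj⇒≢ (~ q))) q
        independent : ∀ {x y} → B.Fresh x → B.Fresh y → Adj x y → ⊥
        independent {x} {y} f g q with x Fin.≟ b | x Fin.≟ d | y Fin.≟ b | y Fin.≟ d
        ... | yes e | _ | _ | _ = opposite (inj₁ e) g q
        ... | _ | yes e | _ | _ = opposite (inj₂ e) g q
        ... | _ | _ | yes e | _ = opposite (inj₁ e) f (~ q)
        ... | _ | _ | _ | yes e = opposite (inj₂ e) f (~ q)
        ... | no x≢b | no x≢d | no y≢b | no y≢d =
              ¬C₄+P₂ (sub cycle₄+edgeᵉ (y ∷ x ∷ a ∷ b ∷ c ∷ d ∷ [])
                (distinct-∷ (λ where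
                    0F      → adj⇒≢ (~ q)
                    (suc i) → ∉₄ (g 0F) y≢b (g 1F) y≢d i)
                  (distinct-∷ (∉₄ (f 0F) x≢b (f 1F) x≢d) dist))
                (2F ∷ 3F ∷ 4F ∷ 5F ∷ 0F ∷ 1F ∷ []) (ab ∷ bc ∷ cd ∷ da ∷ ~ q ∷ []))
        profile : ∀ x → B.Fresh x → B.Unattached x ⊎ ∃[ l ] B.Attached x l
        profile x f with bool? (adj G a x) | bool? (adj G c x)
        ... | inj₁ p | inj₁ q = inj₂ (0F , (λ where
              0F → p
              1F → q) , independent f)
        ... | inj₁ p | inj₂ q = inj₂ (1F , (λ where
              0F → p
              1F → q) , independent f)
        ... | inj₂ p | inj₁ q = inj₂ (2F , (λ where
              0F → p
              1F → q) , independent f)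
        ... | inj₂ p | inj₂ q = inj₁ λ where
              0F → p
              1F → q
        conn : ∀ i → Reach G a (lookup (a ∷ c ∷ []) i)
        conn 0F = here
        conn 1F = step ab (step bc here)

    -- The centres are a and c unless b or d has an outside neighbour. In that case, by `not-both`,
    -- neither a nor c has one, and b and d are the centres.
    shape : ∀ {a b c d} → IsCycle a b c d → Shape G
    shape {a} {b} {c} {d} C with Fin.any? (λ x → (Fin.all? λ i → ¬? (x Fin.≟ lookup (a ∷ b ∷ c ∷ d ∷ []) i)) ×-dec
                                       (adj? b x ⊎-dec adj? d x))
    ... | no none = candy-shape C (λ f p → none (_ , f , inj₁ p)) (λ f p → none (_ , f , inj₂ p))
    ... | yes (x , f , inj₁ bx) = candy-shape (rotate C)
            (λ g p → not-both (reflect C) (reflect-off f) (reflect-off (back g)) bx p)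
            (λ g p → not-both C f (back g) bx p)
      where
        back : ∀ {y} → Off b c d a y → Off a b c d y
        back = rotate-off ∘ rotate-off ∘ rotate-off
    ... | yes (x , f , inj₂ dx) = candy-shape (rotate C)
            (λ g p → not-both C′ (f′ f) (f′ (back g)) dx p)
            (λ g p → not-both (reflect C′) (reflect-off (f′ f)) (reflect-off (f′ (back g))) dx p)
      where
        back : ∀ {y} → Off b c d a y → Off a b c d y
        back = rotate-off ∘ rotate-off ∘ rotate-off
        C′ : IsCycle c d a b
        C′ = rotate (rotate C)
        f′ : ∀ {y} → Off a b c d y → Off c d a b y
        f′ = rotate-off ∘ rotate-off

  module Path (¬P₅+P₂ : ¬ EdgeSub P5∪P2 G) (¬P₆ : ¬ EdgeSub P6 G) (¬C₅ : ¬ EdgeSub C5 G)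
    (¬bull : ¬ EdgeSub bull G) (¬caterpillar : ¬ EdgeSub F₁ G) (¬C₄ : ¬ EdgeSub C₄ G) where

    Off : V → V → V → V → V → V → Set
    Off a b c d e x = ∀ i → x ≢ lookup (a ∷ b ∷ c ∷ d ∷ e ∷ []) i

    off : ∀ {a b c d e x} → x ≢ a → x ≢ b → x ≢ c → x ≢ d → x ≢ e → Off a b c d e x
    off p q r s t 0F      = p
    off p q r s t (suc i) = ∉₄ q r s t i

    reverse-off : ∀ {a b c d e x} → Off a b c d e x → Off e d c b a x
    reverse-off f = off (f 4F) (f 3F) (f 2F) (f 1F) (f 0F)

    record IsPath (a b c d e : V) : Set where
      field
        dist : Distinct (a ∷ b ∷ c ∷ d ∷ e ∷ [])
        ab   : Adj a b
        bc   : Adj b c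
        cd   : Adj c d
        de   : Adj d e

    reverse : ∀ {a b c d e} → IsPath a b c d e → IsPath e d c b a
    reverse {a} {b} {c} {d} {e} P = record
      { dist = λ {i} {j} → distinct-select {xs = a ∷ b ∷ c ∷ d ∷ e ∷ []} dist (4F ∷ 3F ∷ 2F ∷ 1F ∷ 0F ∷ []) {_} {i} {j}
      ; ab = ~ de ; bc = ~ cd ; cd = ~ bc ; de = ~ ab }
      where open IsPath P

    -- Facts about the left half of the path; applied to the reversed path they hold for the right
    -- half. Of all chords only ac and ce survive, and outside vertices can attach only to b, c and
    -- d.
    module Half {a b c d e : V} (P : IsPath a b c d e) where
      open IsPath P

      D : Vec V 5
      D = a ∷ b ∷ c ∷ d ∷ e ∷ []

      with-x : ∀ {x} → Off a b c d e x → Distinct (x ∷ D)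
      with-x f = distinct-∷ f dist

      place : ∀ x → (∃[ i ] x ≡ lookup D i) ⊎ Off a b c d e x
      place x with Fin.any? (λ i → x Fin.≟ lookup D i)
      ... | yes p = inj₁ p
      ... | no ¬p = inj₂ λ i q → ¬p (i , q)

      ¬ad : ¬ Adj a d
      ¬ad p = ¬C₄ (sub cycle₄ᵉ D dist (0F ∷ 1F ∷ 2F ∷ 3F ∷ []) (ab ∷ bc ∷ cd ∷ ~ p ∷ []))

      ¬ae : ¬ Adj a e
      ¬ae p = ¬C₅ (sub cycle₅ᵉ D dist (0F ∷ 1F ∷ 2F ∷ 3F ∷ 4F ∷ []) (ab ∷ bc ∷ cd ∷ de ∷ ~ p ∷ []))

      ¬bd : ¬ Adj b d
      ¬bd p = ¬bull (sub bullᵉ D dist (1F ∷ 3F ∷ 2F ∷ 0F ∷ 4F ∷ []) (p ∷ ~ cd ∷ ~ bc ∷ ~ ab ∷ de ∷ []))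

      ¬be : ¬ Adj b e
      ¬be p = ¬C₄ (sub cycle₄ᵉ D dist (1F ∷ 2F ∷ 3F ∷ 4F ∷ []) (bc ∷ cd ∷ de ∷ ~ p ∷ []))

      near-a : ∀ {x} → Adj a x → x ≡ b ⊎ x ≡ c
      near-a {x} p with place x
      ... | inj₁ (0F , refl) = ⊥-elim (adj⇒≢ p refl)
      ... | inj₁ (1F , refl) = inj₁ refl
      ... | inj₁ (2F , refl) = inj₂ refl
      ... | inj₁ (3F , refl) = ⊥-elim (¬ad p)
      ... | inj₁ (4F , refl) = ⊥-elim (¬ae p)
      ... | inj₂ f = ⊥-elim (¬P₆ (sub path₆ᵉ (x ∷ D) (with-x f) (0F ∷ 1F ∷ 2F ∷ 3F ∷ 4F ∷ 5F ∷ [])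
              (~ p ∷ ab ∷ bc ∷ cd ∷ de ∷ [])))

      near-b : ∀ {x} → Adj b x → (x ≡ a ⊎ x ≡ c) ⊎ Off a b c d e x
      near-b {x} p with place x
      ... | inj₁ (0F , refl) = inj₁ (inj₁ refl)
      ... | inj₁ (1F , refl) = ⊥-elim (adj⇒≢ p refl)
      ... | inj₁ (2F , refl) = inj₁ (inj₂ refl)
      ... | inj₁ (3F , refl) = ⊥-elim (¬bd p)
      ... | inj₁ (4F , refl) = ⊥-elim (¬be p)
      ... | inj₂ f           = inj₂ f

      ¬b-and-c : ∀ {x} → Off a b c d e x → Adj b x → ¬ Adj c x
      ¬b-and-c {x} f p q = ¬P₆ (sub path₆ᵉ (x ∷ D) (with-x f) (1F ∷ 2F ∷ 0F ∷ 3F ∷ 4F ∷ 5F ∷ [])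
        (ab ∷ p ∷ ~ q ∷ cd ∷ de ∷ []))

      ¬b-and-d : ∀ {x} → Off a b c d e x → Adj b x → ¬ Adj d x
      ¬b-and-d {x} f p q = ¬C₄ (sub cycle₄ᵉ (x ∷ D) (with-x f) (2F ∷ 3F ∷ 4F ∷ 0F ∷ []) (bc ∷ cd ∷ q ∷ ~ p ∷ []))

      -- With the chord, the P₆ runs x, b, a, c, d, e.
      chord⇒¬b : Adj a c → ∀ {x} → Off a b c d e x → ¬ Adj b x
      chord⇒¬b ac {x} f p = ¬P₆ (sub path₆ᵉ (x ∷ D) (with-x f) (0F ∷ 2F ∷ 1F ∷ 3F ∷ 4F ∷ 5F ∷ [])
        (~ p ∷ ~ ab ∷ ac ∷ cd ∷ de ∷ []))

      ¬off-off : ∀ {x y} → Off a b c d e x → Off a b c d e y → ¬ Adj x y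
      ¬off-off {x} {y} f g p = ¬P₅+P₂ (sub path₅+edgeᵉ (y ∷ x ∷ D) (distinct-∷ (λ where
          0F      → adj⇒≢ (~ p)
          (suc i) → g i) (with-x f))
        (2F ∷ 3F ∷ 4F ∷ 5F ∷ 6F ∷ 0F ∷ 1F ∷ []) (ab ∷ bc ∷ cd ∷ de ∷ ~ p ∷ []))

    module Both {a b c d e : V} (P : IsPath a b c d e) where
      open IsPath P
      open Half P
      private module R = Half (reverse P)

      -- Outside neighbours at all three inner vertices complete F₁: c is its centre with leaf z,
      -- and b and d carry the leaf pairs a, x and e, y.
      leaves-at-most-two : ∀ {x y z} → Off a b c d e x → Off a b c d e y → Off a b c d e z →
                           Adj b x → Adj d y → ¬ Adj c z
      leaves-at-most-two {x} {y} {z} f g h p q r = ¬caterpillar (sub caterpillarᵉ (z ∷ y ∷ x ∷ D)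
        (distinct-∷ (λ where
            0F            → λ where refl → R.¬b-and-c (reverse-off g) q r
            1F            → λ where refl → ¬b-and-c f p r
            (suc (suc i)) → h i)
          (distinct-∷ (λ where
              0F      → λ where refl → ¬b-and-d f p q
              (suc i) → g i) (with-x f)))
        (5F ∷ 0F ∷ 4F ∷ 6F ∷ 3F ∷ 2F ∷ 7F ∷ 1F ∷ [])
        (r ∷ ~ bc ∷ cd ∷ ~ ab ∷ p ∷ de ∷ q ∷ []))

      -- The chords make c the hub of the triangles abc and cde. Neither b nor d can then have an
      -- outside neighbour, so all leaves hang at c.
      doubleVase-shape : Adj a c → Adj c e → Shape G
      doubleVase-shape ac ce = isDoubleVase (record
          { blowup = B.blowup ok profile
          ; full   = B.full ok profile independent
          ; around = B.around ok profile conn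
          })
        where
          module B = Build G 4 1 doubleVaseᵖ (c ∷ a ∷ b ∷ d ∷ e ∷ [])
          ok : B.Core 0 (c ∷ a ∷ b ∷ d ∷ e ∷ [])
          ok = ((adj⇒≢ (~ ac) , ~ ac) , (adj⇒≢ (~ bc) , ~ bc) , (adj⇒≢ cd , cd) , (adj⇒≢ ce , ce) , tt)
             , ((adj⇒≢ ab , ab) , ((λ q → case dist {0F} {3F} q of λ ()) , ≢true ¬ad)
                , ((λ q → case dist {0F} {4F} q of λ ()) , ≢true ¬ae) , tt)
             , (((λ q → case dist {1F} {3F} q of λ ()) , ≢true ¬bd)
                , ((λ q → case dist {1F} {4F} q of λ ()) , ≢true ¬be) , tt)
             , ((adj⇒≢ de , de) , tt) , tt , tt
          fresh : ∀ {x} → B.Fresh x → Off a b c d e x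
          fresh f = off (f 1F) (f 2F) (f 0F) (f 3F) (f 4F)
          independent : ∀ {x y} → B.Fresh x → B.Fresh y → Adj x y → ⊥
          independent f g = ¬off-off (fresh f) (fresh g)
          ¬a : ∀ {x} → B.Fresh x → ¬ Adj a x
          ¬a f p = [ f 2F , f 0F ]′ (near-a p)
          ¬e : ∀ {x} → B.Fresh x → ¬ Adj e x
          ¬e f p = [ f 3F , f 0F ]′ (R.near-a p)
          ¬b : ∀ {x} → B.Fresh x → ¬ Adj b x
          ¬b f = chord⇒¬b ac (fresh f)
          ¬d : ∀ {x} → B.Fresh x → ¬ Adj d x
          ¬d f = R.chord⇒¬b (~ ce) (reverse-off (fresh f))
          profile : ∀ x → B.Fresh x → B.Unattached x ⊎ ∃[ l ] B.Attached x l
          profile x f with bool? (adj G c x)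
          ... | inj₁ p = inj₂ (0F , (λ where
                0F → p
                1F → ≢true (¬a f)
                2F → ≢true (¬b f)
                3F → ≢true (¬d f)
                4F → ≢true (¬e f)) , independent f)
          ... | inj₂ p = inj₁ λ where
                0F → p
                1F → ≢true (¬a f)
                2F → ≢true (¬b f)
                3F → ≢true (¬d f)
                4F → ≢true (¬e f)
          conn : ∀ i → Reach G c (lookup (c ∷ a ∷ b ∷ d ∷ e ∷ []) i)
          conn 0F = here
          conn 1F = step (~ ac) here
          conn 2F = step (~ bc) here
          conn 3F = step cd here
          conn 4F = step ce here

      -- Without the chord ce the end e is just one of the leaves of d, so it is treated together
      -- with the outside vertices.
      module Tail (¬ce : ¬ Adj c e) where
        rest : ∀ {x} → x ≢ c → x ≢ d → x ≢ a → x ≢ b → x ≡ e ⊎ Off a b c d e x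
        rest {x} p q r s with x Fin.≟ e
        ... | yes t = inj₁ t
        ... | no t  = inj₂ (off r s p q t)

        ¬c-and-d : ∀ {x} → x ≡ e ⊎ Off a b c d e x → Adj c x → ¬ Adj d x
        ¬c-and-d (inj₁ refl) p q = ¬ce p
        ¬c-and-d (inj₂ f)    p q = R.¬b-and-c (reverse-off f) q p

        ¬rest-rest : ∀ {x y} → x ≡ e ⊎ Off a b c d e x → y ≡ e ⊎ Off a b c d e y → ¬ Adj x y
        ¬rest-rest (inj₁ refl) (inj₁ refl) q = adj⇒≢ q refl
        ¬rest-rest (inj₁ refl) (inj₂ g)    q = [ g 3F , g 2F ]′ (R.near-a q)
        ¬rest-rest (inj₂ f)    (inj₁ refl) q = [ f 3F , f 2F ]′ (R.near-a (~ q))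
        ¬rest-rest (inj₂ f)    (inj₂ g)    q = ¬off-off f g q

      -- The hub v is c with triangle abc, and w is d, with e among its leaves.
      amaryllis-shape : Adj a c → ¬ Adj c e → Shape G
      amaryllis-shape ac ¬ce = isAmaryllis (record
          { blowup = B.blowup ok profile
          ; full   = B.full ok profile independent
          ; around = B.around ok profile conn
          })
        where
          open Tail ¬ce
          module B = Build G 3 2 amaryllisᵖ (c ∷ d ∷ a ∷ b ∷ [])
          ok : B.Core 0 (c ∷ d ∷ a ∷ b ∷ [])
          ok = ((adj⇒≢ cd , cd) , (adj⇒≢ (~ ac) , ~ ac) , (adj⇒≢ (~ bc) , ~ bc) , tt)
             , (((λ q → case dist {3F} {0F} q of λ ()) , ≢true (¬ad ∘ ~))
                , ((λ q → case dist {3F} {1F} q of λ ()) , ≢true (¬bd ∘ ~)) , tt)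
             , ((adj⇒≢ ab , ab) , tt) , tt , tt
          fresh : ∀ {x} → B.Fresh x → x ≡ e ⊎ Off a b c d e x
          fresh f = rest (f 0F) (f 1F) (f 2F) (f 3F)
          independent : ∀ {x y} → B.Fresh x → B.Fresh y → Adj x y → ⊥
          independent f g = ¬rest-rest (fresh f) (fresh g)
          ¬a : ∀ {x} → B.Fresh x → ¬ Adj a x
          ¬a f p = [ f 3F , f 0F ]′ (near-a p)
          ¬b : ∀ {x} → B.Fresh x → ¬ Adj b x
          ¬b f p = [ [ f 2F , f 0F ]′ , (λ g → chord⇒¬b ac g p) ]′ (near-b p)
          profile : ∀ x → B.Fresh x → B.Unattached x ⊎ ∃[ l ] B.Attached x l
          profile x f with bool? (adj G c x) | bool? (adj G d x)
          ... | inj₁ p | inj₁ q = ⊥-elim (¬c-and-d (fresh f) p q)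
          ... | inj₁ p | inj₂ q = inj₂ (1F , (λ where
                0F → p
                1F → q
                2F → ≢true (¬a f)
                3F → ≢true (¬b f)) , independent f)
          ... | inj₂ p | inj₁ q = inj₂ (0F , (λ where
                0F → p
                1F → q
                2F → ≢true (¬a f)
                3F → ≢true (¬b f)) , independent f)
          ... | inj₂ p | inj₂ q = inj₁ λ where
                0F → p
                1F → q
                2F → ≢true (¬a f)
                3F → ≢true (¬b f)
          conn : ∀ i → Reach G c (lookup (c ∷ d ∷ a ∷ b ∷ []) i)
          conn 0F = here
          conn 1F = step cd here
          conn 2F = step (~ ac) here
          conn 3F = step (~ bc) here

      -- The path is read as e, w = d, v = c, then the tail b, a. As b has no leaf, all outside
      -- neighbours are at c and d.
      shootingStar-shape : ¬ Adj a c → ¬ Adj c e → (∀ {x} → Off a b c d e x → ¬ Adj b x) → Shape G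
      shootingStar-shape ¬ac ¬ce ¬b-leaf = isShootingStar (record
          { blowup = B.blowup ok profile
          ; full   = B.full ok profile independent
          ; around = B.around ok profile conn
          })
        where
          open Tail ¬ce
          module B = Build G 3 2 shootingStarᵖ (c ∷ d ∷ b ∷ a ∷ [])
          ok : B.Core 0 (c ∷ d ∷ b ∷ a ∷ [])
          ok = ((adj⇒≢ cd , cd) , (adj⇒≢ (~ bc) , ~ bc) , ((λ q → case dist {2F} {0F} q of λ ()) , ≢true (¬ac ∘ ~)) , tt)
             , (((λ q → case dist {3F} {1F} q of λ ()) , ≢true (¬bd ∘ ~))
                , ((λ q → case dist {3F} {0F} q of λ ()) , ≢true (¬ad ∘ ~)) , tt)
             , ((adj⇒≢ (~ ab) , ~ ab) , tt) , tt , tt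
          fresh : ∀ {x} → B.Fresh x → x ≡ e ⊎ Off a b c d e x
          fresh f = rest (f 0F) (f 1F) (f 3F) (f 2F)
          independent : ∀ {x y} → B.Fresh x → B.Fresh y → Adj x y → ⊥
          independent f g = ¬rest-rest (fresh f) (fresh g)
          ¬a : ∀ {x} → B.Fresh x → ¬ Adj a x
          ¬a f p = [ f 2F , f 0F ]′ (near-a p)
          ¬b : ∀ {x} → B.Fresh x → ¬ Adj b x
          ¬b f p = [ [ f 3F , f 0F ]′ , (λ g → ¬b-leaf g p) ]′ (near-b p)
          profile : ∀ x → B.Fresh x → B.Unattached x ⊎ ∃[ l ] B.Attached x l
          profile x f with bool? (adj G c x) | bool? (adj G d x)
          ... | inj₁ p | inj₁ q = ⊥-elim (¬c-and-d (fresh f) p q)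
          ... | inj₁ p | inj₂ q = inj₂ (1F , (λ where
                0F → p
                1F → q
                2F → ≢true (¬b f)
                3F → ≢true (¬a f)) , independent f)
          ... | inj₂ p | inj₁ q = inj₂ (0F , (λ where
                0F → p
                1F → q
                2F → ≢true (¬b f)
                3F → ≢true (¬a f)) , independent f)
          ... | inj₂ p | inj₂ q = inj₁ λ where
                0F → p
                1F → q
                2F → ≢true (¬b f)
                3F → ≢true (¬a f)
          conn : ∀ i → Reach G c (lookup (c ∷ d ∷ b ∷ a ∷ []) i)
          conn 0F = here
          conn 1F = step cd here
          conn 2F = step (~ bc) here
          conn 3F = step (~ bc) (step (~ ab) here)

      -- Leaves at both b and d exclude leaves at c. So b and d are the centres, c is a middle
      -- vertex, and a and e join the leaves.
      candy-shape : ¬ Adj a c → ¬ Adj c e → ∀ {x y} → Off a b c d e x → Off a b c d e y → Adj b x → Adj d y → Shape G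
      candy-shape ¬ac ¬ce {x₀} {y₀} f₀ g₀ bx₀ dy₀ = isCandy (record
          { blowup = B.blowup ok profile
          ; full   = B.full ok profile independent
          ; around = B.around ok profile conn
          }) (c , bc , ~ cd)
        where
          module B = Build G 1 3 candyᵖ (b ∷ d ∷ [])
          ok : B.Core 0 (b ∷ d ∷ [])
          ok = (((λ e → case dist {1F} {3F} e of λ ()) , ≢true ¬bd) , tt) , tt , tt
          data Place : V → Set where
            at-a : Place a
            at-c : Place c
            at-e : Place e
            away : ∀ {x} → Off a b c d e x → Place x
          locate : ∀ {x} → B.Fresh x → Place x
          locate {x} f with place x
          ... | inj₁ (0F , refl) = at-a
          ... | inj₁ (1F , refl) = ⊥-elim (f 0F refl)
          ... | inj₁ (2F , refl) = at-c
          ... | inj₁ (3F , refl) = ⊥-elim (f 1F refl)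
          ... | inj₁ (4F , refl) = at-e
          ... | inj₂ h           = away h
          ¬a : ∀ {x} → B.Fresh x → ¬ Adj a x
          ¬a f p = case near-a p of λ where
            (inj₁ r)    → f 0F r
            (inj₂ refl) → ¬ac p
          ¬e : ∀ {x} → B.Fresh x → ¬ Adj e x
          ¬e f p = case R.near-a p of λ where
            (inj₁ r)    → f 1F r
            (inj₂ refl) → ¬ce (~ p)
          apart : ∀ {x y} → B.Fresh x → B.Fresh y → Place x → Place y → ¬ Adj x y
          apart f g at-a     _        p = ¬a g p
          apart f g at-e     _        p = ¬e g p
          apart f g _        at-a     p = ¬a f (~ p)
          apart f g _        at-e     p = ¬e f (~ p)
          apart f g at-c     at-c     p = adj⇒≢ p refl
          apart f g at-c     (away h) p = leaves-at-most-two f₀ g₀ h bx₀ dy₀ p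
          apart f g (away h) at-c     p = leaves-at-most-two f₀ g₀ h bx₀ dy₀ (~ p)
          apart f g (away h) (away i) p = ¬off-off h i p
          independent : ∀ {x y} → B.Fresh x → B.Fresh y → Adj x y → ⊥
          independent f g = apart f g (locate f) (locate g)
          profile : ∀ x → B.Fresh x → B.Unattached x ⊎ ∃[ l ] B.Attached x l
          profile x f with bool? (adj G b x) | bool? (adj G d x)
          ... | inj₁ p | inj₁ q = inj₂ (0F , (λ where
                0F → p
                1F → q) , independent f)
          ... | inj₁ p | inj₂ q = inj₂ (1F , (λ where
                0F → p
                1F → q) , independent f)
          ... | inj₂ p | inj₁ q = inj₂ (2F , (λ where
                0F → p
                1F → q) , independent f)
          ... | inj₂ p | inj₂ q = inj₁ λ where
                0F → p
                1F → q
          conn : ∀ i → Reach G b (lookup (b ∷ d ∷ []) i)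
          conn 0F = here
          conn 1F = step bc (step cd here)

    shape : ∀ {a b c d e} → IsPath a b c d e → Shape G
    shape {a} {b} {c} {d} {e} P with adj? a c | adj? c e
    ... | yes ac | yes ce = Both.doubleVase-shape P ac ce
    ... | yes ac | no ¬ce = Both.amaryllis-shape P ac ¬ce
    ... | no ¬ac | yes ce = Both.amaryllis-shape (reverse P) (~ ce) (¬ac ∘ ~)
    ... | no ¬ac | no ¬ce with Fin.any? (leaf-at b) | Fin.any? (leaf-at d)
      where
        leaf-at : ∀ v x → Dec (Off a b c d e x × Adj v x)
        leaf-at v x = (Fin.all? λ i → ¬? (x Fin.≟ lookup (a ∷ b ∷ c ∷ d ∷ e ∷ []) i)) ×-dec adj? v x
    ... | no ¬x | _ = Both.shootingStar-shape P ¬ac ¬ce λ f p → ¬x (_ , f , p)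
    ... | yes _ | no ¬y = Both.shootingStar-shape (reverse P) (¬ce ∘ ~) (¬ac ∘ ~) λ f p → ¬y (_ , reverse-off f , p)
    ... | yes (x , f , p) | yes (y , g , q) = Both.candy-shape P ¬ac ¬ce f g p q

any-vec? : ∀ {m N} {P : Vec (Fin N) m → Set} → (∀ v → Dec (P v)) → Dec (∃ P)
any-vec? {zero} P? with P? []
... | yes p = yes ([] , p)
... | no ¬p = no λ where ([] , p) → ¬p p
any-vec? {suc m} P? with Fin.any? (λ x → any-vec? λ v → P? (x ∷ v))
... | yes (x , v , p) = yes (x ∷ v , p)
... | no ¬p = no λ where (x ∷ v , p) → ¬p (x , v , p)

-- Trying all vertex maps makes the case distinction on C₄ and P₅ constructive.
edgeSub? : ∀ H G → EdgeSub H G ⊎ ¬ EdgeSub H G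
edgeSub? H G with any-vec? {n H} {n G} (λ v →
    (Fin.all? λ i → Fin.all? λ j → (lookup v i Fin.≟ lookup v j) →-dec (i Fin.≟ j)) ×-dec
    (Fin.all? λ i → Fin.all? λ j → (adj H i j Bool.≟ true) →-dec (adj G (lookup v i) (lookup v j) Bool.≟ true)) ×-dec
    (Fin.all? λ i → Fin.any? λ j → adj H i j Bool.≟ true))
... | yes (v , inj , pres , cov) = inj₁ (lookup v , (λ e → inj _ _ e) , pres , cov)
... | no ¬v = inj₂ λ (φ , inj , pres , cov) → ¬v (Vec.tabulate φ ,
        (λ i j e → inj (trans (≡-sym (Vec.lookup∘tabulate φ i)) (trans e (Vec.lookup∘tabulate φ j)))) ,
        (λ i j p → trans (cong₂ (adj G) (Vec.lookup∘tabulate φ i) (Vec.lookup∘tabulate φ j)) (pres i j p)) , cov)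

shape : ∀ G → NoForbidden G → Shape G
shape G (¬P₅+P₂ , ¬C₄+P₂ , ¬P₆ , ¬C₅ , ¬bull , ¬diamond , ¬F) with edgeSub? C₄ G | edgeSub? P₅ G
... | inj₁ (φ , inj , pres , _) | _ = Find.Cycle.shape G ¬C₄+P₂ ¬P₆ ¬C₅ ¬diamond record
        { dist = λ {i} {j} e → inj (trans (≡-sym (Vec.lookup∘tabulate φ i)) (trans e (Vec.lookup∘tabulate φ j)))
        ; ab = pres 0F 1F refl ; bc = pres 1F 2F refl ; cd = pres 2F 3F refl ; da = pres 3F 0F refl }
... | inj₂ ¬C₄ | inj₁ (φ , inj , pres , _) = Find.Path.shape G ¬P₅+P₂ ¬P₆ ¬C₅ ¬bull ¬F ¬C₄ record
        { dist = λ {i} {j} e → inj (trans (≡-sym (Vec.lookup∘tabulate φ i)) (trans e (Vec.lookup∘tabulate φ j)))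
        ; ab = pres 0F 1F refl ; bc = pres 1F 2F refl ; cd = pres 2F 3F refl ; de = pres 3F 4F refl }
... | inj₂ ¬C₄ | inj₂ ¬P₅ = small (Find.Small.component G ¬P₅ ¬C₄)

-- Cliques of edges

module Cliques (G : Graph) where

  V : Set
  V = Fin (n G)

  -- `IsEdge` admits each edge in one orientation only, the smaller end first, whereas neighbours
  -- come in any order.
  order : V → V → V × V
  order a b with toℕ a ℕ.<? toℕ b
  ... | yes _ = a , b
  ... | no _  = b , a

  data Ends (p : V) : V × V → Set where
    left  : ∀ {q} → Ends p (p , q)
    right : ∀ {q} → Ends p (q , p)

  order-left : ∀ a b → Ends a (order a b)
  order-left a b with toℕ a ℕ.<? toℕ b
  ... | yes _ = left
  ... | no _  = right

  order-right : ∀ a b → Ends b (order a b)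
  order-right a b with toℕ a ℕ.<? toℕ b
  ... | yes _ = right
  ... | no _  = left

  share : ∀ {p e f} → Ends p e → Ends p f → ShareEnd e f
  share left  left  = inj₁ refl
  share left  right = inj₂ (inj₁ refl)
  share right left  = inj₂ (inj₂ (inj₁ refl))
  share right right = inj₂ (inj₂ (inj₂ refl))

  order-edge : ∀ {a b} → adj G a b ≡ true → IsEdge G (order a b)
  order-edge {a} {b} p with toℕ a ℕ.<? toℕ b
  ... | yes a<b = a<b , p
  ... | no a≮b  = ℕ.≤∧≢⇒< (ℕ.≮⇒≥ a≮b) (λ e → true≢false p
                    (subst (λ z → adj G a z ≡ false) (≡-sym (Fin.toℕ-injective e)) (irr G a))) , trans (sym G b a) p

  order-injective : ∀ {a b c d} → order a b ≡ order c d → (a ≡ c × b ≡ d) ⊎ (a ≡ d × b ≡ c)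
  order-injective {a} {b} {c} {d} e with toℕ a ℕ.<? toℕ b | toℕ c ℕ.<? toℕ d
  order-injective refl | yes _ | yes _ = inj₁ (refl , refl)
  order-injective refl | yes _ | no _  = inj₂ (refl , refl)
  order-injective refl | no _  | yes _ = inj₂ (refl , refl)
  order-injective refl | no _  | no _  = inj₁ (refl , refl)

  star : ∀ x → EdgeClique G (count (adj G x))
  star x = (λ i → order x (nbr i)) , (λ i → order-edge (enum-sound (adj G x) i)) ,
           (λ e → enum-injective (adj G x) (case order-injective e of λ where
             (inj₁ (_ , q)) → q
             (inj₂ (p , q)) → trans q p)) ,
           λ i j _ → share (order-left x (nbr i)) (order-left x (nbr j))
    where nbr = enum (adj G x)

  triangle : ∀ {a b c} → adj G a b ≡ true → adj G b c ≡ true → adj G c a ≡ true → EdgeClique G 3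
  triangle {a} {b} {c} ab bc ca = f , edge , injective , shared
    where
      noLoop : ∀ {x y} → adj G x y ≡ true → x ≡ y → ⊥
      noLoop p refl = true≢false p (irr G _)
      f : Fin 3 → V × V
      f 0F = order a b
      f 1F = order b c
      f 2F = order c a
      edge : ∀ i → IsEdge G (f i)
      edge 0F = order-edge ab
      edge 1F = order-edge bc
      edge 2F = order-edge ca
      differ : ∀ {x y z} → adj G x y ≡ true → adj G z x ≡ true → order x y ≡ order y z → ⊥
      differ p q e = case order-injective e of λ where
        (inj₁ (r , _)) → noLoop p r
        (inj₂ (r , _)) → noLoop q (≡-sym r)
      injective : Injective _≡_ _≡_ f
      injective {0F} {0F} _ = refl
      injective {1F} {1F} _ = refl
      injective {2F} {2F} _ = refl
      injective {0F} {1F} e = ⊥-elim (differ ab ca e)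
      injective {1F} {0F} e = ⊥-elim (differ ab ca (≡-sym e))
      injective {1F} {2F} e = ⊥-elim (differ bc ab e)
      injective {2F} {1F} e = ⊥-elim (differ bc ab (≡-sym e))
      injective {2F} {0F} e = ⊥-elim (differ ca bc e)
      injective {0F} {2F} e = ⊥-elim (differ ca bc (≡-sym e))
      shared : ∀ i j → i ≢ j → ShareEnd (f i) (f j)
      shared 0F 0F p = ⊥-elim (p refl)
      shared 1F 1F p = ⊥-elim (p refl)
      shared 2F 2F p = ⊥-elim (p refl)
      shared 0F 1F _ = share (order-right a b) (order-left b c)
      shared 1F 0F _ = share (order-left b c) (order-right a b)
      shared 1F 2F _ = share (order-right b c) (order-left c a)
      shared 2F 1F _ = share (order-left c a) (order-right b c)
      shared 2F 0F _ = share (order-right c a) (order-left a b)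
      shared 0F 2F _ = share (order-left a b) (order-right c a)

module ProperColouring {F : Graph} {w : ℕ} (c : Colouring F w) (c-sym : ∀ x y → c x y ≡ c y x)
  (proper : ∀ {x y z i} → c x y ≡ just i → c x z ≡ just i → y ≡ z) (full : AllColoured {F} c) where

  -- Two edges of a clique share an end and so differ in colour; hence colouring injects the clique
  -- into `Fin w`. The fixed orientation of edges rules out that two of them are each other's
  -- reverse.
  clique-≤ : ∀ {j} → EdgeClique F j → j ≤ w
  clique-≤ (f , edge , f-inj , meet) = Fin.injective⇒≤ {f = proj₁ ∘ colour} injective
    where
      colour : ∀ i → ∃[ l ] c (proj₁ (f i)) (proj₂ (f i)) ≡ just l
      colour i = full _ _ (proj₂ (edge i))
      clash : ∀ {a b a′ b′ l} → toℕ a < toℕ b → toℕ a′ < toℕ b′ → c a b ≡ just l → c a′ b′ ≡ just l →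
              ShareEnd (a , b) (a′ , b′) → (a , b) ≡ (a′ , b′)
      clash _ _ p q (inj₁ refl) = cong (_ ,_) (proper p q)
      clash {a} {b} {a′} l l′ p q (inj₂ (inj₁ refl))
        with refl ← proper p (trans (c-sym a a′) q) = ⊥-elim (ℕ.<-asym l l′)
      clash {a} {b} l l′ p q (inj₂ (inj₂ (inj₁ refl)))
        with refl ← proper (trans (c-sym b a) p) q = ⊥-elim (ℕ.<-asym l l′)
      clash {a} {b} {a′} _ _ p q (inj₂ (inj₂ (inj₂ refl))) =
        cong (_, b) (proper (trans (c-sym b a) p) (trans (c-sym b a′) q))
      injective : Injective _≡_ _≡_ (proj₁ ∘ colour)
      injective {i} {i′} e with i Fin.≟ i′
      ... | yes r = r
      ... | no i≢i′ = f-inj (clash (proj₁ (edge i)) (proj₁ (edge i′)) (proj₂ (colour i))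
              (trans (proj₂ (colour i′)) (cong just (≡-sym e))) (meet i i′ i≢i′))

-- A won game ends in a proper edge colouring, so it uses at least ω colours.

module Lower (G : Graph) (k : ℕ) where
  open Game G k

  Proper : Col → Set
  Proper c = ∀ {x y z i} → c x y ≡ just i → c x z ≡ just i → y ≡ z

  proper-upd : ∀ {c u v j} → Valid c → Leg c u v j → Proper c → Proper (upd c u v j)
  proper-upd {c} val leg pr {x} {y} {z} p q with upd-cases {c} x y p | upd-cases {c} x z q
  ... | inj₂ p′ | inj₂ q′ = pr p′ q′
  ... | inj₁ (inj₁ (refl , refl) , refl) | inj₂ q′ = ⊥-elim (unseen⁻ (Move.unseen-before val leg (inj₁ refl)) z q′)
  ... | inj₁ (inj₂ (refl , refl) , refl) | inj₂ q′ = ⊥-elim (unseen⁻ (Move.unseen-before val leg (inj₂ refl)) z q′)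
  ... | inj₂ p′ | inj₁ (inj₁ (refl , refl) , refl) = ⊥-elim (unseen⁻ (Move.unseen-before val leg (inj₁ refl)) y p′)
  ... | inj₂ p′ | inj₁ (inj₂ (refl , refl) , refl) = ⊥-elim (unseen⁻ (Move.unseen-before val leg (inj₂ refl)) y p′)
  ... | inj₁ (inj₁ (refl , refl) , _) | inj₁ (inj₁ (refl , refl) , _) = refl
  ... | inj₁ (inj₂ (refl , refl) , _) | inj₁ (inj₂ (refl , refl) , _) = refl
  ... | inj₁ (inj₁ (refl , refl) , _) | inj₁ (inj₂ (e , _) , _) = ⊥-elim (Move.u≢v val leg e)
  ... | inj₁ (inj₂ (refl , refl) , _) | inj₁ (inj₁ (e , _) , _) = ⊥-elim (Move.u≢v val leg (≡-sym e))

  -- Plays the game to its end: Alice follows her strategy, and for Bob the legal move stored in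
  -- `bobMoves` is taken.
  final : ∀ {c p} → Valid c → Proper c → Wins c p → ∃[ c′ ] (Valid c′ × Proper c′ × AllColoured {G} c′)
  final′ : ∀ {c u v j p} → Valid c → Proper c → Leg c u v j → Wins (setCol {G} c u v j) p →
           ∃[ c′ ] (Valid c′ × Proper c′ × AllColoured {G} c′)
  final val pr (finished f)               = _ , val , (λ {x} {y} {z} → pr {x} {y} {z}) , f
  final val pr (aliceMoves u v j leg w)   = final′ val pr leg w
  final val pr (bobMoves (u , v , j , leg) f) = final′ val pr leg (f u v j leg)
  final′ {c} {u} {v} {j} val pr leg w =
    final (subst Valid (upd-def c u v j) (Move.valid′ val leg))
          (subst Proper′ (upd-def c u v j) (λ {x} {y} {z} → proper-upd val leg pr {x} {y} {z})) w
    where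
      Proper′ : Col → Set
      Proper′ c = Proper c

  clique-≤ : ∀ {w} → EdgeClique G w → AliceWinsBminus G k → w ≤ k
  clique-≤ clique win with final valid-∅ (λ ()) win
  ... | c , val , pr , full =
    ProperColouring.clique-≤ {G} c (Valid.csym val) (λ {x} {y} {z} → pr {x} {y} {z}) full clique

-- A canonical representative of each component

first : ∀ {m} → (Fin m → Bool) → Maybe (Fin m)
first {zero}  P = nothing
first {suc m} P = if P zero then just zero else Data.Maybe.map suc (first (P ∘ suc))

first-cong : ∀ {m} {P Q : Fin m → Bool} → (∀ x → P x ≡ Q x) → first P ≡ first Q
first-cong {zero}  h = refl
first-cong {suc m} {P} {Q} h rewrite h zero | first-cong {P = P ∘ suc} {Q ∘ suc} (h ∘ suc) = refl

first-common : ∀ {m} {P Q : Fin m → Bool} {x} → P x ≡ true → first P ≡ first Q → ∃[ z ] (P z ≡ true × Q z ≡ true)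
first-common {suc m} {P} {Q} {x} p e with P zero in eP | Q zero in eQ
... | true  | true  = zero , eP , eQ
... | true  | false with first (Q ∘ suc)
...   | just _  = case e of λ ()
...   | nothing = case e of λ ()
first-common {suc m} {P} {Q} {x} p e | false | true with first (P ∘ suc)
...   | just _  = case e of λ ()
...   | nothing = case e of λ ()
first-common {suc m} {P} {Q} {zero}  p e | false | false = ⊥-elim (true≢false p eP)
first-common {suc m} {P} {Q} {suc x} p e | false | false =
  let z , a , b = first-common {P = P ∘ suc} {Q ∘ suc} {x} p (Maybe.map-injective Fin.suc-injective e)
  in suc z , a , b

module Upper (G : Graph) (k : ℕ) (deg≤k : ∀ x → count (adj G x) ≤ k)
  (triangle : ∀ {x y z} → adj G x y ≡ true → adj G y z ≡ true → adj G z x ≡ true → 3 ≤ k) where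

  member : ∀ {u} → SmallComponent G u → Fin (n G) → Bool
  member (isDoubleStar B _) y = does (Blowup.lab B y ℕ.<? 4)
  member (isVase B _)       y = does (Blowup.lab B y ℕ.<? 4)
  member (isIsolated B _)   y = does (Blowup.lab B y ℕ.<? 1)

  does-true : ∀ {A : Set} (d : Dec A) → does d ≡ true → A
  does-true (yes a) _ = a

  true-does : ∀ {A : Set} (d : Dec A) → A → does d ≡ true
  true-does (yes _) _ = refl
  true-does (no ¬a) a = ⊥-elim (¬a a)

  member⇒reach : ∀ {u y} (C : SmallComponent G u) → member C y ≡ true → Reach G u y
  member⇒reach (isDoubleStar B (_ , r)) p = r (does-true (_ ℕ.<? _) p)
  member⇒reach (isVase B (_ , r))       p = r (does-true (_ ℕ.<? _) p)
  member⇒reach (isIsolated B (_ , r))   p = r (does-true (_ ℕ.<? _) p)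

  reach⇒member : ∀ {u y} (C : SmallComponent G u) → Reach G u y → member C y ≡ true
  reach⇒member (isDoubleStar B (i , _)) p = true-does (_ ℕ.<? _) (reach-inside B i p)
  reach⇒member (isVase B (i , _))       p = true-does (_ ℕ.<? _) (reach-inside B i p)
  reach⇒member (isIsolated B (i , _))   p = true-does (_ ℕ.<? _) (reach-inside B i p)

  module SmallComponents (comp : ∀ u → SmallComponent G u) where

    rep : Fin (n G) → Maybe (Fin (n G))
    rep x = first (member (comp x))

    rep-reach : ∀ {x y} → Reach G x y → rep x ≡ rep y
    rep-reach {x} {y} r = first-cong λ z → bool-ext
      (λ p → reach⇒member (comp y) (Reach-trans (Reach-sym r) (member⇒reach (comp x) p)))
      (λ p → reach⇒member (comp x) (Reach-trans r (member⇒reach (comp y) p)))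

    -- Components with the same first vertex have a vertex in common.
    reach-rep : ∀ {x y} → rep y ≡ rep x → Reach G x y
    reach-rep {x} {y} e =
      let z , p , q = first-common {P = member (comp y)} {member (comp x)} {y} (reach⇒member (comp y) here) e
      in Reach-trans (member⇒reach (comp x) q) (Reach-sym (member⇒reach (comp y) p))

    open Components G k deg≤k triangle (Maybe (Fin (n G))) (Maybe.≡-dec Fin._≟_) rep (λ a → rep-reach (step a here))

    covers : ∀ {s q es x} (B : Blowup G s q es) → Around B x → ∀ {y} → rep y ≡ rep x → Blowup.Inside B y
    covers B (i , _) e = reach-inside B i (reach-rep e)

    core-rep : ∀ {s q es x} (B : Blowup G s q es) → s ≤ q → Around B x → ∀ i → rep (Blowup.core B i) ≡ rep x
    core-rep B s≤q (_ , r) i = ≡-sym (rep-reach (r (subst (_< _) (≡-sym (Blowup.lab-core B i)) (ℕ.≤-trans (Fin.toℕ<n i) s≤q))))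

    state : ∀ x → State (rep x) ∅
    state x = start (comp x)
      where
        start : SmallComponent G x → State (rep x) ∅
        start (isDoubleStar B around) = doubleStar-state B (covers B around) (core-rep B (ℕ.m≤m+n 2 2) around)
        start (isVase B around)       = vase-state B (covers B around) (core-rep B (ℕ.m≤m+n 3 1) around)
        start (isIsolated B around)   = isolated-state B (covers B around)

    alice-wins : AliceWinsBminus G k
    alice-wins = wins state

  alice-wins : Shape G → AliceWinsBminus G k
  alice-wins (small comp) = SmallComponents.alice-wins comp
  alice-wins (isShootingStar C) = ShootingStar.wins k blowup full deg≤k
    where open OnlyComponent C
  alice-wins (isDoubleVase C) = DoubleVase.wins k blowup full deg≤k
    where open OnlyComponent C
  alice-wins (isAmaryllis C) = AmaryllisWins.wins k blowup full deg≤k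
    where open OnlyComponent C
  alice-wins (isCandy C (w , aw , bw)) = TwoCentres.wins G k deg≤k a b a≢b ¬ab cover
      -- The middle vertex w is adjacent to both centres, so k ≥ 2.
      (ℕ.≤-trans (count-≥length {P = adj G w} {a ∷ b ∷ []} ((a≢b ∷ []) ∷ [] ∷ [])
         (trans (sym G w a) aw ∷ trans (sym G w b) bw ∷ [])) (deg≤k w))
    where
      open OnlyComponent C
      a = core 0F
      b = core 1F
      a≢b : a ≢ b
      a≢b = apart (lab-core 0F) (lab-core 1F) refl
      ¬ab : adj G a b ≡ true → ⊥
      ¬ab p = case near p (full p) (lab-core 0F) of λ where
        (here e)         → case trans (≡-sym (lab-core 1F)) e of λ ()
        (there (here e)) → case trans (≡-sym (lab-core 1F)) e of λ ()
      end : ∀ {x y} → Link x y → x ≡ a ⊎ x ≡ b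
      end (here (e , _))                         = inj₁ (core-uniq 0F e)
      end (there (here (e , _)))                 = inj₂ (core-uniq 1F e)
      end (there (there (here (e , _))))         = inj₁ (core-uniq 0F e)
      end (there (there (there (here (e , _))))) = inj₂ (core-uniq 1F e)
      cover : ∀ {x y} → adj G x y ≡ true → (x ≡ a ⊎ x ≡ b) ⊎ (y ≡ a ⊎ y ≡ b)
      cover p = [ inj₁ ∘ end , inj₂ ∘ end ]′ (link p (full p))

-- From excluded subgraphs to perfection

NoForbidden-sub : ∀ {H G} → EdgeSub H G → NoForbidden G → NoForbidden H
NoForbidden-sub {H} {G} s (f₁ , f₂ , f₃ , f₄ , f₅ , f₆ , f₇) =
  lift P5∪P2 f₁ , lift C4∪P2 f₂ , lift P6 f₃ , lift C5 f₄ , lift bull f₅ , lift diamond f₆ , lift F₁ f₇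
  where
    lift : ∀ F → ¬ EdgeSub F G → ¬ EdgeSub F H
    lift F ¬f e = ¬f (EdgeSub-trans {F} {H} {G} e s)

-- H inherits the hypothesis, hence has a shape on which Alice wins. Maximality of w is applied to
-- the stars and triangles of H, and its clique of size w excludes fewer colours.
noForbidden⇒perfect : ∀ G → NoForbidden G → LineBminusPerfect G
noForbidden⇒perfect G nf H s w (clique , largest) =
  Upper.alice-wins H w (λ x → largest _ (star x)) (λ p q r → largest _ (triangle p q r))
    (shape H (NoForbidden-sub {H} {G} s nf)) ,
  λ j j<w win → ℕ.<⇒≱ j<w (Lower.clique-≤ H j clique win)
  where open Cliques H

-- Labelling the vertices of the templates

-- Templates number each leaf class directly after the vertices already present, so labels can be
-- assigned class by class: from N on they are j.
extend : ℕ → (ℕ → ℕ) → ℕ → ℕ → ℕ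
extend N L j x = if x ℕ.<ᵇ N then L x else j

extend-old : ∀ {N L j x} → x < N → extend N L j x ≡ L x
extend-old {N} {x = x} p with x ℕ.<ᵇ N | ℕ.<⇒<ᵇ p
... | true | _ = refl

extend-new : ∀ {N L j} i → extend N L j (N + i) ≡ j
extend-new {N} {L} {j} i with (N + i) ℕ.<ᵇ N in e
... | false = refl
... | true  = ⊥-elim (ℕ.<⇒≱ (ℕ.<ᵇ⇒< (N + i) N (subst Data.Bool.T (≡-sym e) _)) (ℕ.m≤m+n N i))

data Split (N m : ℕ) : ℕ → Set where
  old : ∀ {x} → x < N → Split N m x
  new : ∀ i → i < m → Split N m (N + i)

split : ∀ N {m x} → x < N + m → Split N m x
split N {m} {x} p with x ℕ.<? N
... | yes q = old q
... | no q = subst (Split N m) (ℕ.m+[n∸m]≡n (ℕ.≮⇒≥ q))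
      (new (x ∸ N) (ℕ.+-cancelˡ-< N (x ∸ N) m (subst (_< N + m) (≡-sym (ℕ.m+[n∸m]≡n (ℕ.≮⇒≥ q))) p)))

record Bounded (N j : ℕ) (L : ℕ → ℕ) : Set where
  constructor bounds
  field bound : ∀ {x} → x < N → L x < j
open Bounded

IsCore : ℕ → (ℕ → ℕ) → ℕ → Set
IsCore N L i = i < N × L i ≡ i × (∀ {x} → x < N → L x ≡ i → x ≡ i)

IsClass : ℕ → (ℕ → ℕ) → ℕ → ℕ → ℕ → Set
IsClass N L j t m = (∀ {i} → i < m → t + i < N × L (t + i) ≡ j) ×
                    (∀ {x} → x < N → L x ≡ j → ∃[ i ] (i < m × x ≡ t + i))

module Extend {N j : ℕ} {L : ℕ → ℕ} {m : ℕ} (B : Bounded N j L) where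

  bounded : Bounded (N + m) (suc j) (extend N L j)
  bounded .bound p with split N p
  ... | old q = subst (_< suc j) (≡-sym (extend-old {N} {L} {j} q)) (ℕ.m≤n⇒m≤1+n (bound B q))
  ... | new i q = subst (_< suc j) (≡-sym (extend-new {N} {L} i)) ℕ.≤-refl

  preimage : ∀ {x i} → i ≢ j → x < N + m → extend N L j x ≡ i → x < N × L x ≡ i
  preimage i≢j p e with split N p
  ... | old q   = q , trans (≡-sym (extend-old {N} {L} {j} q)) e
  ... | new i _ = ⊥-elim (i≢j (trans (≡-sym e) (extend-new {N} {L} i)))

  below : ∀ {x i} → x < N → L x ≡ i → i ≢ j
  below p refl e = ℕ.<⇒≢ (bound B p) e

  isCore : ∀ {i} → IsCore N L i → IsCore (N + m) (extend N L j) i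
  isCore (p , e , uniq) = ℕ.≤-trans p (ℕ.m≤m+n N m) , trans (extend-old {N} {L} {j} p) e ,
    λ q f → let q′ , f′ = preimage (below p e) q f in uniq q′ f′

  isClass : ∀ {j′ t m′} → j′ ≢ j → IsClass N L j′ t m′ → IsClass (N + m) (extend N L j) j′ t m′
  isClass ne (fwd , bwd) =
    (λ p → let q , e = fwd p in ℕ.≤-trans q (ℕ.m≤m+n N m) , trans (extend-old {N} {L} {j} q) e) ,
    λ p e → let q , e′ = preimage ne p e in bwd q e′

  newClass : IsClass (N + m) (extend N L j) j N m
  newClass = (λ {i} p → ℕ.+-monoʳ-< N p , extend-new {N} {L} i) , λ p e → inv p e
    where
      inv : ∀ {x} → x < N + m → extend N L j x ≡ j → ∃[ i ] (i < m × x ≡ N + i)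
      inv p e with split N p
      ... | old q   = ⊥-elim (ℕ.<⇒≢ (bound B q) (trans (≡-sym (extend-old {N} {L} {j} q)) e))
      ... | new i q = i , q , refl

hasEdge-++ : ∀ es fs x y → hasEdge (es ++ fs) x y ≡ hasEdge es x y ∨ hasEdge fs x y
hasEdge-++ []       fs x y = refl
hasEdge-++ ((a , b) ∷ es) fs x y rewrite hasEdge-++ es fs x y = ≡-sym (Bool.∨-assoc (matchᵇ a b x y) _ _)

-- Reads a template's edge list against the pattern's: an edge between core vertices stands for
-- itself, a block of `leaves` for a single pattern edge. `last` is a final block to which no
-- further list is appended.
data Expansion (N : ℕ) (L : ℕ → ℕ) : List (ℕ × ℕ) → List (ℕ × ℕ) → Set where
  []   : Expansion N L [] []
  edge : ∀ {a b es ps} → IsCore N L a → IsCore N L b → Expansion N L es ps →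
         Expansion N L ((a , b) ∷ es) ((a , b) ∷ ps)
  fan  : ∀ {c j t m es ps} → IsCore N L c → IsClass N L j t m → Expansion N L es ps →
         Expansion N L (leaves c t m ++ es) ((c , j) ∷ ps)
  last : ∀ {c j t m} → IsCore N L c → IsClass N L j t m → Expansion N L (leaves c t m) ((c , j) ∷ [])

core-eq : ∀ {N L a x} → IsCore N L a → x < N → eqℕ a x ≡ eqℕ a (L x)
core-eq {L = L} {a} {x} (_ , e , uniq) p = bool-ext
  (λ q → ≡⇒eqℕ (trans (≡-sym e) (cong L (eqℕ⇒≡ {a} {x} q))))
  (λ q → ≡⇒eqℕ (≡-sym (uniq p (≡-sym (eqℕ⇒≡ {a} {L x} q)))))

fan-eq : ∀ {N L c j t m x y} → IsCore N L c → IsClass N L j t m → x < N → y < N →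
         hasEdge (leaves c t m) x y ≡ matchᵇ c j (L x) (L y)
fan-eq {N} {L} {c} {j} {t} {m} {x} {y} (_ , ec , uniq) (fwd , bwd) p q =
    trans (bool-ext to from) (Bool.∨-identityʳ _)
  where
    leaf⁻ : ∀ {x y} → Any (Between x y) (leaves c t m) → x ≡ c × ∃[ i ] (i < m × y ≡ t + i)
    leaf⁻ k = let i , i∈ , e , f = find (Any.map⁻ k) in e , i , ∈-upTo⁻ i∈ , f
    leaf⁺ : ∀ {x y} → x < N → y < N → L x ≡ c → L y ≡ j → Any (Between x y) (leaves c t m)
    leaf⁺ p q e f = let i , i<m , g = bwd q f in Any.map⁺ (lose (∈-upTo⁺ i<m) (uniq p e , g))
    to : hasEdge (leaves c t m) x y ≡ true → hasEdge ((c , j) ∷ []) (L x) (L y) ≡ true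
    to h with hasEdge⁻ (leaves c t m) h
    ... | inj₁ k with leaf⁻ k
    ...   | refl , i , i<m , refl = hasEdge⁺ {(c , j) ∷ []} (here (ec , proj₂ (fwd i<m)))
    to h | inj₂ k with leaf⁻ k
    ...   | refl , i , i<m , refl = trans (hasEdge-sym ((c , j) ∷ []) (L x) (L y))
              (hasEdge⁺ {(c , j) ∷ []} (here (ec , proj₂ (fwd i<m))))
    from : hasEdge ((c , j) ∷ []) (L x) (L y) ≡ true → hasEdge (leaves c t m) x y ≡ true
    from h with hasEdge⁻ ((c , j) ∷ []) h
    ... | inj₁ (here (e , f)) = hasEdge⁺ (leaf⁺ p q e f)
    ... | inj₂ (here (e , f)) = trans (hasEdge-sym (leaves c t m) x y) (hasEdge⁺ (leaf⁺ q p e f))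

expansion-eq : ∀ {N L es ps} → Expansion N L es ps → ∀ {x y} → x < N → y < N →
               hasEdge es x y ≡ hasEdge ps (L x) (L y)
expansion-eq [] p q = refl
expansion-eq (edge ca cb E) p q =
  cong₂ _∨_ (cong₂ _∨_ (cong₂ _∧_ (core-eq ca p) (core-eq cb q)) (cong₂ _∧_ (core-eq ca q) (core-eq cb p)))
    (expansion-eq E p q)
expansion-eq (fan {c} {j} {t} {m} {es} cc cl E) {x} {y} p q =
  trans (hasEdge-++ (leaves c t m) es x y) (cong₂ _∨_ (fan-eq cc cl p q) (expansion-eq E p q))
expansion-eq (last cc cl) p q = trans (fan-eq cc cl p q) (≡-sym (Bool.∨-identityʳ _))

-- The counterpart of `Blowup` for a template, in which no vertex lies outside the pattern.
record Template (s q : ℕ) (ps : List (ℕ × ℕ)) (T : Graph) (L : ℕ → ℕ) : Set where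
  field
    bounded : Bounded (n T) q L
    single  : ∀ {x y} → x < n T → y < n T → L x ≡ L y → L x < s → x ≡ y
    adj-T   : ∀ x y → adj T x y ≡ hasEdge ps (L (toℕ x)) (L (toℕ y))

template : ∀ {s q N L es ps} → Bounded N q L → (∀ i → i < s → IsCore N L i) → Expansion N L es ps →
           {_ : True (Fin.all? {q} λ i → hasEdge ps (toℕ i) (toℕ i) Bool.≟ false)} →
           Template s q ps (fromEdges N es) L
template {s} {q} {N} {L} {es} {ps} B cores E {loopless} = record
  { bounded = B
  ; single  = λ {x} {y} p q e l → let _ , _ , uniq = cores (L x) l
                                  in trans (uniq p refl) (≡-sym (uniq q (≡-sym e)))
  ; adj-T   = λ x y → trans (noLoop x y) (expansion-eq E (Fin.toℕ<n x) (Fin.toℕ<n y))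
  }
  where
    -- `fromEdges` deletes loops; the pattern has none, so nothing is deleted here.
    noLoop : ∀ (x y : Fin N) → not (eqℕ (toℕ x) (toℕ y)) ∧ hasEdge es (toℕ x) (toℕ y) ≡ hasEdge es (toℕ x) (toℕ y)
    noLoop x y with bool? (eqℕ (toℕ x) (toℕ y))
    ... | inj₂ e rewrite e = refl
    ... | inj₁ e with refl ← eqF⇒≡ {x = x} {y} e rewrite e = ≡-sym (trans (expansion-eq E (Fin.toℕ<n x) (Fin.toℕ<n x))
            (subst (λ l → hasEdge ps l l ≡ false) (Fin.toℕ-fromℕ< (bound B (Fin.toℕ<n x)))
              (toWitness loopless (Fin.fromℕ< (bound B (Fin.toℕ<n x))))))

module Layout (s m₁ m₂ m₃ : ℕ) where
  N₁ N₂ N₃ : ℕ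
  N₁ = s + m₁
  N₂ = N₁ + m₂
  N₃ = N₂ + m₃

  L₁ L₂ L₃ : ℕ → ℕ
  L₁ = extend s id s
  L₂ = extend N₁ L₁ (suc s)
  L₃ = extend N₂ L₂ (suc (suc s))

  bounded₀ : Bounded s s id
  bounded₀ = bounds id

  module E₁ = Extend {m = m₁} bounded₀
  module E₂ = Extend {m = m₂} E₁.bounded
  module E₃ = Extend {m = m₃} E₂.bounded

  core₀ : ∀ i → i < s → IsCore s id i
  core₀ i p = p , refl , λ _ e → e

  core₁ : ∀ i → i < s → IsCore N₁ L₁ i
  core₁ i p = E₁.isCore (core₀ i p)

  core₂ : ∀ i → i < s → IsCore N₂ L₂ i
  core₂ i p = E₂.isCore (core₁ i p)

  core₃ : ∀ i → i < s → IsCore N₃ L₃ i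
  core₃ i p = E₃.isCore (core₂ i p)

doubleStarᴸ amaryllisᴸ shootingStarᴸ : ℕ → ℕ → ℕ → ℕ
vaseᴸ doubleVaseᴸ : ℕ → ℕ → ℕ
candyᴸ : ℕ → ℕ → ℕ → ℕ → ℕ
doubleStarᴸ m p   = Layout.L₂ 2 m p 0
vaseᴸ p           = Layout.L₁ 3 p 0 0
candyᴸ m a b      = Layout.L₃ 2 m a b
shootingStarᴸ m p = Layout.L₂ 4 m p 0
doubleVaseᴸ p     = Layout.L₁ 5 p 0 0
amaryllisᴸ m p    = Layout.L₂ 4 m p 0

doubleStar-template : ∀ m p → Template 2 4 doubleStarᵖ (doubleStar m p) (doubleStarᴸ m p)
doubleStar-template m p = template E₂.bounded core₂
  (edge (c 0 _) (c 1 _) (fan (c 0 _) (E₂.isClass (λ ()) E₁.newClass) (last (c 1 _) E₂.newClass)))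
  where
    open Layout 2 m p 0
    c : ∀ i → True (i ℕ.<? 2) → IsCore N₂ L₂ i
    c i w = core₂ i (toWitness w)

vase-template : ∀ p → Template 3 4 vaseᵖ (vase p) (vaseᴸ p)
vase-template p = template E₁.bounded core₁
  (edge (c 0 _) (c 1 _) (edge (c 1 _) (c 2 _) (edge (c 2 _) (c 0 _) (last (c 0 _) E₁.newClass))))
  where
    open Layout 3 p 0 0
    c : ∀ i → True (i ℕ.<? 3) → IsCore N₁ L₁ i
    c i w = core₁ i (toWitness w)

candy-template : ∀ m a b → Template 2 5 candyᵖ (candy m a b) (candyᴸ m a b)
candy-template m a b = template E₃.bounded core₃
  (fan (c 0 _) W (fan (c 1 _) W (fan (c 0 _) (E₃.isClass (λ ()) E₂.newClass) (last (c 1 _) E₃.newClass))))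
  where
    open Layout 2 m a b
    c : ∀ i → True (i ℕ.<? 2) → IsCore N₃ L₃ i
    c i w = core₃ i (toWitness w)
    W = E₃.isClass (λ ()) (E₂.isClass (λ ()) E₁.newClass)

shootingStar-template : ∀ m p → Template 4 6 shootingStarᵖ (shootingStar m p) (shootingStarᴸ m p)
shootingStar-template m p = template E₂.bounded core₂
  (edge (c 1 _) (c 0 _) (edge (c 0 _) (c 2 _) (edge (c 2 _) (c 3 _)
    (fan (c 1 _) (E₂.isClass (λ ()) E₁.newClass) (last (c 0 _) E₂.newClass)))))
  where
    open Layout 4 m p 0
    c : ∀ i → True (i ℕ.<? 4) → IsCore N₂ L₂ i
    c i w = core₂ i (toWitness w)

doubleVase-template : ∀ p → Template 5 6 doubleVaseᵖ (doubleVase p) (doubleVaseᴸ p)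
doubleVase-template p = template E₁.bounded core₁
  (edge (c 0 _) (c 1 _) (edge (c 1 _) (c 2 _) (edge (c 2 _) (c 0 _)
    (edge (c 0 _) (c 3 _) (edge (c 3 _) (c 4 _) (edge (c 4 _) (c 0 _) (last (c 0 _) E₁.newClass)))))))
  where
    open Layout 5 p 0 0
    c : ∀ i → True (i ℕ.<? 5) → IsCore N₁ L₁ i
    c i w = core₁ i (toWitness w)

amaryllis-template : ∀ m p → Template 4 6 amaryllisᵖ (amaryllis m p) (amaryllisᴸ m p)
amaryllis-template m p = template E₂.bounded core₂
  (edge (c 1 _) (c 0 _) (edge (c 0 _) (c 2 _) (edge (c 2 _) (c 3 _) (edge (c 3 _) (c 0 _)
    (fan (c 1 _) (E₂.isClass (λ ()) E₁.newClass) (last (c 0 _) E₂.newClass))))))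
  where
    open Layout 4 m p 0
    c : ∀ i → True (i ℕ.<? 4) → IsCore N₂ L₂ i
    c i w = core₂ i (toWitness w)

isolated-template : Template 1 1 [] K₁ id
isolated-template = template (bounds id) (λ i p → p , refl , λ _ e → e) []

-- From blow-ups to isomorphic copies of templates

record Enumeration {G : Graph} (lab : Fin (n G) → ℕ) (N j : ℕ) (L : ℕ → ℕ) : Set where
  field
    φ         : Fin N → Fin (n G)
    injective : Injective _≡_ _≡_ φ
    label     : ∀ x → lab (φ x) ≡ L (toℕ x)
    onto      : ∀ {v} → lab v < j → ∃[ x ] φ x ≡ v

class-size : ∀ {G : Graph} → (Fin (n G) → ℕ) → ℕ → ℕ
class-size lab j = count (λ v → eqℕ (lab v) j)

-- Appends the vertices of label j just where the template numbers its class of label j, so that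
-- labels agree by construction.
enumerate-next : ∀ {G : Graph} {lab : Fin (n G) → ℕ} {N j L} → Bounded N j L → Enumeration {G} lab N j L →
                 Enumeration {G} lab (N + class-size {G} lab j) (suc j) (extend N L j)
enumerate-next {G} {lab} {N} {j} {L} B E = record
  { φ = λ x → [ φ , pick ]′ (Fin.splitAt N x)
  ; injective = λ {x} {y} e → trans (≡-sym (Fin.join-splitAt N m x))
      (trans (cong (Fin.join N m) (inj (Fin.splitAt N x) (Fin.splitAt N y) e)) (Fin.join-splitAt N m y))
  ; label = λ x → subst (λ z → lab ([ φ , pick ]′ (Fin.splitAt N x)) ≡ extend N L j (toℕ z))
      (Fin.join-splitAt N m x) (lab-eq (Fin.splitAt N x))
  ; onto = ont
  }
  where
    open Enumeration E
    m = class-size {G} lab j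
    P = λ v → eqℕ (lab v) j
    pick : Fin m → Fin (n G)
    pick = enum P
    pick-lab : ∀ i → lab (pick i) ≡ j
    pick-lab i = eqℕ⇒≡ (enum-sound P i)
    clash : ∀ x i → φ x ≢ pick i
    clash x i e = ℕ.<⇒≢ (bound B (Fin.toℕ<n x)) (trans (≡-sym (label x)) (trans (cong lab e) (pick-lab i)))
    inj : ∀ (a b : Fin N ⊎ Fin m) → [ φ , pick ]′ a ≡ [ φ , pick ]′ b → a ≡ b
    inj (inj₁ x) (inj₁ y) e = cong inj₁ (injective e)
    inj (inj₁ x) (inj₂ i) e = ⊥-elim (clash x i e)
    inj (inj₂ i) (inj₁ x) e = ⊥-elim (clash x i (≡-sym e))
    inj (inj₂ i) (inj₂ k) e = cong inj₂ (enum-injective P e)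
    lab-eq : ∀ a → lab ([ φ , pick ]′ a) ≡ extend N L j (toℕ (Fin.join N m a))
    lab-eq (inj₁ x) = trans (label x) (trans (≡-sym (extend-old {N} {L} {j} (Fin.toℕ<n x)))
      (cong (extend N L j) (≡-sym (Fin.toℕ-↑ˡ x m))))
    lab-eq (inj₂ i) = trans (pick-lab i) (trans (≡-sym (extend-new {N} {L} (toℕ i)))
      (cong (extend N L j) (≡-sym (Fin.toℕ-↑ʳ N i))))
    ont : ∀ {v} → lab v < suc j → ∃[ x ] [ φ , pick ]′ (Fin.splitAt N x) ≡ v
    ont {v} p with ℕ.m≤n⇒m<n∨m≡n (ℕ.≤-pred p)
    ... | inj₁ q = let x , e = onto q in Fin.join N m (inj₁ x) ,
                     trans (cong [ φ , pick ]′ (Fin.splitAt-join N m (inj₁ x))) e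
    ... | inj₂ q = let i , e = enum-complete P v (≡⇒eqℕ q) in Fin.join N m (inj₂ i) ,
                     trans (cong [ φ , pick ]′ (Fin.splitAt-join N m (inj₂ i))) e

enumerate-core : ∀ {G s q es} (B : Blowup G s q es) → Enumeration {G} (Blowup.lab B) s s id
enumerate-core B = record
  { φ = core
  ; injective = λ {i} {j} e → Fin.toℕ-injective (trans (≡-sym (lab-core i)) (trans (cong lab e) (lab-core j)))
  ; label = lab-core
  ; onto = λ p → Fin.fromℕ< p , ≡-sym (core-uniq _ (≡-sym (Fin.toℕ-fromℕ< p)))
  }
  where open Blowup B

-- On both sides adjacency depends on the labels alone, so a bijection that respects labels is an
-- isomorphism.
compIso : ∀ {G s q es u T L} (B : Blowup G s q es) → Around B u → Template s q es T L →
          Enumeration {G} (Blowup.lab B) (n T) q L → CompIso G u T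
compIso {es = es} {T = T} {L} B (i , around) T-is E = φ , injective ,
    (λ x y → trans (adj-T x y) (trans (≡-sym (cong₂ (hasEdge es) (label x) (label y))) (≡-sym (adj-lab (inside x) (inside y))))) ,
    (λ x → around (inside x)) , (λ v r → onto (reach-inside B i r))
  where
    open Blowup B
    open Enumeration E
    open Template T-is
    inside : ∀ x → Inside (φ x)
    inside x = subst (_< _) (≡-sym (label x)) (bound bounded (Fin.toℕ<n x))

module Iso {G : Graph} {s q : ℕ} {es : List (ℕ × ℕ)} (B : Blowup G s q es) where
  open Blowup B using (lab)

  size : ℕ → ℕ
  size = class-size {G} lab

  open Layout s (size s) (size (suc s)) (size (suc (suc s))) public

  enum₁ = enumerate-next bounded₀ (enumerate-core B)
  enum₂ = enumerate-next E₁.bounded enum₁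
  enum₃ = enumerate-next E₂.bounded enum₂

small-iso : ∀ {G u} → SmallComponent G u → IsDoubleStarComp G u ⊎ IsVaseComp G u ⊎ IsIsolatedComp G u
small-iso (isDoubleStar B a) = inj₁ (Iso.size B 2 , Iso.size B 3 , compIso B a (doubleStar-template _ _) (Iso.enum₂ B))
small-iso (isVase B a)       = inj₂ (inj₁ (_ , compIso B a (vase-template _) (Iso.enum₁ B)))
small-iso (isIsolated B a)   = inj₂ (inj₂ (compIso B a isolated-template (enumerate-core B)))

only-structure : ∀ {G s q es} (C : OnlyComponent G s q es) →
  (∀ u → OnlyComponent.Inside C u → IsPermittedComp G u) → Structure G
only-structure {G} C f = inj₂ ((λ u v p q → proj₂ (around (inside p)) (inside q)) , λ u p → f u (inside p))
  where
    open OnlyComponent C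
    inside : ∀ {u} → Nontrivial G u → Inside u
    inside (x , y , here , a)     = full a
    inside (x , y , step b _ , _) = full b

shape⇒structure : ∀ {G} → Shape G → Structure G
shape⇒structure (small comp) = inj₁ (small-iso ∘ comp)
shape⇒structure {G} (isCandy C (w , aw , bw)) = only-structure C λ u i →
    inj₂ (inj₂ (inj₁ (Iso.size blowup 2 , Iso.size blowup 3 , Iso.size blowup 4 , count-pos⁺ {x = w} (≡⇒eqℕ lab-w) ,
      compIso blowup (around i) (candy-template _ _ _) (Iso.enum₃ blowup))))
  where
    open OnlyComponent C
    lab-w : lab w ≡ 2
    lab-w = case (near aw (full aw) (lab-core 0F) , near bw (full bw) (lab-core 1F)) of λ where
      (here e , _) → e
      (there (here _) , here e) → e
      (there (here e) , there (here f)) → case trans (≡-sym e) f of λ ()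
shape⇒structure (isShootingStar C) = only-structure C λ u i →
    inj₂ (inj₂ (inj₂ (inj₁ (Iso.size blowup 4 , Iso.size blowup 5 , compIso blowup (around i) (shootingStar-template _ _) (Iso.enum₂ blowup)))))
  where open OnlyComponent C
shape⇒structure (isDoubleVase C) = only-structure C λ u i →
    inj₂ (inj₂ (inj₂ (inj₂ (inj₁ (_ , compIso blowup (around i) (doubleVase-template _) (Iso.enum₁ blowup))))))
  where open OnlyComponent C
shape⇒structure (isAmaryllis C) = only-structure C λ u i →
    inj₂ (inj₂ (inj₂ (inj₂ (inj₂ (Iso.size blowup 4 , Iso.size blowup 5 , compIso blowup (around i) (amaryllis-template _ _) (Iso.enum₂ blowup))))))
  where open OnlyComponent C

-- Searching for a labelling of a forbidden graph by a pattern

anyBelow : ℕ → (ℕ → Bool) → Bool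
anyBelow zero    P = false
anyBelow (suc q) P = P q ∨ anyBelow q P

anyBelow⁺ : ∀ {q P l} → l < q → P l ≡ true → anyBelow q P ≡ true
anyBelow⁺ {suc q} {P} {l} p e with ℕ.m≤n⇒m<n∨m≡n (ℕ.≤-pred p)
... | inj₁ l<q  = ∨-introʳ (P q) (anyBelow⁺ {q} {P} l<q e)
... | inj₂ refl = ∨-introˡ _ e

module Search (es : List (ℕ × ℕ)) (s q : ℕ) (ps : List (ℕ × ℕ)) where

  -- The list holds the labels of the vertices i − 1, …, 0.
  compatible : ℕ → ℕ → List ℕ → Bool
  compatible i l []       = true
  compatible i l (k ∷ ks) =
    (not (hasEdge es (length ks) i) ∨ hasEdge ps k l) ∧ (not (eqℕ k l ∧ (k ℕ.<ᵇ s)) ∧ compatible i l ks)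

  -- Backtracking over the labels of the next r vertices. The value `false` rules out every
  -- labelling, by `search⁺`.
  search : ℕ → ℕ → List ℕ → Bool
  search zero    i ks = true
  search (suc r) i ks = anyBelow q λ l → compatible i l ks ∧ search r (suc i) (l ∷ ks)

  -- What remains of an embedding into a template once class sizes are forgotten: a homomorphism to
  -- the pattern that is injective on core labels. This makes the question finite for all parameters
  -- at once.
  record Labelling (N : ℕ) (f : ℕ → ℕ) : Set where
    field
      range  : ∀ {i} → i < N → f i < q
      edges  : ∀ {i j} → i < j → j < N → hasEdge es i j ≡ true → hasEdge ps (f i) (f j) ≡ true
      single : ∀ {i j} → i < j → j < N → f i ≡ f j → f i < s → ⊥

  module _ {N : ℕ} {f : ℕ → ℕ} (ℓ : Labelling N f) where
    open Labelling ℓ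

    prefix : ℕ → List ℕ
    prefix zero    = []
    prefix (suc i) = f i ∷ prefix i

    length-prefix : ∀ i → length (prefix i) ≡ i
    length-prefix zero    = refl
    length-prefix (suc i) = cong suc (length-prefix i)

    compatible⁺ : ∀ {i} j → j ≤ i → i < N → compatible i (f i) (prefix j) ≡ true
    compatible⁺ zero    _ _ = refl
    compatible⁺ {i} (suc j) j<i i<N rewrite length-prefix j =
      ∧-intro hom (∧-intro distinct (compatible⁺ j (ℕ.<⇒≤ j<i) i<N))
      where
        hom : not (hasEdge es j i) ∨ hasEdge ps (f j) (f i) ≡ true
        hom with bool? (hasEdge es j i)
        ... | inj₁ e rewrite e = edges j<i i<N e
        ... | inj₂ e rewrite e = refl
        distinct : not (eqℕ (f j) (f i) ∧ (f j ℕ.<ᵇ s)) ≡ true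
        distinct with bool? (eqℕ (f j) (f i) ∧ (f j ℕ.<ᵇ s))
        ... | inj₂ e rewrite e = refl
        ... | inj₁ e = let a , b = ∧-true e in
              ⊥-elim (single j<i i<N (eqℕ⇒≡ a) (ℕ.<ᵇ⇒< (f j) s (subst Data.Bool.T (≡-sym b) _)))

    search⁺ : ∀ r i → i + r ≡ N → search r i (prefix i) ≡ true
    search⁺ zero    i e = refl
    search⁺ (suc r) i e = anyBelow⁺ {q} (range i<N)
        (∧-intro (compatible⁺ i ℕ.≤-refl i<N) (search⁺ r (suc i) (trans (≡-sym (ℕ.+-suc i r)) e)))
      where
        i<N : i < N
        i<N = ℕ.≤-trans (s≤s (ℕ.m≤m+n i r)) (ℕ.≤-reflexive (trans (≡-sym (ℕ.+-suc i r)) e))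

module _ {G : Graph} {N : ℕ} {es : List (ℕ × ℕ)} {u : Fin (n G)} {T : Graph}
  {s q : ℕ} {ps : List (ℕ × ℕ)} {L : ℕ → ℕ}
  (T-is : Template s q ps T L) (iso : CompIso G u T)
  (sub : EdgeSub (fromEdges N es) G) (reach : ∀ x → Reach G u (proj₁ sub x)) where
  open Template T-is
  open Search es s q ps

  -- The copy lies in the component, so its vertices can be pulled back along the isomorphism; their
  -- labels in the template form a `Labelling`.
  no-copy : search N 0 [] ≡ false → ⊥
  no-copy e = true≢false (search⁺ labelling N 0 refl) e
    where
      φ = proj₁ iso
      ψ = proj₁ sub
      ψ-inj = proj₁ (proj₂ sub)
      ψ-adj = proj₁ (proj₂ (proj₂ sub))
      back : ∀ x → ∃[ z ] φ z ≡ ψ x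
      back x = proj₂ (proj₂ (proj₂ (proj₂ iso))) (ψ x) (reach x)
      f : ℕ → ℕ
      f i with i ℕ.<? N
      ... | yes p = L (toℕ (proj₁ (back (Fin.fromℕ< p))))
      ... | no _  = 0
      at : ∀ {i} → i < N → ∃[ x ] (toℕ x ≡ i × f i ≡ L (toℕ (proj₁ (back x))))
      at {i} p with i ℕ.<? N
      ... | yes p′ = Fin.fromℕ< p′ , Fin.toℕ-fromℕ< p′ , refl
      ... | no ¬p  = ⊥-elim (¬p p)
      labelling : Labelling N f
      labelling = record
        { range = λ p → let x , _ , e = at p in subst (_< q) (≡-sym e) (Bounded.bound bounded (Fin.toℕ<n _))
        ; edges = λ {i} {j} i<j j<N h →
            let x , ex , fx = at (ℕ.<-trans i<j j<N)
                y , ey , fy = at j<N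
                x̂ , px = back x
                ŷ , py = back y
                x≢y : eqℕ (toℕ x) (toℕ y) ≡ false
                x≢y = ≢true λ c → ℕ.<⇒≢ i<j (trans (≡-sym ex) (trans (eqℕ⇒≡ {toℕ x} {toℕ y} c) ey))
                xy : adj (fromEdges N es) x y ≡ true
                xy = trans (cong (λ b → not b ∧ hasEdge es (toℕ x) (toℕ y)) x≢y)
                       (trans (cong₂ (hasEdge es) ex ey) h)
            in trans (cong₂ (hasEdge ps) fx fy) (trans (≡-sym (adj-T x̂ ŷ))
                 (trans (proj₁ (proj₂ (proj₂ iso)) x̂ ŷ) (trans (cong₂ (adj G) px py) (ψ-adj x y xy))))
        ; single = λ {i} {j} i<j j<N e l →
            let x , ex , fx = at (ℕ.<-trans i<j j<N)
                y , ey , fy = at j<N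
                x̂ , px = back x
                ŷ , py = back y
                same : x̂ ≡ ŷ
                same = Fin.toℕ-injective (single (Fin.toℕ<n x̂) (Fin.toℕ<n ŷ)
                  (trans (≡-sym fx) (trans e fy)) (subst (_< s) fx l))
                x≡y : x ≡ y
                x≡y = ψ-inj (trans (≡-sym px) (trans (cong φ same) py))
            in ℕ.<⇒≢ i<j (trans (≡-sym ex) (trans (cong toℕ x≡y) ey))
        }

-- Permitted graphs contain no forbidden subgraph

Absent : ℕ → List (ℕ × ℕ) → ℕ → ℕ → List (ℕ × ℕ) → Set
Absent N es s q ps = Search.search es s q ps N 0 [] ≡ false

record AbsentFromSmall (N : ℕ) (es : List (ℕ × ℕ)) : Set where
  constructor absent
  field
    doubleStars : Absent N es 2 4 doubleStarᵖ
    vases       : Absent N es 3 4 vaseᵖ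
    isolated    : Absent N es 1 1 []

record AbsentFromLarge (N : ℕ) (es : List (ℕ × ℕ)) : Set where
  constructor absent
  field
    doubleStars   : Absent N es 2 4 doubleStarᵖ
    vases         : Absent N es 3 4 vaseᵖ
    candies       : Absent N es 2 5 candyᵖ
    shootingStars : Absent N es 4 6 shootingStarᵖ
    doubleVases   : Absent N es 5 6 doubleVaseᵖ
    amaryllises   : Absent N es 4 6 amaryllisᵖ

map-reach : ∀ {F G} (e : EdgeSub F G) → ∀ {x y} → Reach F x y → Reach G (proj₁ e x) (proj₁ e y)
map-reach e here = here
map-reach e@(_ , _ , pres , _) (step a r) = step (pres _ _ a) (map-reach e r)

-- A connected graph is mapped into a single component, that of the image of vertex 0.
not-small : ∀ {G} N es → (∀ u → IsDoubleStarComp G u ⊎ IsVaseComp G u ⊎ IsIsolatedComp G u) →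
            AbsentFromSmall (suc N) es → (∀ x → Reach (fromEdges (suc N) es) 0F x) → ¬ EdgeSub (fromEdges (suc N) es) G
not-small {G} N es comps (absent a₁ a₂ a₃) conn e@(ψ , _) with comps (ψ 0F)
... | inj₁ (m , p , i)       = no-copy (doubleStar-template m p) i e (map-reach e ∘ conn) a₁
... | inj₂ (inj₁ (p , i))    = no-copy (vase-template p) i e (map-reach e ∘ conn) a₂
... | inj₂ (inj₂ i)          = no-copy isolated-template i e (map-reach e ∘ conn) a₃

-- The forbidden graphs have no isolated vertices, so a copy, connected or not, lies entirely in the
-- one nontrivial component.
not-large : ∀ {G} N es → (∀ u v → Nontrivial G u → Nontrivial G v → Reach G u v) →
            (∀ u → Nontrivial G u → IsPermittedComp G u) → AbsentFromLarge (suc N) es →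
            ¬ EdgeSub (fromEdges (suc N) es) G
not-large {G} N es one comps (absent a₁ a₂ a₃ a₄ a₅ a₆) e@(ψ , _ , pres , cov) = go (comps (ψ 0F) (nontrivial 0F))
  where
    nontrivial : ∀ x → Nontrivial G (ψ x)
    nontrivial x = let y , p = cov x in ψ x , ψ y , here , pres x y p
    reach : ∀ x → Reach G (ψ 0F) (ψ x)
    reach x = one _ _ (nontrivial 0F) (nontrivial x)
    go : IsPermittedComp G (ψ 0F) → ⊥
    go (inj₁ (m , p , i))                                   = no-copy (doubleStar-template m p) i e reach a₁
    go (inj₂ (inj₁ (p , i)))                                = no-copy (vase-template p) i e reach a₂
    go (inj₂ (inj₂ (inj₁ (m , a , b , _ , i))))             = no-copy (candy-template m a b) i e reach a₃
    go (inj₂ (inj₂ (inj₂ (inj₁ (m , p , i)))))              = no-copy (shootingStar-template m p) i e reach a₄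
    go (inj₂ (inj₂ (inj₂ (inj₂ (inj₁ (p , i))))))           = no-copy (doubleVase-template p) i e reach a₅
    go (inj₂ (inj₂ (inj₂ (inj₂ (inj₂ (m , p , i))))))       = no-copy (amaryllis-template m p) i e reach a₆

contains : ∀ (F : Graph) {N} es (xs : Vec (Fin (n F)) (suc N)) {_ : True (covered? (suc N) es)} {_ : True (distinct? xs)} →
           All (λ (a , b) → adj F (nth xs a) (nth xs b) ≡ true) es → EdgeSub (fromEdges (suc N) es) F
contains F es xs {w} {w′} ps = embed {F} es xs {w} (λ {i} {j} → toWitness w′ i j) ps

-- With several small components a disconnected forbidden graph could be spread over them. But each
-- of the seven graphs contains P₅ or C₄, which are connected and occur in no small component.
structure⇒noForbidden : ∀ G → Structure G → NoForbidden G
structure⇒noForbidden G (inj₂ (one , comps)) =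
  large 6 path₅+edgeᵉ (absent refl refl refl refl refl refl) ,
  large 5 cycle₄+edgeᵉ (absent refl refl refl refl refl refl) ,
  large 5 path₆ᵉ (absent refl refl refl refl refl refl) ,
  large 4 cycle₅ᵉ (absent refl refl refl refl refl refl) ,
  large 4 bullᵉ (absent refl refl refl refl refl refl) ,
  large 3 diamondᵉ (absent refl refl refl refl refl refl) ,
  large 7 caterpillarᵉ (absent refl refl refl refl refl refl)
  where
    large : ∀ N es → AbsentFromLarge (suc N) es → ¬ EdgeSub (fromEdges (suc N) es) G
    large N es = not-large N es one comps
structure⇒noForbidden G (inj₁ comps) =
    (λ e → ¬P₅ (via P5∪P2 {P₅} e (contains P5∪P2 path₅ᵉ (0F ∷ 1F ∷ 2F ∷ 3F ∷ 4F ∷ []) (refl ∷ refl ∷ refl ∷ refl ∷ [])))) ,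
    (λ e → ¬C₄ (via C4∪P2 {C₄} e (contains C4∪P2 cycle₄ᵉ (0F ∷ 1F ∷ 2F ∷ 3F ∷ []) (refl ∷ refl ∷ refl ∷ refl ∷ [])))) ,
    (λ e → ¬P₅ (via P6 {P₅} e (contains P6 path₅ᵉ (0F ∷ 1F ∷ 2F ∷ 3F ∷ 4F ∷ []) (refl ∷ refl ∷ refl ∷ refl ∷ [])))) ,
    (λ e → ¬P₅ (via C5 {P₅} e (contains C5 path₅ᵉ (0F ∷ 1F ∷ 2F ∷ 3F ∷ 4F ∷ []) (refl ∷ refl ∷ refl ∷ refl ∷ [])))) ,
    (λ e → ¬P₅ (via bull {P₅} e (contains bull path₅ᵉ (3F ∷ 0F ∷ 2F ∷ 1F ∷ 4F ∷ []) (refl ∷ refl ∷ refl ∷ refl ∷ [])))) ,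
    (λ e → ¬C₄ (via diamond {C₄} e (contains diamond cycle₄ᵉ (0F ∷ 2F ∷ 1F ∷ 3F ∷ []) (refl ∷ refl ∷ refl ∷ refl ∷ [])))) ,
    (λ e → ¬P₅ (via F₁ {P₅} e (contains F₁ path₅ᵉ (4F ∷ 2F ∷ 0F ∷ 3F ∷ 6F ∷ []) (refl ∷ refl ∷ refl ∷ refl ∷ []))))
  where
    via : ∀ F {H} → EdgeSub F G → EdgeSub H F → EdgeSub H G
    via F {H} e f = EdgeSub-trans {H} {F} {G} f e
    ¬P₅ : ¬ EdgeSub P₅ G
    ¬P₅ = not-small 4 path₅ᵉ comps (absent refl refl refl) λ where
      0F → here
      1F → step {v = 1F} refl here
      2F → step {v = 1F} refl (step {v = 2F} refl here)
      3F → step {v = 1F} refl (step {v = 2F} refl (step {v = 3F} refl here))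
      4F → step {v = 1F} refl (step {v = 2F} refl (step {v = 3F} refl (step {v = 4F} refl here)))
    ¬C₄ : ¬ EdgeSub C₄ G
    ¬C₄ = not-small 3 cycle₄ᵉ comps (absent refl refl refl) λ where
      0F → here
      1F → step {v = 1F} refl here
      2F → step {v = 1F} refl (step {v = 2F} refl here)
      3F → step {v = 3F} refl here

anyF allF : ∀ {m} → (Fin m → Bool) → Bool
anyF {zero}  P = false
anyF {suc m} P = P zero ∨ anyF (P ∘ suc)
allF {zero}  P = true
allF {suc m} P = P zero ∧ allF (P ∘ suc)

anyF⁻ : ∀ {m} {P : Fin m → Bool} → anyF P ≡ true → ∃[ x ] P x ≡ true
anyF⁻ {suc m} {P} e with ∨-true {P zero} e
... | inj₁ p = zero , p
... | inj₂ q = let x , p = anyF⁻ {P = P ∘ suc} q in suc x , p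

allF⁻ : ∀ {m} {P : Fin m → Bool} → allF P ≡ true → ∀ x → P x ≡ true
allF⁻ {suc m} {P} e zero    = proj₁ (∧-true {P zero} e)
allF⁻ {suc m} {P} e (suc x) = allF⁻ {P = P ∘ suc} (proj₂ (∧-true {P zero} e)) x

-- Positions won by Bob, by exhaustive search to bounded depth

module Refute (F : Graph) (k : ℕ) where
  open Game F k

  hasColour : Fin k → Maybe (Fin k) → Bool
  hasColour j nothing  = false
  hasColour j (just i) = eqF i j

  hasColour⁻ : ∀ {j m} → hasColour j m ≡ true → m ≡ just j
  hasColour⁻ {j} {just i} e = cong just (eqF⇒≡ {x = i} {j} e)

  hasColour⁺ : ∀ {j m} → m ≡ just j → hasColour j m ≡ true
  hasColour⁺ {j} refl = ≡⇒eqF {x = j} refl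

  at : Col → V → Fin k → Bool
  at c x j = anyF λ w → hasColour j (c x w)

  dead : Col → V → V → Bool
  dead c u v = adj F u v ∧ (isNone (c u v) ∧ allF λ j → at c u j ∨ at c v j)

  lost : Col → Bool
  lost c = anyF λ u → anyF λ v → dead c u v

  playable : Col → V → V → Fin k → Bool
  playable c u v j = adj F u v ∧ (isNone (c u v) ∧ (not (at c u j) ∧ not (at c v j)))

  set : Col → V → V → Fin k → Col
  set = setCol {F}

  -- The number d bounds Bob's remaining moves, and each edge is tried in one orientation only. A
  -- position is recognised as lost when some open edge has no legal colour left.
  bobWins aliceLoses : ℕ → Col → Bool
  bobWins zero    c = lost c
  bobWins (suc d) c = lost c ∨ anyF λ u → anyF λ v → anyF λ j →
    (toℕ u ℕ.<ᵇ toℕ v) ∧ (playable c u v j ∧ aliceLoses d (set c u v j))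
  -- An open edge is demanded because Alice has won, although she has no move, when everything is
  -- coloured.
  aliceLoses d c = lost c ∨ ((anyF λ u → anyF λ v → uncolouredAt c u v) ∧ allF λ u → allF λ v → allF λ j →
    not (toℕ u ℕ.<ᵇ toℕ v) ∨ (not (playable c u v j) ∨ bobWins d (set c u v j)))

  Dead : Col → V → V → Set
  Dead c u v = Adj u v × c u v ≡ nothing × ∀ j → seen c u j ≡ true ⊎ seen c v j ≡ true

  at⇒seen : ∀ {c x j} → at c x j ≡ true → seen c x j ≡ true
  at⇒seen {c} {x} {j} e = let w , p = anyF⁻ {P = λ w → hasColour j (c x w)} e in seen⁺ (hasColour⁻ p)

  dead⁻ : ∀ {c u v} → dead c u v ≡ true → Dead c u v
  dead⁻ {c} {u} {v} e =
    let a , r = ∧-true {adj F u v} e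
        b , t = ∧-true {isNone (c u v)} r
    in a , isNone⁻ b , λ j → Sum.map (at⇒seen {c}) (at⇒seen {c}) (∨-true {at c u j} (allF⁻ t j))

  -- No colour is legal on a dead edge, so the move is on another edge, and blocked colours stay
  -- blocked.
  dead-step : ∀ {c u v x y j} → Valid c → Dead c u v → Leg c x y j → Dead (upd c x y j) u v
  dead-step {c} {u} {v} {x} {y} {j} val (a , e , blocked) leg =
      a , trans (upd-miss {c} miss₁ miss₂) e , λ i → Sum.map seen-mono seen-mono (blocked i)
    where
      open Move val leg
      miss₁ : ¬ (u ≡ x × v ≡ y)
      miss₁ (refl , refl) = case blocked j of λ where
        (inj₁ s) → true≢false s (unseen-before (inj₁ refl))
        (inj₂ s) → true≢false s (unseen-before (inj₂ refl))
      miss₂ : ¬ (u ≡ y × v ≡ x)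
      miss₂ (refl , refl) = case blocked j of λ where
        (inj₁ s) → true≢false s (unseen-before (inj₂ refl))
        (inj₂ s) → true≢false s (unseen-before (inj₁ refl))

  valid-set : ∀ {c u v j} → Valid c → Leg c u v j → Valid (set c u v j)
  valid-set {c} {u} {v} {j} val leg = subst Valid (upd-def c u v j) (Move.valid′ val leg)

  dead-loses : ∀ {c p u v} → Valid c → Dead c u v → ¬ Wins c p
  dead-loses {u = u} {v} val (a , e , _) (finished f) = case trans (≡-sym e) (proj₂ (f u v a)) of λ ()
  dead-loses {c} {u = u} {v} val d (aliceMoves x y j leg w) =
    dead-loses (valid-set val leg) (subst (λ c′ → Dead c′ u v) (upd-def c x y j) (dead-step val d leg)) w
  dead-loses {c} {u = u} {v} val d (bobMoves (x , y , j , leg) f) =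
    dead-loses (valid-set val leg) (subst (λ c′ → Dead c′ u v) (upd-def c x y j) (dead-step val d leg)) (f x y j leg)

  lost-loses : ∀ {c p} → Valid c → lost c ≡ true → ¬ Wins c p
  lost-loses {c} val e w =
    let u , p = anyF⁻ {P = λ u → anyF λ v → dead c u v} e
        v , q = anyF⁻ {P = λ v → dead c u v} p
    in dead-loses val (dead⁻ {c} q) w

  playable⁻ : ∀ {c u v j} → playable c u v j ≡ true → Leg c u v j
  playable⁻ {c} {u} {v} {j} e =
    let a , r = ∧-true {adj F u v} e
        b , t = ∧-true {isNone (c u v)} r
        p , q = ∧-true {not (at c u j)} t
    in a , isNone⁻ b , absent-at {u} (not-true p) , absent-at {v} (not-true q)
    where
      absent-at : ∀ {x} → at c x j ≡ false → ∀ w → c x w ≢ just j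
      absent-at {x} f w g = true≢false (present w) f
        where
          anyF⁺ : ∀ {m} {P : Fin m → Bool} x → P x ≡ true → anyF P ≡ true
          anyF⁺ zero    p = ∨-introˡ _ p
          anyF⁺ {P = P} (suc x) p = ∨-introʳ (P zero) (anyF⁺ x p)
          present : ∀ w → at c x j ≡ true
          present _ = anyF⁺ {P = λ w → hasColour j (c x w)} w (hasColour⁺ g)

  playable⁺ : ∀ {c u v j} → Leg c u v j → playable c u v j ≡ true
  playable⁺ {c} {u} {v} {j} (a , e , f , g) rewrite a | e =
    ∧-intro (cong not (absent-at {u} f)) (cong not (absent-at {v} g))
    where
      absent-at : ∀ {x} → (∀ w → c x w ≢ just j) → at c x j ≡ false
      absent-at {x} f = ≢true λ p → let w , q = anyF⁻ {P = λ w → hasColour j (c x w)} p in f w (hasColour⁻ q)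

  bobWins-sound : ∀ d {c} → Valid c → bobWins d c ≡ true → ¬ Wins c bob
  aliceLoses-sound : ∀ d {c} → Valid c → aliceLoses d c ≡ true → ¬ Wins c alice
  bobWins-sound zero val e = lost-loses val e
  bobWins-sound (suc d) {c} val e w with ∨-true {lost c} e
  ... | inj₁ l = lost-loses val l w
  ... | inj₂ r with anyF⁻ r
  ...   | u , r₁ with anyF⁻ r₁
  ...     | v , r₂ with anyF⁻ r₂
  ...       | j , r₃ with ∧-true {toℕ u ℕ.<ᵇ toℕ v} r₃
  ...         | _ , r₄ with ∧-true {playable c u v j} r₄
  ...           | p , q = win w
    where
      leg = playable⁻ {c} p
      win : ¬ Wins c bob
      win (finished f)   = case trans (≡-sym (proj₁ (proj₂ leg))) (proj₂ (f u v (proj₁ leg))) of λ ()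
      win (bobMoves _ f) = aliceLoses-sound d (valid-set val leg) q (f u v j leg)
  aliceLoses-sound d {c} val e w with ∨-true {lost c} e
  ... | inj₁ l = lost-loses val l w
  ... | inj₂ r with ∧-true {anyF λ u → anyF λ v → uncolouredAt c u v} r
  ...   | o , all = fails w
    where
      reply : ∀ u v j → toℕ u < toℕ v → Leg c u v j → bobWins d (set c u v j) ≡ true
      reply u v j lt leg with ∨-true {not (toℕ u ℕ.<ᵇ toℕ v)} (allF⁻ (allF⁻ (allF⁻ all u) v) j)
      ... | inj₁ n = ⊥-elim (subst Data.Bool.T (not-true n) (ℕ.<⇒<ᵇ lt))
      ... | inj₂ s with ∨-true {not (playable c u v j)} s
      ...   | inj₁ n = ⊥-elim (true≢false (playable⁺ {c} leg) (not-true n))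
      ...   | inj₂ b = b
      fails : ¬ Wins c alice
      fails (finished f) =
        let u , p = anyF⁻ {P = λ u → anyF λ v → uncolouredAt c u v} o
            v , q = anyF⁻ {P = λ v → uncolouredAt c u v} p
            a , n = uncolouredAt⁻ {c} q
        in case trans (≡-sym n) (proj₂ (f u v a)) of λ ()
      fails (aliceMoves u v j leg w) with ℕ.<-cmp (toℕ u) (toℕ v)
      ... | tri< lt _ _ = bobWins-sound d (valid-set val leg) (reply u v j lt leg) w
      ... | tri≈ _ eq _ = Move.u≢v val leg (Fin.toℕ-injective eq)
      ... | tri> _ _ gt = let leg′ = legal-swap {c} val leg in
              bobWins-sound d (valid-set val leg′) (reply v u j gt leg′)
                (wins-ext (λ x y → trans (cong (λ f → f x y) (≡-sym (upd-def c u v j)))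
                  (trans (upd-swap {c} u v j x y) (cong (λ f → f x y) (upd-def c v u j)))) w)

  bob-wins : ∀ d → bobWins d ∅ ≡ true → ¬ AliceWinsBminus F k
  bob-wins d e = bobWins-sound d valid-∅ e

-- The forbidden graphs are not perfect

module _ (F : Graph) (w : ℕ) (c : Colouring F w) where

  proper? : Dec ((∀ x y → c x y ≡ c y x) ×
                 (∀ x y z → c x y ≢ nothing → c x y ≡ c x z → y ≡ z) ×
                 (∀ x y → adj F x y ≡ true → c x y ≢ nothing))
  proper? = (Fin.all? λ x → Fin.all? λ y → eq? (c x y) (c y x))
    ×-dec (Fin.all? λ x → Fin.all? λ y → Fin.all? λ z →
             ¬? (eq? (c x y) nothing) →-dec (eq? (c x y) (c x z) →-dec (y Fin.≟ z)))
    ×-dec (Fin.all? λ x → Fin.all? λ y → (adj F x y Bool.≟ true) →-dec ¬? (eq? (c x y) nothing))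
    where eq? = Maybe.≡-dec (Fin._≟_ {w})

  coloured-clique-≤ : True proper? → ∀ {j} → EdgeClique F j → j ≤ w
  coloured-clique-≤ t = ProperColouring.clique-≤ {F} c (proj₁ ok)
      (λ {x} {y} {z} p q → proj₁ (proj₂ ok) x y z (λ n → case trans (≡-sym n) p of λ ()) (trans p (≡-sym q)))
      full
    where
      ok = toWitness t
      full : AllColoured {F} c
      full x y a with c x y in e
      ... | just l  = l , refl
      ... | nothing = ⊥-elim (proj₂ (proj₂ ok) x y a e)

colouring : ∀ F w → List (Fin (n F) × Fin (n F) × Fin w) → Colouring F w
colouring F w []                 = emptyCol {F}
colouring F w ((u , v , l) ∷ ms) = setCol {F} (colouring F w ms) u v l

-- Perfection of G is applied to the copy of F itself, with ω of F as the number of colours.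
imperfect : ∀ {F G w d} → OmegaL F w → Refute.bobWins F w d (emptyCol {F}) ≡ true →
            LineBminusPerfect G → ¬ EdgeSub F G
imperfect {F} {w = w} {d} ω e perfect sub = Refute.bob-wins F w d e (proj₁ (perfect F sub w ω))

-- The star at x is a clique of size w, and an explicit proper edge colouring with w colours bounds
-- all cliques from above.
ω-coloured : ∀ F w x → count (adj F x) ≡ w → (ms : List (Fin (n F) × Fin (n F) × Fin w)) →
             {_ : True (proper? F w (colouring F w ms))} → OmegaL F w
ω-coloured F w x e ms {p} = subst (EdgeClique F) e (Cliques.star F x) ,
  λ j → coloured-clique-≤ F w (colouring F w ms) p

-- Three edges of C₅ never meet pairwise, although its line graph is not 2-colourable.
ω-C5 : OmegaL C5 2
ω-C5 = Cliques.star C5 0F , at-most-2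
  where
    E = Fin 5 × Fin 5
    edge? : ∀ e → Dec (IsEdge C5 e)
    edge? (u , v) = (toℕ u ℕ.<? toℕ v) ×-dec (adj C5 u v Bool.≟ true)
    share? : ∀ (e f : E) → Dec (ShareEnd e f)
    share? (a , b) (c , d) = (a Fin.≟ c) ⊎-dec (a Fin.≟ d) ⊎-dec (b Fin.≟ c) ⊎-dec (b Fin.≟ d)
    same? : ∀ (e f : E) → Dec (e ≡ f)
    same? = Product.≡-dec Fin._≟_ Fin._≟_
    all-edges? : ∀ {P : E → Set} → (∀ e → Dec (P e)) → Dec (∀ a b → IsEdge C5 (a , b) → P (a , b))
    all-edges? P? = Fin.all? λ a → Fin.all? λ b → edge? (a , b) →-dec P? (a , b)
    Apart : E → E → E → Set
    Apart e f g = e ≢ f → ShareEnd e f → e ≢ g → ShareEnd e g → f ≢ g → ShareEnd f g → ⊥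
    no-triple : ∀ a b → IsEdge C5 (a , b) → ∀ c d → IsEdge C5 (c , d) → ∀ x y → IsEdge C5 (x , y) →
                Apart (a , b) (c , d) (x , y)
    no-triple = toWitness {a? = all-edges? λ e → all-edges? λ f → all-edges? λ g →
      ¬? (same? e f) →-dec (share? e f →-dec (¬? (same? e g) →-dec (share? e g →-dec
        (¬? (same? f g) →-dec (share? f g →-dec no λ ())))))} _
    at-most-2 : ∀ j → EdgeClique C5 j → j ≤ 2
    at-most-2 0 _ = z≤n
    at-most-2 1 _ = s≤s z≤n
    at-most-2 2 _ = s≤s (s≤s z≤n)
    at-most-2 (suc (suc (suc j))) (f , isEdge , inj , meet) =
      ⊥-elim (no-triple _ _ (isEdge 0F) _ _ (isEdge 1F) _ _ (isEdge 2F)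
        (λ e → case inj e of λ ()) (meet 0F 1F λ ())
        (λ e → case inj e of λ ()) (meet 0F 2F λ ())
        (λ e → case inj e of λ ()) (meet 1F 2F λ ()))

-- The lists are proper edge colourings with ω colours. C₅ has none with 2 colours, so its ω is
-- found separately. The depth d counts Bob's own moves: two suffice to spoil an edge, three in F₁.
perfect⇒noForbidden : ∀ G → LineBminusPerfect G → NoForbidden G
perfect⇒noForbidden G p =
  imperfect {P5∪P2} {G} {d = 2} (ω-coloured P5∪P2 2 1F refl
    ((0F , 1F , 0F) ∷ (1F , 2F , 1F) ∷ (2F , 3F , 0F) ∷ (3F , 4F , 1F) ∷ (5F , 6F , 0F) ∷ [])) refl p ,
  imperfect {C4∪P2} {G} {d = 2} (ω-coloured C4∪P2 2 1F refl
    ((0F , 1F , 0F) ∷ (1F , 2F , 1F) ∷ (2F , 3F , 0F) ∷ (3F , 0F , 1F) ∷ (4F , 5F , 0F) ∷ [])) refl p ,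
  imperfect {P6} {G} {d = 2} (ω-coloured P6 2 1F refl
    ((0F , 1F , 0F) ∷ (1F , 2F , 1F) ∷ (2F , 3F , 0F) ∷ (3F , 4F , 1F) ∷ (4F , 5F , 0F) ∷ [])) refl p ,
  imperfect {C5} {G} {d = 2} ω-C5 refl p ,
  imperfect {bull} {G} {d = 2} (ω-coloured bull 3 0F refl
    ((0F , 1F , 0F) ∷ (1F , 2F , 1F) ∷ (2F , 0F , 2F) ∷ (0F , 3F , 1F) ∷ (1F , 4F , 2F) ∷ [])) refl p ,
  imperfect {diamond} {G} {d = 2} (ω-coloured diamond 3 0F refl
    ((0F , 1F , 0F) ∷ (0F , 2F , 1F) ∷ (0F , 3F , 2F) ∷ (1F , 2F , 2F) ∷ (1F , 3F , 1F) ∷ [])) refl p ,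
  imperfect {F₁} {G} {d = 3} (ω-coloured F₁ 3 0F refl
    ((0F , 1F , 0F) ∷ (0F , 2F , 1F) ∷ (0F , 3F , 2F) ∷ (2F , 4F , 0F) ∷ (2F , 5F , 2F) ∷ (3F , 6F , 0F) ∷ (3F , 7F , 1F) ∷ [])) refl p

theorem11 : (G : Graph) →
    (LineBminusPerfect G ⇔ NoForbidden G) × (NoForbidden G ⇔ Structure G)
theorem11 G =
  mk⇔ (perfect⇒noForbidden G) (noForbidden⇒perfect G) ,
  mk⇔ (λ nf → shape⇒structure (shape G nf)) (structure⇒noForbidden G)
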